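{- Every randomized online algorithm for line aggregation with deadlines has competitive ratio at least $e$ against an oblivious adversary. That is, if $\mathcal{A}$ is a randomized online algorithm and $\rho\in\mathbb{R}$ is such that $\mathbb{E}[\mathrm{cost}(\mathcal{A})]\le \rho\cdot\mathrm{cost}(\mathrm{OPT})$ for every instance $I$, then $\rho\ge e$.
   Context: Line aggregation with deadlines (LAD). An instance $I$ is a finite sequence of requests; each request is a triple $r=(\tau,x,d)$ with release time $\tau\ge 0$, location $x>0$ and deadline $d\ge\tau$. A solution is a finite set of services $X=\{(t_1,x_1),\dots,(t_n,x_n)\}$, where $(t_i,x_i)$ is a service performed at time $t_i$ at location $x_i\in\mathbb{R}_{\ge0}$, at cost $x_i$. The solution $X$ is feasible if for every request $(\tau,x,d)$ there is $(t_i,x_i)\in X$ with $\tau\le t_i\le d$ and $x_i\ge x$. The cost of a solution is the sum of the costs of its services. $\mathrm{OPT}$ denotes a minimum-cost feasible (offline) solution for $I$, and $\mathrm{cost}(\mathcal{A})$ is the cost of the solution produced by $\mathcal{A}$ on $I$. Online algorithms. Requests are revealed at their release times (with their location and deadline); at equal times, releases are revealed before deadlines are processed. A deterministic online algorithm assigns to each instance a feasible solution such that the services performed at times $\le t$ depend only on the requests released at times $\le t$. A randomized online algorithm is a probability distribution over deterministic online algorithms, and the expectation is over its random choices. An oblivious adversary fixes the whole instance independently of these random choices. -}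

module Defs where

open import Level using (Level; 0ℓ) renaming (suc to lsuc; _⊔_ to _⊔ˡ_)
open import Data.Product using (∃-syntax; _×_; _,_)
open import Data.Nat as ℕ using (ℕ; zero; suc; _!)
import Data.Nat.Properties as ℕ
import Data.Integer as ℤ
import Data.Integer.Properties as ℤ
open import Data.Rational as ℚ using (ℚ; 0ℚ; 1ℚ; ½; mkℚ)
import Data.Rational.Properties as ℚ
import Data.Rational.Unnormalised as ℚᵘ
import Data.Rational.Unnormalised.Properties as ℚᵘ
open import Algebra.Bundles using (CommutativeMonoid)
import Algebra.Properties.CommutativeSemigroup as CommutativeSemigroup
import Algebra.Properties.Group as GroupProperties
open import Data.List using (List; []; _∷_; map; foldr)
open import Data.List.Relation.Unary.All using (All)
open import Data.List.Relation.Unary.Any using (Any)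
open import Data.List.Relation.Unary.AllPairs using (AllPairs)
open import Data.Sum using (inj₁; inj₂)
open import Relation.Nullary using (¬_)
open import Relation.Unary using (Pred; U; ∁; ⋂; _⊥_; _≐_)
open import Relation.Binary.PropositionalEquality

IsCauchy : (ℕ → ℚ) → Set
IsCauchy s = ∀ ε → 0ℚ ℚ.< ε →
  ∃[ N ] (∀ m n → N ℕ.≤ m → N ℕ.≤ n → ℚ.∣ s m ℚ.- s n ∣ ℚ.< ε)

-- Reals are Cauchy sequences of rationals, with the field operations taken
-- termwise; equality of reals is _≈_, never _≡_.
record ℝ : Set where
  constructor mkℝ
  field
    seq      : ℕ → ℚ
    isCauchy : IsCauchy seq

open ℝ public

infix 4 _≤_ _<_ _≈_

_≤_ : ℝ → ℝ → Set
x ≤ y = ∀ ε → 0ℚ ℚ.< ε → ∃[ N ] (∀ n → N ℕ.≤ n → seq x n ℚ.≤ seq y n ℚ.+ ε)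

_<_ : ℝ → ℝ → Set
x < y = ∃[ ε ] (0ℚ ℚ.< ε × ∃[ N ] (∀ n → N ℕ.≤ n → seq x n ℚ.+ ε ℚ.≤ seq y n))

_≈_ : ℝ → ℝ → Set
x ≈ y = x ≤ y × y ≤ x

fromℚ : ℚ → ℝ
fromℚ q = mkℝ (λ _ → q) λ ε 0<ε → 0 , λ _ _ _ _ →
  subst (ℚ._< ε) (sym (cong ℚ.∣_∣ (ℚ.+-inverseʳ q))) 0<ε

0ℝ 1ℝ : ℝ
0ℝ = fromℚ 0ℚ
1ℝ = fromℚ 1ℚ

private
  open CommutativeSemigroup (CommutativeMonoid.commutativeSemigroup ℚ.+-0-commutativeMonoid)
    using (interchange)

  p-q+q≡p : ∀ p q → (p ℚ.- q) ℚ.+ q ≡ p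
  p-q+q≡p p q = trans (ℚ.+-assoc p (ℚ.- q) q)
    (trans (cong (p ℚ.+_) (ℚ.+-inverseˡ q)) (ℚ.+-identityʳ p))

  +-difference : ∀ a b c d → (a ℚ.+ b) ℚ.- (c ℚ.+ d) ≡ (a ℚ.- c) ℚ.+ (b ℚ.- d)
  +-difference a b c d = trans (cong ((a ℚ.+ b) ℚ.+_) (ℚ.neg-distrib-+ c d))
    (interchange a b (ℚ.- c) (ℚ.- d))

  *-distribˡ-- : ∀ p q r → p ℚ.* (q ℚ.- r) ≡ p ℚ.* q ℚ.- p ℚ.* r
  *-distribˡ-- p q r = trans (ℚ.*-distribˡ-+ p q (ℚ.- r))
    (cong (p ℚ.* q ℚ.+_) (sym (ℚ.neg-distribʳ-* p r)))

  *-difference : ∀ a b c d → a ℚ.* b ℚ.- c ℚ.* d ≡ a ℚ.* (b ℚ.- d) ℚ.+ d ℚ.* (a ℚ.- c)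
  *-difference a b c d = sym (begin
    a ℚ.* (b ℚ.- d) ℚ.+ d ℚ.* (a ℚ.- c)
      ≡⟨ cong₂ ℚ._+_ (*-distribˡ-- a b d) (*-distribˡ-- d a c) ⟩
    (a ℚ.* b ℚ.- a ℚ.* d) ℚ.+ (d ℚ.* a ℚ.- d ℚ.* c)
      ≡⟨ cong₂ (λ x y → (a ℚ.* b ℚ.- a ℚ.* d) ℚ.+ (x ℚ.- y)) (ℚ.*-comm d a) (ℚ.*-comm d c) ⟩
    (a ℚ.* b ℚ.- a ℚ.* d) ℚ.+ (a ℚ.* d ℚ.- c ℚ.* d)
      ≡⟨ sym (ℚ.+-assoc (a ℚ.* b ℚ.- a ℚ.* d) (a ℚ.* d) (ℚ.- (c ℚ.* d))) ⟩
    ((a ℚ.* b ℚ.- a ℚ.* d) ℚ.+ a ℚ.* d) ℚ.- c ℚ.* d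
      ≡⟨ cong (ℚ._- c ℚ.* d) (p-q+q≡p (a ℚ.* b) (a ℚ.* d)) ⟩
    a ℚ.* b ℚ.- c ℚ.* d ∎)
    where open ≡-Reasoning

  half+half : ∀ ε → ε ℚ.* ½ ℚ.+ ε ℚ.* ½ ≡ ε
  half+half ε = trans (sym (ℚ.*-distribˡ-+ ε ½ ½)) (ℚ.*-identityʳ ε)

  0<half : ∀ {ε} → 0ℚ ℚ.< ε → 0ℚ ℚ.< ε ℚ.* ½
  0<half {ε} 0<ε = subst (ℚ._< ε ℚ.* ½) (ℚ.*-zeroˡ ½) (ℚ.*-monoˡ-<-pos ½ 0<ε)

  cauchy-+ : ∀ s t → IsCauchy s → IsCauchy t → IsCauchy (λ n → s n ℚ.+ t n)
  cauchy-+ s t cs ct ε 0<ε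
    with cs (ε ℚ.* ½) (0<half 0<ε) | ct (ε ℚ.* ½) (0<half 0<ε)
  ... | M , hs | N , ht = M ℕ.⊔ N , λ m n p q → begin-strict
    ℚ.∣ (s m ℚ.+ t m) ℚ.- (s n ℚ.+ t n) ∣
      ≡⟨ cong ℚ.∣_∣ (+-difference (s m) (t m) (s n) (t n)) ⟩
    ℚ.∣ (s m ℚ.- s n) ℚ.+ (t m ℚ.- t n) ∣
      ≤⟨ ℚ.∣p+q∣≤∣p∣+∣q∣ (s m ℚ.- s n) (t m ℚ.- t n) ⟩
    ℚ.∣ s m ℚ.- s n ∣ ℚ.+ ℚ.∣ t m ℚ.- t n ∣
      <⟨ ℚ.+-mono-< (hs m n (ℕ.m⊔n≤o⇒m≤o M N p) (ℕ.m⊔n≤o⇒m≤o M N q))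
                    (ht m n (ℕ.m⊔n≤o⇒n≤o M N p) (ℕ.m⊔n≤o⇒n≤o M N q)) ⟩
    ε ℚ.* ½ ℚ.+ ε ℚ.* ½
      ≡⟨ half+half ε ⟩
    ε ∎
    where open ℚ.≤-Reasoning

  cauchy-bounded : ∀ s → IsCauchy s →
    ∃[ b ] (0ℚ ℚ.< b × ∃[ N ] (∀ n → N ℕ.≤ n → ℚ.∣ s n ∣ ℚ.≤ b))
  cauchy-bounded s cs with cs 1ℚ (ℚ.positive⁻¹ 1ℚ)
  ... | N , h = 1ℚ ℚ.+ ℚ.∣ s N ∣ , 0<b , N , λ n p → begin
    ℚ.∣ s n ∣
      ≡⟨ cong ℚ.∣_∣ (sym (p-q+q≡p (s n) (s N))) ⟩
    ℚ.∣ (s n ℚ.- s N) ℚ.+ s N ∣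
      ≤⟨ ℚ.∣p+q∣≤∣p∣+∣q∣ (s n ℚ.- s N) (s N) ⟩
    ℚ.∣ s n ℚ.- s N ∣ ℚ.+ ℚ.∣ s N ∣
      ≤⟨ ℚ.+-monoˡ-≤ ℚ.∣ s N ∣ (ℚ.<⇒≤ (h n N p ℕ.≤-refl)) ⟩
    1ℚ ℚ.+ ℚ.∣ s N ∣ ∎
    where
    open ℚ.≤-Reasoning
    0<b : 0ℚ ℚ.< 1ℚ ℚ.+ ℚ.∣ s N ∣
    0<b = ℚ.+-mono-<-≤ (ℚ.positive⁻¹ 1ℚ) (ℚ.0≤∣p∣ (s N))

  cauchy-* : ∀ s t → IsCauchy s → IsCauchy t → IsCauchy (λ n → s n ℚ.* t n)
  cauchy-* s t cs ct ε 0<ε =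
    let (a , 0<a , Na , ha) = cauchy-bounded s cs
        (b , 0<b , Nb , hb) = cauchy-bounded t ct
        (δ , 0<δ , δ-eq)    = share (a ℚ.+ b) (ℚ.+-mono-< 0<a 0<b)
        (Ms , hs)           = cs δ 0<δ
        (Mt , ht)           = ct δ 0<δ
    in estimate a b δ Na Nb Ms Mt 0<a 0<b δ-eq ha hb hs ht
    where
    share : ∀ c → 0ℚ ℚ.< c → ∃[ δ ] (0ℚ ℚ.< δ × δ ℚ.* c ≡ ε)
    share c 0<c = δ , ℚ.positive⁻¹ δ {{ℚ.pos*pos⇒pos ε {{ℚ.positive 0<ε}} (ℚ.1/ c) {{ℚ.1/pos⇒pos c}}}} ,
      trans (ℚ.*-assoc ε (ℚ.1/ c) c) (trans (cong (ε ℚ.*_) (ℚ.*-inverseˡ c)) (ℚ.*-identityʳ ε))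
      where
      instance
        c>0 : ℚ.Positive c
        c>0 = ℚ.positive 0<c
        c≢0 : ℚ.NonZero c
        c≢0 = ℚ.pos⇒nonZero c
      δ = ε ℚ.* ℚ.1/ c

    estimate : ∀ a b δ Na Nb Ms Mt → 0ℚ ℚ.< a → 0ℚ ℚ.< b → δ ℚ.* (a ℚ.+ b) ≡ ε →
      (∀ n → Na ℕ.≤ n → ℚ.∣ s n ∣ ℚ.≤ a) → (∀ n → Nb ℕ.≤ n → ℚ.∣ t n ∣ ℚ.≤ b) →
      (∀ m n → Ms ℕ.≤ m → Ms ℕ.≤ n → ℚ.∣ s m ℚ.- s n ∣ ℚ.< δ) →
      (∀ m n → Mt ℕ.≤ m → Mt ℕ.≤ n → ℚ.∣ t m ℚ.- t n ∣ ℚ.< δ) →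
      ∃[ N ] (∀ m n → N ℕ.≤ m → N ℕ.≤ n → ℚ.∣ s m ℚ.* t m ℚ.- s n ℚ.* t n ∣ ℚ.< ε)
    estimate a b δ Na Nb Ms Mt 0<a 0<b δ-eq ha hb hs ht = N , bound
      where
      open ℚ.≤-Reasoning
      instance
        a>0 : ℚ.Positive a
        a>0 = ℚ.positive 0<a
        b>0 : ℚ.Positive b
        b>0 = ℚ.positive 0<b
      N = (Na ℕ.⊔ Nb) ℕ.⊔ (Ms ℕ.⊔ Mt)
      module _ {n} (p : N ℕ.≤ n) where
        l = ℕ.m⊔n≤o⇒m≤o (Na ℕ.⊔ Nb) (Ms ℕ.⊔ Mt) p
        r = ℕ.m⊔n≤o⇒n≤o (Na ℕ.⊔ Nb) (Ms ℕ.⊔ Mt) p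
        pa = ℕ.m⊔n≤o⇒m≤o Na Nb l
        pb = ℕ.m⊔n≤o⇒n≤o Na Nb l
        ps = ℕ.m⊔n≤o⇒m≤o Ms Mt r
        pt = ℕ.m⊔n≤o⇒n≤o Ms Mt r
      bound : ∀ m n → N ℕ.≤ m → N ℕ.≤ n → ℚ.∣ s m ℚ.* t m ℚ.- s n ℚ.* t n ∣ ℚ.< ε
      bound m n p q = begin-strict
        ℚ.∣ s m ℚ.* t m ℚ.- s n ℚ.* t n ∣
          ≡⟨ cong ℚ.∣_∣ (*-difference (s m) (t m) (s n) (t n)) ⟩
        ℚ.∣ s m ℚ.* (t m ℚ.- t n) ℚ.+ t n ℚ.* (s m ℚ.- s n) ∣
          ≤⟨ ℚ.∣p+q∣≤∣p∣+∣q∣ (s m ℚ.* (t m ℚ.- t n)) (t n ℚ.* (s m ℚ.- s n)) ⟩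
        ℚ.∣ s m ℚ.* (t m ℚ.- t n) ∣ ℚ.+ ℚ.∣ t n ℚ.* (s m ℚ.- s n) ∣
          ≡⟨ cong₂ ℚ._+_ (ℚ.∣p*q∣≡∣p∣*∣q∣ (s m) (t m ℚ.- t n)) (ℚ.∣p*q∣≡∣p∣*∣q∣ (t n) (s m ℚ.- s n)) ⟩
        ℚ.∣ s m ∣ ℚ.* dt ℚ.+ ℚ.∣ t n ∣ ℚ.* ds
          ≤⟨ ℚ.+-mono-≤ (ℚ.*-monoʳ-≤-nonNeg dt {{ℚ.∣-∣-nonNeg (t m ℚ.- t n)}} (ha m (pa p)))
                        (ℚ.*-monoʳ-≤-nonNeg ds {{ℚ.∣-∣-nonNeg (s m ℚ.- s n)}} (hb n (pb q))) ⟩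
        a ℚ.* dt ℚ.+ b ℚ.* ds
          <⟨ ℚ.+-mono-< (ℚ.*-monoʳ-<-pos a (ht m n (pt p) (pt q)))
                        (ℚ.*-monoʳ-<-pos b (hs m n (ps p) (ps q))) ⟩
        a ℚ.* δ ℚ.+ b ℚ.* δ
          ≡⟨ sym (ℚ.*-distribʳ-+ δ a b) ⟩
        (a ℚ.+ b) ℚ.* δ
          ≡⟨ ℚ.*-comm (a ℚ.+ b) δ ⟩
        δ ℚ.* (a ℚ.+ b)
          ≡⟨ δ-eq ⟩
        ε ∎
        where
        dt = ℚ.∣ t m ℚ.- t n ∣
        ds = ℚ.∣ s m ℚ.- s n ∣

infixl 6 _+_
infixl 7 _*_

_+_ : ℝ → ℝ → ℝ
x + y = mkℝ (λ n → seq x n ℚ.+ seq y n) (cauchy-+ (seq x) (seq y) (isCauchy x) (isCauchy y))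

_*_ : ℝ → ℝ → ℝ
x * y = mkℝ (λ n → seq x n ℚ.* seq y n) (cauchy-* (seq x) (seq y) (isCauchy x) (isCauchy y))

sum : List ℝ → ℝ
sum = foldr _+_ 0ℝ

infix 4 _⟶_

_⟶_ : (ℕ → ℝ) → ℝ → Set
xs ⟶ x = ∀ ε → 0ℚ ℚ.< ε →
  ∃[ N ] (∀ n → N ℕ.≤ n → xs n ≤ x + fromℚ ε × x ≤ xs n + fromℚ ε)

partialSum : (ℕ → ℝ) → ℕ → ℝ
partialSum xs zero    = 0ℝ
partialSum xs (suc n) = partialSum xs n + xs n

IsSupremum : ∀ {ℓ} → Pred ℝ ℓ → ℝ → Set ℓ
IsSupremum S c = (∀ x → S x → x ≤ c) × (∀ u → (∀ x → S x → x ≤ u) → c ≤ u)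

1/[_]! : ℕ → ℚ
1/[ k ]! = (ℤ.+ 1 ℚ./ (k !)) {{ℕ._!≢0 k}}

e-seq : ℕ → ℚ
e-seq zero    = 1/[ 0 ]!
e-seq (suc n) = e-seq n ℚ.+ 1/[ suc n ]!

private
  1/suc : ℕ → ℚ
  1/suc n = ℤ.+ 1 ℚ./ suc n

  1/-as-ℚᵘ : ∀ d .{{_ : ℕ.NonZero d}} → ℚ.toℚᵘ (ℤ.+ 1 ℚ./ d) ℚᵘ.≃ (ℤ.+ 1 ℚᵘ./ d)
  1/-as-ℚᵘ (suc d) = ℚ.toℚᵘ-fromℚᵘ (ℚᵘ.mkℚᵘ (ℤ.+ 1) d)

  archimedean : ∀ ε → 0ℚ ℚ.< ε → ∃[ N ] 1/suc N ℚ.< ε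
  archimedean ε 0<ε with ℚ.positive 0<ε
  archimedean (mkℚ (ℤ.+ suc k) d c) 0<ε | _ = suc d , ℚ.toℚᵘ-cancel-< (begin-strict
    ℚ.toℚᵘ (1/suc (suc d))
      ≃⟨ 1/-as-ℚᵘ (suc (suc d)) ⟩
    ℚᵘ.mkℚᵘ (ℤ.+ 1) (suc d)
      <⟨ ℚᵘ.*<* (ℤ.+<+ (ℕ.≤-trans (ℕ.≤-reflexive (cong suc (ℕ.*-identityˡ (suc d))))
                                   (ℕ.m≤m+n (suc (suc d)) (k ℕ.* suc (suc d))))) ⟩
    ℚᵘ.mkℚᵘ (ℤ.+ suc k) d ∎)
    where open ℚᵘ.≤-Reasoning

  0≤1/! : ∀ k → 0ℚ ℚ.≤ 1/[ k ]!
  0≤1/! k = ℚ.nonNegative⁻¹ 1/[ k ]! {{ℚ.normalize-nonNeg 1 (k !) {{ℕ._!≢0 k}}}}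

  1/!-bound : ∀ n → 1/suc (suc n) ℚ.+ 1/[ suc (suc n) ]! ℚ.≤ 1/suc n
  1/!-bound n = ℚ.toℚᵘ-cancel-≤ (begin
    ℚ.toℚᵘ (1/suc (suc n) ℚ.+ 1/[ 2+n ]!)
      ≃⟨ ℚ.toℚᵘ-homo-+ (1/suc (suc n)) 1/[ 2+n ]! ⟩
    ℚ.toℚᵘ (1/suc (suc n)) ℚᵘ.+ ℚ.toℚᵘ 1/[ 2+n ]!
      ≃⟨ ℚᵘ.+-cong (1/-as-ℚᵘ 2+n) (1/-as-ℚᵘ F {{ℕ._!≢0 2+n}}) ⟩
    (ℤ.+ 1 ℚᵘ./ 2+n) ℚᵘ.+ (ℤ.+ 1 ℚᵘ./ F) {{ℕ._!≢0 2+n}}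
      ≤⟨ fractions F {{ℕ._!≢0 2+n}} (ℕ.*-monoʳ-≤ 2+n (ℕ.m≤m*n (suc n) (n !) {{ℕ._!≢0 n}})) ⟩
    ℤ.+ 1 ℚᵘ./ suc n
      ≃⟨ ℚᵘ.≃-sym (1/-as-ℚᵘ (suc n)) ⟩
    ℚ.toℚᵘ (1/suc n) ∎)
    where
    open ℚᵘ.≤-Reasoning
    2+n = suc (suc n)
    F   = 2+n !

    numerators : ∀ G → 2+n ℕ.* suc n ℕ.≤ G → (1 ℕ.* G ℕ.+ 1 ℕ.* 2+n) ℕ.* suc n ℕ.≤ 1 ℕ.* (2+n ℕ.* G)
    numerators G h = ℕ.≤-trans (ℕ.≤-reflexive lhs) (ℕ.≤-trans (ℕ.+-monoʳ-≤ (G ℕ.* suc n) h) (ℕ.≤-reflexive rhs))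
      where
      lhs : (1 ℕ.* G ℕ.+ 1 ℕ.* 2+n) ℕ.* suc n ≡ G ℕ.* suc n ℕ.+ 2+n ℕ.* suc n
      lhs = trans (cong₂ (λ x y → (x ℕ.+ y) ℕ.* suc n) (ℕ.*-identityˡ G) (ℕ.*-identityˡ 2+n))
                  (ℕ.*-distribʳ-+ (suc n) G 2+n)
      rhs : G ℕ.* suc n ℕ.+ G ≡ 1 ℕ.* (2+n ℕ.* G)
      rhs = trans (ℕ.+-comm (G ℕ.* suc n) G) (trans (cong (G ℕ.+_) (ℕ.*-comm G (suc n)))
                  (sym (ℕ.*-identityˡ (2+n ℕ.* G))))

    fractions : ∀ G .{{_ : ℕ.NonZero G}} → 2+n ℕ.* suc n ℕ.≤ G →
                (ℤ.+ 1 ℚᵘ./ 2+n) ℚᵘ.+ (ℤ.+ 1 ℚᵘ./ G) ℚᵘ.≤ (ℤ.+ 1 ℚᵘ./ suc n)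
    fractions (suc g) h = ℚᵘ.*≤* (ℤ.+≤+ (numerators (suc g) h))

  e-seq-≤ : ∀ n k → e-seq n ℚ.≤ e-seq (k ℕ.+ n)
  e-seq-≤ n zero    = ℚ.≤-refl
  e-seq-≤ n (suc k) = ℚ.≤-trans (e-seq-≤ n k)
    (subst (ℚ._≤ e-seq (suc k ℕ.+ n)) (ℚ.+-identityʳ (e-seq (k ℕ.+ n)))
      (ℚ.+-monoʳ-≤ (e-seq (k ℕ.+ n)) (0≤1/! (suc k ℕ.+ n))))

  e-seq-+ : ∀ n k → e-seq (suc (k ℕ.+ n)) ℚ.+ 1/suc (k ℕ.+ n) ℚ.≤ e-seq (suc n) ℚ.+ 1/suc n
  e-seq-+ n zero    = ℚ.≤-refl
  e-seq-+ n (suc k) = begin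
    (e-seq m ℚ.+ 1/[ suc m ]!) ℚ.+ 1/suc m
      ≡⟨ ℚ.+-assoc (e-seq m) 1/[ suc m ]! (1/suc m) ⟩
    e-seq m ℚ.+ (1/[ suc m ]! ℚ.+ 1/suc m)
      ≡⟨ cong (e-seq m ℚ.+_) (ℚ.+-comm 1/[ suc m ]! (1/suc m)) ⟩
    e-seq m ℚ.+ (1/suc m ℚ.+ 1/[ suc m ]!)
      ≤⟨ ℚ.+-monoʳ-≤ (e-seq m) (1/!-bound (k ℕ.+ n)) ⟩
    e-seq m ℚ.+ 1/suc (k ℕ.+ n)
      ≤⟨ e-seq-+ n k ⟩
    e-seq (suc n) ℚ.+ 1/suc n ∎
    where
    open ℚ.≤-Reasoning
    m = suc (k ℕ.+ n)

  difference-≤ : ∀ {a u x y} → a ℚ.≤ y → x ℚ.≤ a ℚ.+ u → x ℚ.- y ℚ.≤ u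
  difference-≤ {a} {u} {x} {y} a≤y x≤a+u = begin
    x ℚ.- y          ≤⟨ ℚ.+-mono-≤ x≤a+u (ℚ.neg-antimono-≤ a≤y) ⟩
    (a ℚ.+ u) ℚ.- a  ≡⟨ cong (ℚ._- a) (ℚ.+-comm a u) ⟩
    (u ℚ.+ a) ℚ.- a  ≡⟨ ℚ.+-assoc u a (ℚ.- a) ⟩
    u ℚ.+ (a ℚ.- a)  ≡⟨ cong (u ℚ.+_) (ℚ.+-inverseʳ a) ⟩
    u ℚ.+ 0ℚ         ≡⟨ ℚ.+-identityʳ u ⟩
    u                ∎
    where open ℚ.≤-Reasoning

  e-cauchy : IsCauchy e-seq
  e-cauchy ε 0<ε with archimedean ε 0<ε
  ... | N , 1/N<ε = suc N , λ m n p q → ℚ.≤-<-trans (close m n p q) 1/N<ε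
    where
    lower : ∀ m → suc N ℕ.≤ m → e-seq (suc N) ℚ.≤ e-seq m
    lower m p = subst (λ j → e-seq (suc N) ℚ.≤ e-seq j) (ℕ.m∸n+n≡m p) (e-seq-≤ (suc N) (m ℕ.∸ suc N))

    upper : ∀ m → suc N ℕ.≤ m → e-seq m ℚ.≤ e-seq (suc N) ℚ.+ 1/suc N
    upper m p = subst (λ j → e-seq j ℚ.≤ e-seq (suc N) ℚ.+ 1/suc N) (ℕ.m∸n+n≡m p)
      (ℚ.≤-trans (subst (ℚ._≤ e-seq (k ℕ.+ suc N) ℚ.+ 1/suc (k ℕ.+ N)) (ℚ.+-identityʳ (e-seq (k ℕ.+ suc N)))
                   (ℚ.+-monoʳ-≤ (e-seq (k ℕ.+ suc N)) (ℚ.nonNegative⁻¹ (1/suc (k ℕ.+ N))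
                     {{ℚ.normalize-nonNeg 1 (suc (k ℕ.+ N))}})))
                 (subst (λ j → e-seq j ℚ.+ 1/suc (k ℕ.+ N) ℚ.≤ e-seq (suc N) ℚ.+ 1/suc N)
                   (sym (ℕ.+-suc k N)) (e-seq-+ N k)))
      where k = m ℕ.∸ suc N

    close : ∀ m n → suc N ℕ.≤ m → suc N ℕ.≤ n → ℚ.∣ e-seq m ℚ.- e-seq n ∣ ℚ.≤ 1/suc N
    close m n p q with ℚ.∣p∣≡p∨∣p∣≡-p (e-seq m ℚ.- e-seq n)
    ... | inj₁ eq = subst (ℚ._≤ 1/suc N) (sym eq) (difference-≤ (lower n q) (upper m p))
    ... | inj₂ eq = subst (ℚ._≤ 1/suc N) (sym (trans eq swap)) (difference-≤ (lower m p) (upper n q))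
      where
      swap : ℚ.- (e-seq m ℚ.- e-seq n) ≡ e-seq n ℚ.- e-seq m
      swap = trans (ℚ.neg-distrib-+ (e-seq m) (ℚ.- e-seq n))
        (trans (cong (ℚ.- e-seq m ℚ.+_) (⁻¹-involutive (e-seq n)))
               (ℚ.+-comm (ℚ.- e-seq m) (e-seq n)))
        where open GroupProperties ℚ.+-0-group using (⁻¹-involutive)

e : ℝ
e = mkℝ e-seq e-cauchy

record Request : Set where
  field
    release location deadline : ℝ
    0≤release        : 0ℝ ≤ release
    0<location       : 0ℝ < location
    release≤deadline : release ≤ deadline

open Request public

Instance : Set
Instance = List Request

record Service : Set where
  field
    time place : ℝ
    0≤place    : 0ℝ ≤ place

open Service public

infix 4 _≈ʳ_ _≈ˢ_ _∈ˢ_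

_≈ʳ_ : Request → Request → Set
r ≈ʳ r′ = release r ≈ release r′ × location r ≈ location r′ × deadline r ≈ deadline r′

_≈ˢ_ : Service → Service → Set
s ≈ˢ s′ = time s ≈ time s′ × place s ≈ place s′

-- A finite set of services is a list without repetitions; the order of
-- the list carries no meaning.
record Solution : Set where
  field
    services : List Service
    distinct : AllPairs (λ s s′ → ¬ s ≈ˢ s′) services

open Solution public

_∈ˢ_ : Service → Solution → Set
s ∈ˢ X = Any (s ≈ˢ_) (services X)

cost : Solution → ℝ
cost X = sum (map place (services X))

_Serves_ : Service → Request → Set
s Serves r = release r ≤ time s × time s ≤ deadline r × location r ≤ place s

Feasible : Instance → Solution → Set
Feasible I X = All (λ r → Any (_Serves r) (services X)) I

IsOPT : Instance → Solution → Set
IsOPT I X = Feasible I X × (∀ Y → Feasible I Y → cost X ≤ cost Y)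

-- The subsequences of I and J consisting of the requests released at times
-- ≤ t are equal; requests released later can be dropped on either side.
-- A service at time t may thus depend on requests released exactly at t.
data SameUpTo (t : ℝ) : Instance → Instance → Set where
  []    : SameUpTo t [] []
  both  : ∀ {r r′ I J} → r ≈ʳ r′ → SameUpTo t I J → SameUpTo t (r ∷ I) (r′ ∷ J)
  skipˡ : ∀ {r I J} → t < release r → SameUpTo t I J → SameUpTo t (r ∷ I) J
  skipʳ : ∀ {r I J} → t < release r → SameUpTo t I J → SameUpTo t I (r ∷ J)

-- SameUpTo is symmetric, so `online` makes the two sets of services at
-- times ≤ t equal.
record DeterministicAlgorithm : Set where
  field
    run      : Instance → Solution
    feasible : ∀ I → Feasible I (run I)
    online   : ∀ t I J → SameUpTo t I J →
               ∀ s → time s ≤ t → s ∈ˢ run I → s ∈ˢ run J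

open DeterministicAlgorithm public

-- Since excluded middle is not assumed, the union of a sequence of events
-- is taken to be the complement of the intersection of the complements.
⋃ᶜ : ∀ {Ω : Set} → (ℕ → Pred Ω 0ℓ) → Pred Ω 0ℓ
⋃ᶜ A = ∁ (⋂ ℕ (λ n → ∁ (A n)))

record ProbabilityMeasure (Ω : Set) (ℓ : Level) : Set (lsuc 0ℓ ⊔ˡ lsuc ℓ) where
  field
    Event    : Pred (Pred Ω 0ℓ) ℓ
    Event-≐  : ∀ {A B} → A ≐ B → Event A → Event B
    Event-U  : Event U
    Event-∁  : ∀ {A} → Event A → Event (∁ A)
    Event-⋂  : ∀ {A : ℕ → Pred Ω 0ℓ} → (∀ n → Event (A n)) → Event (⋂ ℕ A)
    ℙ        : ∀ A → Event A → ℝ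
    ℙ-nonNeg : ∀ A (a : Event A) → 0ℝ ≤ ℙ A a
    ℙ-U      : ∀ (u : Event U) → ℙ U u ≈ 1ℝ
    ℙ-⋃      : ∀ (A : ℕ → Pred Ω 0ℓ) (a : ∀ n → Event (A n)) →
               (∀ m n → m ≢ n → A m ⊥ A n) →
               ∀ B (b : Event B) → B ≐ ⋃ᶜ A →
               partialSum (λ n → ℙ (A n) (a n)) ⟶ ℙ B b

module _ {Ω : Set} {ℓ : Level} (P : ProbabilityMeasure Ω ℓ) where
  open ProbabilityMeasure P

  Measurable : (Ω → ℝ) → Set ℓ
  Measurable f = ∀ x → Event (λ ω → f ω ≤ x)

  record Step : Set (lsuc 0ℓ ⊔ˡ ℓ) where
    field
      set     : Pred Ω 0ℓ
      isEvent : Event set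
      value   : ℝ

  open Step

  -- A nonnegative simple function below f, given by finitely many
  -- pairwise disjoint events and its values on them; it is 0 elsewhere.
  record SimpleBelow (f : Ω → ℝ) : Set (lsuc 0ℓ ⊔ˡ ℓ) where
    field
      steps    : List Step
      disjoint : AllPairs (λ S T → set S ⊥ set T) steps
      nonNeg   : All (λ S → 0ℝ ≤ value S) steps
      below    : All (λ S → ∀ ω → set S ω → value S ≤ f ω) steps

  integral : List Step → ℝ
  integral steps = sum (map (λ S → value S * ℙ (set S) (isEvent S)) steps)

  -- 𝔼[ f ] = c, as a Lebesgue integral of a nonnegative measurable f: the
  -- supremum of the integrals of the simple functions below f. When 𝔼[ f ]
  -- is infinite, no c satisfies this.
  IsExpectation : (Ω → ℝ) → ℝ → Set (lsuc 0ℓ ⊔ˡ ℓ)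
  IsExpectation f = IsSupremum (λ x → ∃[ φ ] x ≈ integral (SimpleBelow.steps {f} φ))

-- The only events required beyond the σ-algebra axioms are those that make
-- the cost on each instance a random variable.
record RandomizedAlgorithm (ℓ : Level) : Set (lsuc 0ℓ ⊔ˡ lsuc ℓ) where
  field
    distribution    : ProbabilityMeasure DeterministicAlgorithm ℓ
    cost-measurable : ∀ I → Measurable distribution (λ A → cost (run A I))

open RandomizedAlgorithm public

IsExpectedCost : ∀ {ℓ} → RandomizedAlgorithm ℓ → Instance → ℝ → Set (lsuc 0ℓ ⊔ˡ ℓ)
IsExpectedCost 𝒜 I = IsExpectation (distribution 𝒜) (λ A → cost (run A I))

module Submission where

-- A phase releases, all at once, requests at the locations 1, q, ..., q^ℓ, the farther ones with
-- the later deadlines; after a random number of these deadlines the next phase starts, before the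
-- following deadline. If the phase is cut short after the deadline of q^T, the offline solution
-- serves q^T when the phase starts and leaves the rest to one final service at q^ℓ, so its cost
-- is the sum of the q^T plus q^ℓ. The algorithm does not know T and plays online bidding: its
-- services in the phase must have covered q^k by the k-th deadline.
-- Let q = 1 + 1/n, u = 1/(n+1), and let T be geometric with ratio 1 - u = 1/q, truncated at ℓ. Then
-- q^T has mean 1 + ℓ u, while any bidding costs at least (ℓ + 1) u q^n on average, because q^d / (d+1)
-- is smallest at d = n; and q^(n+1) ≥ 1 + 1 + 1/2! + ... + 1/M! for every M. So the ratio of the mean
-- costs comes arbitrarily close to e for suitable n, ℓ and many phases, and a bound on the ratio
-- for every instance is a bound on the ratio of the means.
-- Since ≤ on the reals is ¬¬-stable, finitely many undecidable case distinctions are harmless.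

open import Defs
open import Data.Product using (_×_; ∃-syntax)
open import Data.Product using (_,_; proj₁; proj₂)
open import Level using (0ℓ) renaming (suc to lsuc; _⊔_ to _⊔ˡ_)
open import Algebra.Bundles using (CommutativeRing)
open import Data.Empty using (⊥-elim)
open import Data.Fin as Fin using (Fin; zero; suc; toℕ)
import Data.Fin.Properties as Fin
import Data.Integer as ℤ
import Data.Integer.Properties as ℤ
open import Data.List using (List; []; _∷_; map; _++_; tabulate)
open import Data.List.Membership.Propositional using (find) renaming (_∈_ to _∈ₗ_)
import Data.List.Properties as List
open import Data.List.Relation.Unary.All as All using (All; []; _∷_)
import Data.List.Relation.Unary.All.Properties as All
open import Data.List.Relation.Unary.AllPairs using (AllPairs; []; _∷_)
open import Data.List.Relation.Unary.Any as Any using (Any; here; there)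
open import Data.Nat as ℕ using (ℕ; zero; suc; _!)
import Data.Nat.Properties as ℕ
open import Data.Rational as ℚ using (ℚ; 0ℚ; 1ℚ; ½; mkℚ)
import Data.Rational.Properties as ℚ
open import Data.Rational.Solver using (module +-*-Solver)
import Data.Rational.Unnormalised as ℚᵘ
import Data.Rational.Unnormalised.Properties as ℚᵘ
open import Data.Sum using (_⊎_; inj₁; inj₂; [_,_]′)
open import Data.Unit using (tt)
open import Data.Vec using (Vec; []; _∷_; replicate)
open import Function using (_∘_)
open import Relation.Binary.Bundles using (Preorder)
open import Relation.Binary.PropositionalEquality hiding ([_])
import Relation.Binary.Reasoning.Preorder
open import Relation.Nullary using (¬_; Dec; yes; no)
open import Relation.Nullary.Decidable using (decidable-stable; ¬¬-excluded-middle)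
open import Relation.Unary using (Pred; U; ∁; _⊥_)

open import Algebra.Properties.Semiring.Exp (CommutativeRing.semiring ℚ.+-*-commutativeRing)
  using (_^_; ^-homo-*)
open +-*-Solver using (solve; _:=_; _:+_; _:*_; _:-_; con)

-- Rational numbers and the partial sums of e

-- The bidding bound is a potential argument. The potential is `v` times the largest bid so far,
-- where `v` is just below the minimum of `q^d / (d+1)`. Stage `k` is reached with probability
-- `t^k = q^(-k)`, and by then the largest bid `a` is at least `k`. Raising it to `a + d + 1`
-- therefore contributes at least `q^d` to the mean cost, which pays for `d + 1` units of potential.
-- Exchanging the mean over instances with the expectation over algorithms would normally use
-- linearity of the integral. Here the expectation is a supremum over simple functions, and only
-- finite additivity of probability is derived. The costs on the finitely many instances are rounded
-- down to integers, which turns their weighted mean into finitely many weighted events; bounding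
-- these pointwise loses an additive 1. Rounding needs a truncation level common to all algorithms
-- although their costs are unbounded, so only a certified, capped part of each cost is counted.
-- Neither the loss of 1 nor the final service at `q^ℓ` grows with the number of phases.

≤-by-diff : ∀ {p q} d → 0ℚ ℚ.≤ d → q ≡ p ℚ.+ d → p ℚ.≤ q
≤-by-diff {p} {q} d 0≤d eq = begin
  p            ≡⟨ sym (ℚ.+-identityʳ p) ⟩
  p ℚ.+ 0ℚ     ≤⟨ ℚ.+-monoʳ-≤ p 0≤d ⟩
  p ℚ.+ d      ≡⟨ sym eq ⟩
  q            ∎
  where open ℚ.≤-Reasoning

≤⇒0≤diff : ∀ {p q} → p ℚ.≤ q → 0ℚ ℚ.≤ q ℚ.- p
≤⇒0≤diff {p} {q} p≤q = subst (ℚ._≤ q ℚ.- p) (ℚ.+-inverseʳ p) (ℚ.+-monoˡ-≤ (ℚ.- p) p≤q)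

0≤+ : ∀ {p q} → 0ℚ ℚ.≤ p → 0ℚ ℚ.≤ q → 0ℚ ℚ.≤ p ℚ.+ q
0≤+ = ℚ.+-mono-≤

0≤* : ∀ {p q} → 0ℚ ℚ.≤ p → 0ℚ ℚ.≤ q → 0ℚ ℚ.≤ p ℚ.* q
0≤* {p} {q} 0≤p 0≤q = ℚ.nonNegative⁻¹ (p ℚ.* q)
  {{ℚ.nonNeg*nonNeg⇒nonNeg p {{ℚ.nonNegative 0≤p}} q {{ℚ.nonNegative 0≤q}}}}

0<* : ∀ {p q} → 0ℚ ℚ.< p → 0ℚ ℚ.< q → 0ℚ ℚ.< p ℚ.* q
0<* {p} {q} 0<p 0<q = ℚ.positive⁻¹ (p ℚ.* q) {{ℚ.pos*pos⇒pos p {{ℚ.positive 0<p}} q {{ℚ.positive 0<q}}}}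

*-monoʳ : ∀ {p q} r → 0ℚ ℚ.≤ r → p ℚ.≤ q → r ℚ.* p ℚ.≤ r ℚ.* q
*-monoʳ r 0≤r = ℚ.*-monoˡ-≤-nonNeg r {{ℚ.nonNegative 0≤r}}

*-monoˡ : ∀ {p q} r → 0ℚ ℚ.≤ r → p ℚ.≤ q → p ℚ.* r ℚ.≤ q ℚ.* r
*-monoˡ r 0≤r = ℚ.*-monoʳ-≤-nonNeg r {{ℚ.nonNegative 0≤r}}

0≤1 : 0ℚ ℚ.≤ 1ℚ
0≤1 = ℚ.nonNegative⁻¹ 1ℚ

ι : ℕ → ℚ
ι zero    = 0ℚ
ι (suc n) = 1ℚ ℚ.+ ι n

ι-+ : ∀ m n → ι (m ℕ.+ n) ≡ ι m ℚ.+ ι n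
ι-+ zero    n = sym (ℚ.+-identityˡ (ι n))
ι-+ (suc m) n = trans (cong (1ℚ ℚ.+_) (ι-+ m n)) (sym (ℚ.+-assoc 1ℚ (ι m) (ι n)))

ι-* : ∀ m n → ι (m ℕ.* n) ≡ ι m ℚ.* ι n
ι-* zero    n = sym (ℚ.*-zeroˡ (ι n))
ι-* (suc m) n = trans (ι-+ n (m ℕ.* n)) (trans (cong (ι n ℚ.+_) (ι-* m n))
  (solve 2 (λ m n → n :+ m :* n := (con 1ℚ :+ m) :* n) refl (ι m) (ι n)))

0≤ι : ∀ n → 0ℚ ℚ.≤ ι n
0≤ι zero    = ℚ.≤-refl
0≤ι (suc n) = 0≤+ 0≤1 (0≤ι n)

0<ι-suc : ∀ n → 0ℚ ℚ.< ι (suc n)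
0<ι-suc n = ℚ.+-mono-<-≤ (ℚ.positive⁻¹ 1ℚ) (0≤ι n)

ι-mono-≤ : ∀ {m n} → m ℕ.≤ n → ι m ℚ.≤ ι n
ι-mono-≤ {m} m≤n with ℕ.m≤n⇒∃[o]m+o≡n m≤n
... | o , refl = ≤-by-diff (ι o) (0≤ι o) (ι-+ m o)

ι-mono-< : ∀ {m n} → m ℕ.< n → ι m ℚ.< ι n
ι-mono-< {m} m<n = ℚ.<-≤-trans
  (subst (ℚ._< ι (suc m)) (ℚ.+-identityˡ (ι m)) (ℚ.+-monoˡ-< (ι m) (ℚ.positive⁻¹ 1ℚ)))
  (ι-mono-≤ m<n)

toℚᵘ-ι : ∀ n → ℚ.toℚᵘ (ι n) ℚᵘ.≃ ℚᵘ.mkℚᵘ (ℤ.+ n) 0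
toℚᵘ-ι zero    = ℚᵘ.≃-refl
toℚᵘ-ι (suc n) = ℚᵘ.≃-trans (ℚ.toℚᵘ-homo-+ 1ℚ (ι n))
  (ℚᵘ.≃-trans (ℚᵘ.+-congʳ (ℚ.toℚᵘ 1ℚ) (toℚᵘ-ι n))
    (ℚᵘ.*≡* (cong (λ z → (ℤ.+ 1 ℤ.+ z) ℤ.* ℤ.+ 1) (ℤ.*-identityʳ (ℤ.+ n)))))

archimedean : ∀ p → ∃[ n ] p ℚ.≤ ι n
archimedean p@(mkℚ i d c) = ℤ.∣ i ∣ , ℚ.toℚᵘ-cancel-≤ (ℚᵘ.≤-respʳ-≃ (ℚᵘ.≃-sym (toℚᵘ-ι ℤ.∣ i ∣))
  (ℚᵘ.*≤* (bound i)))
  where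
  bound : ∀ i → i ℤ.* ℤ.+ 1 ℤ.≤ ℤ.+ ℤ.∣ i ∣ ℤ.* ℤ.+ suc d
  bound (ℤ.+ k)    = subst₂ ℤ._≤_ (ℤ.pos-* k 1) (ℤ.pos-* k (suc d))
    (ℤ.+≤+ (ℕ.*-monoʳ-≤ k (ℕ.s≤s ℕ.z≤n)))
  bound ℤ.-[1+ k ] = ℤ.-≤+

^-nonNeg : ∀ {p} n → 0ℚ ℚ.≤ p → 0ℚ ℚ.≤ p ^ n
^-nonNeg zero    0≤p = 0≤1
^-nonNeg (suc n) 0≤p = 0≤* 0≤p (^-nonNeg n 0≤p)

0≤1/! : ∀ k → 0ℚ ℚ.≤ 1/[ k ]!
0≤1/! k = ℚ.nonNegative⁻¹ 1/[ k ]! {{ℚ.normalize-nonNeg 1 (k !) {{ℕ._!≢0 k}}}}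

toℚᵘ-1/ : ∀ d .{{_ : ℕ.NonZero d}} → ℚ.toℚᵘ (ℤ.+ 1 ℚ./ d) ℚᵘ.≃ (ℤ.+ 1 ℚᵘ./ d)
toℚᵘ-1/ (suc d) = ℚ.toℚᵘ-fromℚᵘ (ℚᵘ.mkℚᵘ (ℤ.+ 1) d)

1/suc! : ∀ k → ι (suc k) ℚ.* 1/[ suc k ]! ≡ 1/[ k ]!
1/suc! k = ℚ.toℚᵘ-injective (begin
  ℚ.toℚᵘ (ι (suc k) ℚ.* 1/[ suc k ]!)
    ≈⟨ ℚ.toℚᵘ-homo-* (ι (suc k)) 1/[ suc k ]! ⟩
  ℚ.toℚᵘ (ι (suc k)) ℚᵘ.* ℚ.toℚᵘ 1/[ suc k ]!
    ≈⟨ ℚᵘ.*-cong (toℚᵘ-ι (suc k)) (toℚᵘ-1/ (suc k !) {{ℕ._!≢0 (suc k)}}) ⟩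
  ℚᵘ.mkℚᵘ (ℤ.+ suc k) 0 ℚᵘ.* (ℤ.+ 1 ℚᵘ./ (suc k !)) {{ℕ._!≢0 (suc k)}}
    ≈⟨ fractions (k !) {{ℕ._!≢0 k}} (suc k !) {{ℕ._!≢0 (suc k)}} refl ⟩
  (ℤ.+ 1 ℚᵘ./ (k !)) {{ℕ._!≢0 k}}
    ≈⟨ ℚᵘ.≃-sym (toℚᵘ-1/ (k !) {{ℕ._!≢0 k}}) ⟩
  ℚ.toℚᵘ 1/[ k ]! ∎)
  where
  open ℚᵘ.≃-Reasoning
  fractions : ∀ f .{{_ : ℕ.NonZero f}} g .{{_ : ℕ.NonZero g}} → g ≡ suc k ℕ.* f →
    ℚᵘ.mkℚᵘ (ℤ.+ suc k) 0 ℚᵘ.* (ℤ.+ 1 ℚᵘ./ g) ℚᵘ.≃ (ℤ.+ 1 ℚᵘ./ f)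
  fractions (suc f) (suc g) eq = ℚᵘ.*≡* (cong ℤ.+_ (trans
    (cong (ℕ._* suc f) (ℕ.*-identityʳ (suc k)))
    (trans (sym eq) (sym (trans (ℕ.+-identityʳ _) (ℕ.+-identityʳ (suc g)))))))

expTerm : ℕ → ℚ → ℚ
expTerm k s = 1/[ k ]! ℚ.* s ^ k

expSum : ℕ → ℚ → ℚ
expSum zero    s = expTerm 0 s
expSum (suc m) s = expSum m s ℚ.+ expTerm (suc m) s

expTerm-suc : ∀ k s → ι (suc k) ℚ.* expTerm (suc k) s ≡ s ℚ.* expTerm k s
expTerm-suc k s = trans
  (solve 4 (λ i f s p → i :* (f :* (s :* p)) := s :* ((i :* f) :* p)) refl (ι (suc k)) 1/[ suc k ]! s (s ^ k))
  (cong (λ x → s ℚ.* (x ℚ.* s ^ k)) (1/suc! k))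

0≤expTerm : ∀ k {s} → 0ℚ ℚ.≤ s → 0ℚ ℚ.≤ expTerm k s
0≤expTerm k 0≤s = 0≤* (0≤1/! k) (^-nonNeg k 0≤s)

*-cancelˡ-≤ : ∀ {p q} r → 0ℚ ℚ.< r → r ℚ.* p ℚ.≤ r ℚ.* q → p ℚ.≤ q
*-cancelˡ-≤ r 0<r = ℚ.*-cancelˡ-≤-pos r {{ℚ.positive 0<r}}

-- A mean value inequality: the derivative of `expTerm (suc k)` is `expTerm k`, which is increasing,
-- so the growth over a step `u` is at most `u` times its value at the right end. Multiplying by
-- `k + 1` reduces this to the case of `k`.
expTerm-step : ∀ k {s u} → 0ℚ ℚ.≤ s → 0ℚ ℚ.≤ u →
  expTerm (suc k) (s ℚ.+ u) ℚ.≤ expTerm (suc k) s ℚ.+ u ℚ.* expTerm k (s ℚ.+ u)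
expTerm-step k {s} {u} 0≤s 0≤u = *-cancelˡ-≤ (ι (suc k)) (0<ι-suc k) (begin
  ι (suc k) ℚ.* expTerm (suc k) (s ℚ.+ u)
    ≡⟨ expTerm-suc k (s ℚ.+ u) ⟩
  (s ℚ.+ u) ℚ.* expTerm k (s ℚ.+ u)
    ≤⟨ split k ⟩
  s ℚ.* expTerm k s ℚ.+ ι (suc k) ℚ.* (u ℚ.* expTerm k (s ℚ.+ u))
    ≡⟨ cong (ℚ._+ ι (suc k) ℚ.* (u ℚ.* expTerm k (s ℚ.+ u))) (sym (expTerm-suc k s)) ⟩
  ι (suc k) ℚ.* expTerm (suc k) s ℚ.+ ι (suc k) ℚ.* (u ℚ.* expTerm k (s ℚ.+ u))
    ≡⟨ sym (ℚ.*-distribˡ-+ (ι (suc k)) (expTerm (suc k) s) (u ℚ.* expTerm k (s ℚ.+ u))) ⟩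
  ι (suc k) ℚ.* (expTerm (suc k) s ℚ.+ u ℚ.* expTerm k (s ℚ.+ u)) ∎)
  where
  open ℚ.≤-Reasoning
  split : ∀ k → (s ℚ.+ u) ℚ.* expTerm k (s ℚ.+ u) ℚ.≤
    s ℚ.* expTerm k s ℚ.+ ι (suc k) ℚ.* (u ℚ.* expTerm k (s ℚ.+ u))
  split zero    = ℚ.≤-reflexive
    (solve 3 (λ s u f → (s :+ u) :* (f :* con 1ℚ) := s :* (f :* con 1ℚ) :+ (con 1ℚ :+ con 0ℚ) :* (u :* (f :* con 1ℚ)))
      refl s u 1/[ 0 ]!)
  split (suc k) = begin
    (s ℚ.+ u) ℚ.* x
      ≡⟨ ℚ.*-distribʳ-+ x s u ⟩
    s ℚ.* x ℚ.+ u ℚ.* x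
      ≤⟨ ℚ.+-monoˡ-≤ (u ℚ.* x) (*-monoʳ s 0≤s (expTerm-step k 0≤s 0≤u)) ⟩
    s ℚ.* (z ℚ.+ u ℚ.* y) ℚ.+ u ℚ.* x
      ≤⟨ ≤-by-diff (u ℚ.* (u ℚ.* y)) (0≤* 0≤u (0≤* 0≤u (0≤expTerm k (0≤+ 0≤s 0≤u)))) eq ⟩
    s ℚ.* z ℚ.+ ι (suc (suc k)) ℚ.* (u ℚ.* x) ∎
    where
    x = expTerm (suc k) (s ℚ.+ u)
    y = expTerm k (s ℚ.+ u)
    z = expTerm (suc k) s
    eq : s ℚ.* z ℚ.+ ι (suc (suc k)) ℚ.* (u ℚ.* x) ≡ (s ℚ.* (z ℚ.+ u ℚ.* y) ℚ.+ u ℚ.* x) ℚ.+ u ℚ.* (u ℚ.* y)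
    eq = begin-equality
      s ℚ.* z ℚ.+ ι (suc (suc k)) ℚ.* (u ℚ.* x)
        ≡⟨ solve 5 (λ s z i u x → s :* z :+ (con 1ℚ :+ i) :* (u :* x) := s :* z :+ u :* (i :* x) :+ u :* x)
             refl s z (ι (suc k)) u x ⟩
      s ℚ.* z ℚ.+ u ℚ.* (ι (suc k) ℚ.* x) ℚ.+ u ℚ.* x
        ≡⟨ cong (λ w → s ℚ.* z ℚ.+ u ℚ.* w ℚ.+ u ℚ.* x) (expTerm-suc k (s ℚ.+ u)) ⟩
      s ℚ.* z ℚ.+ u ℚ.* ((s ℚ.+ u) ℚ.* y) ℚ.+ u ℚ.* x
        ≡⟨ solve 5 (λ s z u y x → s :* z :+ u :* ((s :+ u) :* y) :+ u :* x :=
                                   s :* (z :+ u :* y) :+ u :* x :+ u :* (u :* y)) refl s z u y x ⟩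
      (s ℚ.* (z ℚ.+ u ℚ.* y) ℚ.+ u ℚ.* x) ℚ.+ u ℚ.* (u ℚ.* y) ∎

-- Read as `(1 - u) * expSum m (s + u) ≤ expSum m s`, this says that a step `u` multiplies the
-- partial sum by at most `1/(1 - u)`, which will be `q`.
expSum-step : ∀ m {s u} → 0ℚ ℚ.≤ s → 0ℚ ℚ.≤ u → expSum m (s ℚ.+ u) ℚ.≤ expSum m s ℚ.+ u ℚ.* expSum m (s ℚ.+ u)
expSum-step m {s} {u} 0≤s 0≤u = ℚ.≤-trans (sharp m)
  (ℚ.+-monoʳ-≤ (expSum m s) (*-monoʳ u 0≤u (init m)))
  where
  open ℚ.≤-Reasoning
  0≤s+u = 0≤+ 0≤s 0≤u
  -- `initSum m` is the derivative of `expSum m` at `s + u`: the sum without its last term.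
  initSum : ℕ → ℚ
  initSum zero    = 0ℚ
  initSum (suc m) = expSum m (s ℚ.+ u)
  init : ∀ m → initSum m ℚ.≤ expSum m (s ℚ.+ u)
  init zero    = 0≤expTerm 0 0≤s+u
  init (suc m) = ≤-by-diff _ (0≤expTerm (suc m) 0≤s+u) refl
  next : ∀ m → initSum m ℚ.+ expTerm m (s ℚ.+ u) ≡ expSum m (s ℚ.+ u)
  next zero    = ℚ.+-identityˡ _
  next (suc m) = refl
  sharp : ∀ m → expSum m (s ℚ.+ u) ℚ.≤ expSum m s ℚ.+ u ℚ.* initSum m
  sharp zero    = ℚ.≤-reflexive (solve 2 (λ x u → x := x :+ u :* con 0ℚ) refl (expTerm 0 s) u)
  sharp (suc m) = begin
    expSum m (s ℚ.+ u) ℚ.+ expTerm (suc m) (s ℚ.+ u)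
      ≤⟨ ℚ.+-mono-≤ (sharp m) (expTerm-step m 0≤s 0≤u) ⟩
    (expSum m s ℚ.+ u ℚ.* initSum m) ℚ.+ (expTerm (suc m) s ℚ.+ u ℚ.* expTerm m (s ℚ.+ u))
      ≡⟨ solve 5 (λ a u b c d → (a :+ u :* b) :+ (c :+ u :* d) := (a :+ c) :+ u :* (b :+ d)) refl
           (expSum m s) u (initSum m) (expTerm (suc m) s) (expTerm m (s ℚ.+ u)) ⟩
    expSum (suc m) s ℚ.+ u ℚ.* (initSum m ℚ.+ expTerm m (s ℚ.+ u))
      ≡⟨ cong (λ w → expSum (suc m) s ℚ.+ u ℚ.* w) (next m) ⟩
    expSum (suc m) s ℚ.+ u ℚ.* expSum m (s ℚ.+ u) ∎

1^n≡1 : ∀ n → 1ℚ ^ n ≡ 1ℚ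
1^n≡1 zero    = refl
1^n≡1 (suc n) = trans (ℚ.*-identityˡ (1ℚ ^ n)) (1^n≡1 n)

expTerm-1 : ∀ k → expTerm k 1ℚ ≡ 1/[ k ]!
expTerm-1 k = trans (cong (1/[ k ]! ℚ.*_) (1^n≡1 k)) (ℚ.*-identityʳ 1/[ k ]!)

expSum-1 : ∀ m → expSum m 1ℚ ≡ e-seq m
expSum-1 zero    = expTerm-1 0
expSum-1 (suc m) = cong₂ ℚ._+_ (expSum-1 m) (expTerm-1 (suc m))

expSum-0 : ∀ m → expSum m 0ℚ ≡ 1ℚ
expSum-0 zero    = refl
expSum-0 (suc m) = trans (cong (expSum m 0ℚ ℚ.+_)
  (trans (cong (1/[ suc m ]! ℚ.*_) (ℚ.*-zeroˡ (0ℚ ^ m))) (ℚ.*-zeroʳ 1/[ suc m ]!)))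
  (trans (ℚ.+-identityʳ _) (expSum-0 m))

1≤e-seq : ∀ m → 1ℚ ℚ.≤ e-seq m
1≤e-seq zero    = ℚ.≤-refl
1≤e-seq (suc m) = ℚ.≤-trans (1≤e-seq m) (≤-by-diff _ (0≤1/! (suc m)) refl)

archimedean-* : ∀ δ → 0ℚ ℚ.< δ → ∀ p → ∃[ k ] p ℚ.≤ δ ℚ.* ι k
archimedean-* δ 0<δ p = let k , bound = archimedean (p ℚ.* ℚ.1/ δ) in k , (begin
  p                          ≡⟨ sym (ℚ.*-identityˡ p) ⟩
  1ℚ ℚ.* p                   ≡⟨ cong (ℚ._* p) (sym (ℚ.*-inverseʳ δ)) ⟩
  δ ℚ.* ℚ.1/ δ ℚ.* p         ≡⟨ solve 3 (λ d w p → d :* w :* p := d :* (p :* w)) refl δ (ℚ.1/ δ) p ⟩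
  δ ℚ.* (p ℚ.* ℚ.1/ δ)       ≤⟨ *-monoʳ δ (ℚ.<⇒≤ 0<δ) bound ⟩
  δ ℚ.* ι k                  ∎)
  where
  open ℚ.≤-Reasoning
  instance
    δ>0 : ℚ.Positive δ
    δ>0 = ℚ.positive 0<δ
    δ≢0 : ℚ.NonZero δ
    δ≢0 = ℚ.pos⇒nonZero δ

-- q = 1 + 1/n and t = 1 - u = 1/q, where u = 1/(n+1).
record Ratio (n : ℕ) : Set where
  field
    u t q : ℚ
    0≤u   : 0ℚ ℚ.≤ u
    0≤t   : 0ℚ ℚ.≤ t
    0≤q   : 0ℚ ℚ.≤ q
    t≡1-u : t ≡ 1ℚ ℚ.- u
    q*t≡1 : q ℚ.* t ≡ 1ℚ
    Nu≡1  : ι (suc n) ℚ.* u ≡ 1ℚ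

  qu≡q-1 : q ℚ.* u ≡ q ℚ.- 1ℚ
  qu≡q-1 = begin
    q ℚ.* u                          ≡⟨ solve 2 (λ q u → q :* u := q :- q :* (con 1ℚ :- u)) refl q u ⟩
    q ℚ.- q ℚ.* (1ℚ ℚ.- u)           ≡⟨ cong (λ x → q ℚ.- q ℚ.* x) (sym t≡1-u) ⟩
    q ℚ.- q ℚ.* t                    ≡⟨ cong (λ x → q ℚ.- x) q*t≡1 ⟩
    q ℚ.- 1ℚ                         ∎
    where open ≡-Reasoning

  q≡1+qu : q ≡ 1ℚ ℚ.+ q ℚ.* u
  q≡1+qu = trans (solve 1 (λ q → q := con 1ℚ :+ (q :- con 1ℚ)) refl q) (cong (1ℚ ℚ.+_) (sym qu≡q-1))

  1≤q : 1ℚ ℚ.≤ q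
  1≤q = ≤-by-diff (q ℚ.* u) (0≤* 0≤q 0≤u) q≡1+qu

  t≤1 : t ℚ.≤ 1ℚ
  t≤1 = ≤-by-diff u 0≤u (trans (solve 1 (λ u → con 1ℚ := (con 1ℚ :- u) :+ u) refl u) (cong (ℚ._+ u) (sym t≡1-u)))

  1+u≤q : 1ℚ ℚ.+ u ℚ.≤ q
  1+u≤q = begin
    1ℚ ℚ.+ u         ≡⟨ cong (1ℚ ℚ.+_) (sym (ℚ.*-identityˡ u)) ⟩
    1ℚ ℚ.+ 1ℚ ℚ.* u  ≤⟨ ℚ.+-monoʳ-≤ 1ℚ (*-monoˡ u 0≤u 1≤q) ⟩
    1ℚ ℚ.+ q ℚ.* u   ≡⟨ sym q≡1+qu ⟩
    q                ∎
    where open ℚ.≤-Reasoning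

  q^*t^≡1 : ∀ k → q ^ k ℚ.* t ^ k ≡ 1ℚ
  q^*t^≡1 zero    = refl
  q^*t^≡1 (suc k) = trans
    (solve 4 (λ q x t y → (q :* x) :* (t :* y) := (q :* t) :* (x :* y)) refl q (q ^ k) t (t ^ k))
    (trans (cong₂ ℚ._*_ q*t≡1 (q^*t^≡1 k)) refl)

  bernoulli-q : ∀ i → 1ℚ ℚ.+ ι i ℚ.* u ℚ.≤ q ^ i
  bernoulli-q zero    = ℚ.≤-reflexive (solve 1 (λ u → con 1ℚ :+ con 0ℚ :* u := con 1ℚ) refl u)
  bernoulli-q (suc i) = begin
    1ℚ ℚ.+ (1ℚ ℚ.+ ι i) ℚ.* u
      ≤⟨ ≤-by-diff (u ℚ.* (ι i ℚ.* u)) (0≤* 0≤u (0≤* (0≤ι i) 0≤u))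
           (solve 2 (λ i u → (con 1ℚ :+ u) :* (con 1ℚ :+ i :* u) := con 1ℚ :+ (con 1ℚ :+ i) :* u :+ u :* (i :* u))
             refl (ι i) u) ⟩
    (1ℚ ℚ.+ u) ℚ.* (1ℚ ℚ.+ ι i ℚ.* u)
      ≤⟨ *-monoˡ (1ℚ ℚ.+ ι i ℚ.* u) (0≤+ 0≤1 (0≤* (0≤ι i) 0≤u)) 1+u≤q ⟩
    q ℚ.* (1ℚ ℚ.+ ι i ℚ.* u)
      ≤⟨ *-monoʳ q 0≤q (bernoulli-q i) ⟩
    q ℚ.* q ^ i ∎
    where open ℚ.≤-Reasoning

  bernoulli-t : ∀ i → 1ℚ ℚ.- ι i ℚ.* u ℚ.≤ t ^ i
  bernoulli-t zero    = ℚ.≤-reflexive (solve 1 (λ u → con 1ℚ :- con 0ℚ :* u := con 1ℚ) refl u)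
  bernoulli-t (suc i) = begin
    1ℚ ℚ.- (1ℚ ℚ.+ ι i) ℚ.* u
      ≤⟨ ≤-by-diff (u ℚ.* (ι i ℚ.* u)) (0≤* 0≤u (0≤* (0≤ι i) 0≤u))
           (solve 2 (λ i u → (con 1ℚ :- u) :* (con 1ℚ :- i :* u) := con 1ℚ :- (con 1ℚ :+ i) :* u :+ u :* (i :* u))
             refl (ι i) u) ⟩
    (1ℚ ℚ.- u) ℚ.* (1ℚ ℚ.- ι i ℚ.* u)
      ≡⟨ cong (ℚ._* (1ℚ ℚ.- ι i ℚ.* u)) (sym t≡1-u) ⟩
    t ℚ.* (1ℚ ℚ.- ι i ℚ.* u)
      ≤⟨ *-monoʳ t 0≤t (bernoulli-t i) ⟩
    t ℚ.* t ^ i ∎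
    where open ℚ.≤-Reasoning

  -- Both sides start at 1; a step multiplies the right side by `q = 1/(1 - u)` and the left side by
  -- at most that. At `j = n + 1` the argument of `expSum` is 1, which is where the partial sums of
  -- e come from.
  expSum≤q^ : ∀ m j → expSum m (ι j ℚ.* u) ℚ.≤ q ^ j
  expSum≤q^ m zero    = ℚ.≤-reflexive (trans (cong (expSum m) (ℚ.*-zeroˡ u)) (expSum-0 m))
  expSum≤q^ m (suc j) = begin
    a                              ≡⟨ sym (ℚ.*-identityˡ a) ⟩
    1ℚ ℚ.* a                       ≡⟨ cong (ℚ._* a) (sym q*t≡1) ⟩
    q ℚ.* t ℚ.* a                  ≡⟨ ℚ.*-assoc q t a ⟩
    q ℚ.* (t ℚ.* a)                ≤⟨ *-monoʳ q 0≤q ta≤b ⟩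
    q ℚ.* expSum m (ι j ℚ.* u)     ≤⟨ *-monoʳ q 0≤q (expSum≤q^ m j) ⟩
    q ℚ.* q ^ j                    ∎
    where
    open ℚ.≤-Reasoning
    a = expSum m (ι (suc j) ℚ.* u)
    b = expSum m (ι j ℚ.* u)
    step : a ℚ.≤ b ℚ.+ u ℚ.* a
    step = subst (λ s → expSum m s ℚ.≤ b ℚ.+ u ℚ.* expSum m s)
      (solve 2 (λ j u → j :* u :+ u := (con 1ℚ :+ j) :* u) refl (ι j) u)
      (expSum-step m (0≤* (0≤ι j) 0≤u) 0≤u)
    ta≤b : t ℚ.* a ℚ.≤ b
    ta≤b = begin
      t ℚ.* a                          ≡⟨ cong (ℚ._* a) t≡1-u ⟩
      (1ℚ ℚ.- u) ℚ.* a                 ≡⟨ solve 2 (λ u a → (con 1ℚ :- u) :* a := a :- u :* a) refl u a ⟩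
      a ℚ.- u ℚ.* a                    ≤⟨ ℚ.+-monoˡ-≤ (ℚ.- (u ℚ.* a)) step ⟩
      (b ℚ.+ u ℚ.* a) ℚ.- u ℚ.* a      ≡⟨ solve 2 (λ b c → (b :+ c) :- c := b) refl b (u ℚ.* a) ⟩
      b                                ∎

  e-seq≤q^ : ∀ m → e-seq m ℚ.≤ q ^ suc n
  e-seq≤q^ m = subst (ℚ._≤ q ^ suc n) (trans (cong (expSum m) Nu≡1) (expSum-1 m)) (expSum≤q^ m (suc n))

  q^n-bound : ∀ m → e-seq m ℚ.* t ℚ.≤ q ^ n
  q^n-bound m = begin
    e-seq m ℚ.* t          ≤⟨ *-monoˡ t 0≤t (e-seq≤q^ m) ⟩
    q ℚ.* q ^ n ℚ.* t      ≡⟨ solve 3 (λ q x t → q :* x :* t := (q :* t) :* x) refl q (q ^ n) t ⟩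
    q ℚ.* t ℚ.* q ^ n      ≡⟨ cong (ℚ._* q ^ n) q*t≡1 ⟩
    1ℚ ℚ.* q ^ n           ≡⟨ ℚ.*-identityˡ (q ^ n) ⟩
    q ^ n                  ∎
    where open ℚ.≤-Reasoning

  -- q^d / (d+1) is smallest at d = n.
  q^-minimum : ∀ d → q ^ n ℚ.* (ι (suc d) ℚ.* u) ℚ.≤ q ^ d
  -- If `i` is the distance of `d` from `n`, then `(d+1) u` is `1 + i u` or `1 - i u`, and
  -- Bernoulli's inequality compares it with `q^i` or `t^i`.
  q^-minimum d with ℕ.≤-total n d
  ... | inj₁ n≤d with ℕ.m≤n⇒∃[o]m+o≡n n≤d
  ...   | i , refl = begin
    q ^ n ℚ.* (ι (suc n ℕ.+ i) ℚ.* u)          ≡⟨ cong (λ x → q ^ n ℚ.* (x ℚ.* u)) (ι-+ (suc n) i) ⟩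
    q ^ n ℚ.* ((ι (suc n) ℚ.+ ι i) ℚ.* u)      ≡⟨ cong (q ^ n ℚ.*_) (ℚ.*-distribʳ-+ u (ι (suc n)) (ι i)) ⟩
    q ^ n ℚ.* (ι (suc n) ℚ.* u ℚ.+ ι i ℚ.* u)  ≡⟨ cong (λ x → q ^ n ℚ.* (x ℚ.+ ι i ℚ.* u)) Nu≡1 ⟩
    q ^ n ℚ.* (1ℚ ℚ.+ ι i ℚ.* u)               ≤⟨ *-monoʳ (q ^ n) (^-nonNeg n 0≤q) (bernoulli-q i) ⟩
    q ^ n ℚ.* q ^ i                            ≡⟨ sym (^-homo-* q n i) ⟩
    q ^ (n ℕ.+ i)                              ∎
    where open ℚ.≤-Reasoning
  q^-minimum d | inj₂ d≤n with ℕ.m≤n⇒∃[o]m+o≡n d≤n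
  ...   | i , refl = begin
    q ^ (d ℕ.+ i) ℚ.* (ι (suc d) ℚ.* u)
      ≡⟨ cong₂ ℚ._*_ (^-homo-* q d i) part ⟩
    (q ^ d ℚ.* q ^ i) ℚ.* (1ℚ ℚ.- ι i ℚ.* u)
      ≤⟨ *-monoʳ (q ^ d ℚ.* q ^ i) (0≤* (^-nonNeg d 0≤q) (^-nonNeg i 0≤q)) (bernoulli-t i) ⟩
    (q ^ d ℚ.* q ^ i) ℚ.* t ^ i
      ≡⟨ ℚ.*-assoc (q ^ d) (q ^ i) (t ^ i) ⟩
    q ^ d ℚ.* (q ^ i ℚ.* t ^ i)
      ≡⟨ cong (q ^ d ℚ.*_) (q^*t^≡1 i) ⟩
    q ^ d ℚ.* 1ℚ
      ≡⟨ ℚ.*-identityʳ (q ^ d) ⟩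
    q ^ d ∎
    where
    open ℚ.≤-Reasoning
    part : ι (suc d) ℚ.* u ≡ 1ℚ ℚ.- ι i ℚ.* u
    part = begin-equality
      ι (suc d) ℚ.* u
        ≡⟨ solve 3 (λ a b u → a :* u := (a :+ b) :* u :- b :* u) refl (ι (suc d)) (ι i) u ⟩
      (ι (suc d) ℚ.+ ι i) ℚ.* u ℚ.- ι i ℚ.* u
        ≡⟨ cong (λ x → x ℚ.* u ℚ.- ι i ℚ.* u) (sym (ι-+ (suc d) i)) ⟩
      ι (suc (d ℕ.+ i)) ℚ.* u ℚ.- ι i ℚ.* u
        ≡⟨ cong (ℚ._- ι i ℚ.* u) Nu≡1 ⟩
      1ℚ ℚ.- ι i ℚ.* u ∎

  -- The factor `e-seq m * t * u` replaces the exact minimum `q^n * u` of `q^d / (d+1)`, so that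
  -- only a partial sum of e enters the final comparison.
  jump : ∀ m d → e-seq m ℚ.* t ℚ.* u ℚ.* ι (suc d) ℚ.≤ q ^ d
  jump m d = begin
    e-seq m ℚ.* t ℚ.* u ℚ.* ι (suc d)
      ≡⟨ solve 4 (λ e t u i → e :* t :* u :* i := e :* t :* (i :* u)) refl (e-seq m) t u (ι (suc d)) ⟩
    e-seq m ℚ.* t ℚ.* (ι (suc d) ℚ.* u)
      ≤⟨ *-monoˡ (ι (suc d) ℚ.* u) (0≤* (0≤ι (suc d)) 0≤u) (q^n-bound m) ⟩
    q ^ n ℚ.* (ι (suc d) ℚ.* u)
      ≤⟨ q^-minimum d ⟩
    q ^ d ∎
    where open ℚ.≤-Reasoning

reciprocal : ∀ n → ∃[ w ] (0ℚ ℚ.< w × ι (suc n) ℚ.* w ≡ 1ℚ)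
reciprocal n = ℚ.1/ p , ℚ.positive⁻¹ (ℚ.1/ p) {{ℚ.1/pos⇒pos p}} , ℚ.*-inverseʳ p
  where
  p = ι (suc n)
  instance
    p>0 : ℚ.Positive p
    p>0 = ℚ.positive (0<ι-suc n)
    p≢0 : ℚ.NonZero p
    p≢0 = ℚ.pos⇒nonZero p

ratio-from : ∀ n {w u} → 0ℚ ℚ.< w → ι (suc n) ℚ.* w ≡ 1ℚ → 0ℚ ℚ.< u → ι (suc (suc n)) ℚ.* u ≡ 1ℚ → Ratio (suc n)
ratio-from n {w} {u} 0<w nw≡1 0<u Nu≡1 = record
  { u = u ; t = ι (suc n) ℚ.* u ; q = ι (suc (suc n)) ℚ.* w
  ; 0≤u = ℚ.<⇒≤ 0<u ; 0≤t = 0≤* (0≤ι (suc n)) (ℚ.<⇒≤ 0<u) ; 0≤q = 0≤* (0≤ι (suc (suc n))) (ℚ.<⇒≤ 0<w)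
  ; t≡1-u = trans (t-identity (ι (suc n)) u) (cong (ℚ._- u) Nu≡1)
  ; q*t≡1 = trans (q*t-identity (ι (suc (suc n))) w (ι (suc n)) u) (cong₂ ℚ._*_ Nu≡1 nw≡1)
  ; Nu≡1 = Nu≡1
  }
  where
  t-identity : ∀ a u → a ℚ.* u ≡ (1ℚ ℚ.+ a) ℚ.* u ℚ.- u
  t-identity = solve 2 (λ a u → a :* u := (con 1ℚ :+ a) :* u :- u) refl
  q*t-identity : ∀ a w b u → (a ℚ.* w) ℚ.* (b ℚ.* u) ≡ (a ℚ.* u) ℚ.* (b ℚ.* w)
  q*t-identity = solve 4 (λ a w b u → (a :* w) :* (b :* u) := (a :* u) :* (b :* w)) refl

-- The index is shifted because `1 + 1/n` needs `n ≥ 1`; accordingly `u` is `1/(n+2)` here.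
ratio : ∀ n → Ratio (suc n)
ratio n =
  let w , 0<w , nw≡1 = reciprocal n
      u , 0<u , Nu≡1 = reciprocal (suc n)
  in ratio-from n 0<w nw≡1 0<u Nu≡1

-- Online bidding

Weighted : Set → Set
Weighted W = List (ℚ × W)

𝔼 : ∀ {W} → Weighted W → (W → ℚ) → ℚ
𝔼 []            g = 0ℚ
𝔼 ((p , w) ∷ D) g = p ℚ.* g w ℚ.+ 𝔼 D g

NonNegWeights : ∀ {W} → Weighted W → Set
NonNegWeights = All (λ pw → 0ℚ ℚ.≤ proj₁ pw)

scale : ∀ {W} → ℚ → Weighted W → Weighted W
scale c = map (λ (p , w) → c ℚ.* p , w)

relabel : ∀ {V W} → (V → W) → Weighted V → Weighted W
relabel f = map (λ (p , w) → p , f w)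

𝔼-++ : ∀ {W} (D E : Weighted W) g → 𝔼 (D ++ E) g ≡ 𝔼 D g ℚ.+ 𝔼 E g
𝔼-++ []            E g = sym (ℚ.+-identityˡ (𝔼 E g))
𝔼-++ ((p , w) ∷ D) E g = trans (cong (p ℚ.* g w ℚ.+_) (𝔼-++ D E g))
  (sym (ℚ.+-assoc (p ℚ.* g w) (𝔼 D g) (𝔼 E g)))

𝔼-scale : ∀ {W} c (D : Weighted W) g → 𝔼 (scale c D) g ≡ c ℚ.* 𝔼 D g
𝔼-scale c []            g = sym (ℚ.*-zeroʳ c)
𝔼-scale c ((p , w) ∷ D) g = trans (cong (c ℚ.* p ℚ.* g w ℚ.+_) (𝔼-scale c D g))
  (solve 4 (λ c p x y → c :* p :* x :+ c :* y := c :* (p :* x :+ y)) refl c p (g w) (𝔼 D g))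

𝔼-relabel : ∀ {V W} (f : V → W) (D : Weighted V) g → 𝔼 (relabel f D) g ≡ 𝔼 D (g ∘ f)
𝔼-relabel f []            g = refl
𝔼-relabel f ((p , w) ∷ D) g = cong (p ℚ.* g (f w) ℚ.+_) (𝔼-relabel f D g)

𝔼-shift : ∀ {W} (D : Weighted W) c g → 𝔼 D (λ w → c ℚ.+ g w) ≡ c ℚ.* 𝔼 D (λ _ → 1ℚ) ℚ.+ 𝔼 D g
𝔼-shift []            c g = solve 1 (λ c → con 0ℚ := c :* con 0ℚ :+ con 0ℚ) refl c
𝔼-shift ((p , w) ∷ D) c g = trans (cong (p ℚ.* (c ℚ.+ g w) ℚ.+_) (𝔼-shift D c g))
  (solve 5 (λ p c x y z → p :* (c :+ x) :+ (c :* y :+ z) := c :* (p :* con 1ℚ :+ y) :+ (p :* x :+ z)) refl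
    p c (g w) (𝔼 D (λ _ → 1ℚ)) (𝔼 D g))

𝔼-*ˡ : ∀ {W} (D : Weighted W) c g → 𝔼 D (λ w → c ℚ.* g w) ≡ c ℚ.* 𝔼 D g
𝔼-*ˡ []            c g = sym (ℚ.*-zeroʳ c)
𝔼-*ˡ ((p , w) ∷ D) c g = trans (cong (p ℚ.* (c ℚ.* g w) ℚ.+_) (𝔼-*ˡ D c g))
  (solve 4 (λ c p x y → p :* (c :* x) :+ c :* y := c :* (p :* x :+ y)) refl c p (g w) (𝔼 D g))

scale-nonNeg : ∀ {W} c {D : Weighted W} → 0ℚ ℚ.≤ c → NonNegWeights D → NonNegWeights (scale c D)
scale-nonNeg c 0≤c 0≤D = All.map⁺ (All.map (0≤* 0≤c) 0≤D)

module Bidding {n} (R : Ratio n) (M : ℕ) where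
  open Ratio R

  -- The law of the number T ≤ ℓ of successes before the first failure (at most ℓ)
  -- when each trial succeeds with probability t.
  average : ∀ ℓ → (Fin (suc ℓ) → ℚ) → ℚ
  average zero    h = h zero
  average (suc ℓ) h = u ℚ.* h zero ℚ.+ t ℚ.* average ℓ (h ∘ suc)

  u+t≡1 : u ℚ.+ t ≡ 1ℚ
  u+t≡1 = trans (cong (u ℚ.+_) t≡1-u) (solve 1 (λ u → u :+ (con 1ℚ :- u) := con 1ℚ) refl u)

  average-shift : ∀ ℓ c h → average ℓ (λ T → c ℚ.+ h T) ≡ c ℚ.+ average ℓ h
  average-shift zero    c h = refl
  average-shift (suc ℓ) c h = begin
    u ℚ.* (c ℚ.+ h zero) ℚ.+ t ℚ.* average ℓ (λ T → c ℚ.+ h (suc T))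
      ≡⟨ cong (λ x → u ℚ.* (c ℚ.+ h zero) ℚ.+ t ℚ.* x) (average-shift ℓ c (h ∘ suc)) ⟩
    u ℚ.* (c ℚ.+ h zero) ℚ.+ t ℚ.* (c ℚ.+ average ℓ (h ∘ suc))
      ≡⟨ solve 5 (λ u t c x y → u :* (c :+ x) :+ t :* (c :+ y) := (u :+ t) :* c :+ (u :* x :+ t :* y)) refl
           u t c (h zero) (average ℓ (h ∘ suc)) ⟩
    (u ℚ.+ t) ℚ.* c ℚ.+ average (suc ℓ) h
      ≡⟨ cong (λ x → x ℚ.* c ℚ.+ average (suc ℓ) h) u+t≡1 ⟩
    1ℚ ℚ.* c ℚ.+ average (suc ℓ) h
      ≡⟨ cong (ℚ._+ average (suc ℓ) h) (ℚ.*-identityˡ c) ⟩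
    c ℚ.+ average (suc ℓ) h ∎
    where open ≡-Reasoning

  average-*ˡ : ∀ ℓ c h → average ℓ (λ T → c ℚ.* h T) ≡ c ℚ.* average ℓ h
  average-*ˡ zero    c h = refl
  average-*ˡ (suc ℓ) c h = trans (cong (λ x → u ℚ.* (c ℚ.* h zero) ℚ.+ t ℚ.* x) (average-*ˡ ℓ c (h ∘ suc)))
    (solve 5 (λ u t c x y → u :* (c :* x) :+ t :* (c :* y) := c :* (u :* x :+ t :* y)) refl
      u t c (h zero) (average ℓ (h ∘ suc)))

  average-cong : ∀ ℓ {f g} → (∀ T → f T ≡ g T) → average ℓ f ≡ average ℓ g
  average-cong zero    eq = eq zero
  average-cong (suc ℓ) eq = cong₂ (λ x y → u ℚ.* x ℚ.+ t ℚ.* y) (eq zero) (average-cong ℓ (eq ∘ suc))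

  average-mono : ∀ ℓ {f g} → (∀ T → f T ℚ.≤ g T) → average ℓ f ℚ.≤ average ℓ g
  average-mono zero    f≤g = f≤g zero
  average-mono (suc ℓ) f≤g = ℚ.+-mono-≤ (*-monoʳ u 0≤u (f≤g zero)) (*-monoʳ t 0≤t (average-mono ℓ (f≤g ∘ suc)))

  -- Since `q t = 1`, each value of `T` below `ℓ` contributes exactly `u`, and the truncation value
  -- `ℓ` contributes 1.
  average-location : ∀ ℓ → average ℓ (λ T → q ^ toℕ T) ≡ 1ℚ ℚ.+ ι ℓ ℚ.* u
  average-location zero    = solve 1 (λ u → con 1ℚ := con 1ℚ :+ con 0ℚ :* u) refl u
  average-location (suc ℓ) = begin
    u ℚ.* 1ℚ ℚ.+ t ℚ.* average ℓ (λ T → q ℚ.* q ^ toℕ T)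
      ≡⟨ cong (λ x → u ℚ.* 1ℚ ℚ.+ t ℚ.* x) (trans (average-*ˡ ℓ q _) (cong (q ℚ.*_) (average-location ℓ))) ⟩
    u ℚ.* 1ℚ ℚ.+ t ℚ.* (q ℚ.* (1ℚ ℚ.+ ι ℓ ℚ.* u))
      ≡⟨ solve 4 (λ u t q i → u :* con 1ℚ :+ t :* (q :* (con 1ℚ :+ i :* u)) :=
                               u :+ (q :* t) :* (con 1ℚ :+ i :* u)) refl u t q (ι ℓ) ⟩
    u ℚ.+ q ℚ.* t ℚ.* (1ℚ ℚ.+ ι ℓ ℚ.* u)
      ≡⟨ cong (λ x → u ℚ.+ x ℚ.* (1ℚ ℚ.+ ι ℓ ℚ.* u)) q*t≡1 ⟩
    u ℚ.+ 1ℚ ℚ.* (1ℚ ℚ.+ ι ℓ ℚ.* u)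
      ≡⟨ solve 2 (λ u i → u :+ con 1ℚ :* (con 1ℚ :+ i :* u) := con 1ℚ :+ (con 1ℚ :+ i) :* u) refl u (ι ℓ) ⟩
    1ℚ ℚ.+ ι (suc ℓ) ℚ.* u ∎
    where open ≡-Reasoning

  walk : ∀ {W} ℓ → (Fin (suc ℓ) → Weighted W) → Weighted W
  walk zero    F = F zero
  walk (suc ℓ) F = scale u (F zero) ++ scale t (walk ℓ (F ∘ suc))

  𝔼-walk : ∀ {W} ℓ (F : Fin (suc ℓ) → Weighted W) g → 𝔼 (walk ℓ F) g ≡ average ℓ (λ T → 𝔼 (F T) g)
  𝔼-walk zero    F g = refl
  𝔼-walk (suc ℓ) F g = trans (𝔼-++ (scale u (F zero)) (scale t (walk ℓ (F ∘ suc))) g)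
    (cong₂ ℚ._+_ (𝔼-scale u (F zero) g)
      (trans (𝔼-scale t (walk ℓ (F ∘ suc)) g) (cong (t ℚ.*_) (𝔼-walk ℓ (F ∘ suc) g))))

  walk-nonNeg : ∀ {W} ℓ {F : Fin (suc ℓ) → Weighted W} → (∀ T → NonNegWeights (F T)) → NonNegWeights (walk ℓ F)
  walk-nonNeg zero    0≤F = 0≤F zero
  walk-nonNeg (suc ℓ) 0≤F = All.++⁺ (scale-nonNeg u 0≤u (0≤F zero)) (scale-nonNeg t 0≤t (walk-nonNeg ℓ (0≤F ∘ suc)))

  Word : ℕ → ℕ → Set
  Word ℓ = Vec (Fin (suc ℓ))

  -- The joint law of `r` independent copies of `T`, one for each phase.
  words : ∀ ℓ r → Weighted (Word ℓ r)
  words ℓ zero    = (1ℚ , []) ∷ []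
  words ℓ (suc r) = walk ℓ (λ T → relabel (T ∷_) (words ℓ r))

  words-nonNeg : ∀ ℓ r → NonNegWeights (words ℓ r)
  words-nonNeg ℓ zero    = 0≤1 ∷ []
  words-nonNeg ℓ (suc r) = walk-nonNeg ℓ (λ T → All.map⁺ (words-nonNeg ℓ r))

  𝔼-words-suc : ∀ ℓ r g → 𝔼 (words ℓ (suc r)) g ≡ average ℓ (λ T → 𝔼 (words ℓ r) (λ w → g (T ∷ w)))
  𝔼-words-suc ℓ r g = trans (𝔼-walk ℓ _ g) (average-cong ℓ (λ T → 𝔼-relabel (T ∷_) (words ℓ r) g))

  average-const : ∀ ℓ c → average ℓ (λ _ → c) ≡ c
  average-const zero    c = refl
  average-const (suc ℓ) c = trans (cong (λ x → u ℚ.* c ℚ.+ t ℚ.* x) (average-const ℓ c))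
    (trans (sym (ℚ.*-distribʳ-+ c u t)) (trans (cong (ℚ._* c) u+t≡1) (ℚ.*-identityˡ c)))

  words-total : ∀ ℓ r → 𝔼 (words ℓ r) (λ _ → 1ℚ) ≡ 1ℚ
  words-total ℓ zero    = refl
  words-total ℓ (suc r) = trans (𝔼-words-suc ℓ r _)
    (trans (average-cong ℓ (λ _ → words-total ℓ r)) (average-const ℓ 1ℚ))

  𝔼-words-shift : ∀ ℓ r c g → 𝔼 (words ℓ r) (λ w → c ℚ.+ g w) ≡ c ℚ.+ 𝔼 (words ℓ r) g
  𝔼-words-shift ℓ r c g = trans (𝔼-shift (words ℓ r) c g)
    (cong (ℚ._+ 𝔼 (words ℓ r) g) (trans (cong (c ℚ.*_) (words-total ℓ r)) (ℚ.*-identityʳ c)))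

  optCost : ∀ {ℓ r} → Word ℓ r → ℚ
  optCost {ℓ} []      = q ^ ℓ
  optCost     (T ∷ w) = q ^ toℕ T ℚ.+ optCost w

  0≤optCost : ∀ {ℓ r} (w : Word ℓ r) → 0ℚ ℚ.≤ optCost w
  0≤optCost {ℓ} []      = ^-nonNeg ℓ 0≤q
  0≤optCost     (T ∷ w) = 0≤+ (^-nonNeg (toℕ T) 0≤q) (0≤optCost w)

  𝔼-optCost : ∀ ℓ r → 𝔼 (words ℓ r) optCost ≡ ι r ℚ.* (1ℚ ℚ.+ ι ℓ ℚ.* u) ℚ.+ q ^ ℓ
  𝔼-optCost ℓ zero    = solve 2 (λ x z → con 1ℚ :* x :+ con 0ℚ := con 0ℚ :* z :+ x) refl (q ^ ℓ) (1ℚ ℚ.+ ι ℓ ℚ.* u)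
  𝔼-optCost ℓ (suc r) = begin
    𝔼 (words ℓ (suc r)) optCost
      ≡⟨ 𝔼-words-suc ℓ r optCost ⟩
    average ℓ (λ T → 𝔼 (words ℓ r) (λ w → q ^ toℕ T ℚ.+ optCost w))
      ≡⟨ average-cong ℓ (λ T → trans (𝔼-words-shift ℓ r (q ^ toℕ T) optCost) (ℚ.+-comm (q ^ toℕ T) x)) ⟩
    average ℓ (λ T → x ℚ.+ q ^ toℕ T)
      ≡⟨ trans (average-shift ℓ x (λ T → q ^ toℕ T)) (cong (x ℚ.+_) (average-location ℓ)) ⟩
    x ℚ.+ z
      ≡⟨ cong (ℚ._+ z) (𝔼-optCost ℓ r) ⟩
    (ι r ℚ.* z ℚ.+ q ^ ℓ) ℚ.+ z
      ≡⟨ solve 3 (λ r z y → (r :* z :+ y) :+ z := (con 1ℚ :+ r) :* z :+ y) refl (ι r) z (q ^ ℓ) ⟩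
    ι (suc r) ℚ.* z ℚ.+ q ^ ℓ ∎
    where
    open ≡-Reasoning
    x = 𝔼 (words ℓ r) optCost
    z = 1ℚ ℚ.+ ι ℓ ℚ.* u

  -- A bid b reaches the first b of the locations 1, q, q², ...; the bid 0 means no service.
  price : ℕ → ℚ
  price zero    = 0ℚ
  price (suc j) = q ^ j

  0≤price : ∀ j → 0ℚ ℚ.≤ price j
  0≤price zero    = ℚ.≤-refl
  0≤price (suc j) = ^-nonNeg j 0≤q

  spent : ∀ {ℓ} → (Fin (suc ℓ) → ℕ) → Fin (suc ℓ) → ℚ
  spent         b zero    = price (b zero)
  spent {suc ℓ} b (suc T) = price (b zero) ℚ.+ spent (b ∘ suc) T

  v : ℚ
  v = e-seq M ℚ.* t ℚ.* u

  0≤v : 0ℚ ℚ.≤ v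
  0≤v = 0≤* (0≤* (ℚ.≤-trans 0≤1 (1≤e-seq M)) 0≤t) 0≤u

  ^-antimono : ∀ {k a} → k ℕ.≤ a → t ^ a ℚ.≤ t ^ k
  ^-antimono {k} k≤a with ℕ.m≤n⇒∃[o]m+o≡n k≤a
  ... | o , refl = begin
    t ^ (k ℕ.+ o)      ≡⟨ ^-homo-* t k o ⟩
    t ^ k ℚ.* t ^ o    ≤⟨ *-monoʳ (t ^ k) (^-nonNeg k 0≤t) (t^≤1 o) ⟩
    t ^ k ℚ.* 1ℚ       ≡⟨ ℚ.*-identityʳ (t ^ k) ⟩
    t ^ k              ∎
    where
    open ℚ.≤-Reasoning
    t^≤1 : ∀ o → t ^ o ℚ.≤ 1ℚ
    t^≤1 zero    = ℚ.≤-refl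
    t^≤1 (suc o) = ℚ.≤-trans (*-monoʳ t 0≤t (t^≤1 o)) (ℚ.≤-trans (ℚ.≤-reflexive (ℚ.*-identityʳ t)) t≤1)

  -- One step of the potential argument. A bid `b = a + 1 + d` has price `q^(a+d)`; since `k ≤ a`,
  -- the weight `t^k` is at least `t^a`, which cancels `q^a` and leaves `q^d`. By `jump` this pays
  -- for `d + 1` units.
  price-bound : ∀ k a b → k ℕ.≤ a → v ℚ.* ι (a ℕ.⊔ b) ℚ.≤ v ℚ.* ι a ℚ.+ t ^ k ℚ.* price b
  price-bound k a b k≤a with ℕ.<-≤-connex a b
  ... | inj₂ b≤a rewrite ℕ.m≥n⇒m⊔n≡m b≤a = ≤-by-diff _ (0≤* (^-nonNeg k 0≤t) (0≤price b)) refl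
  ... | inj₁ a<b with ℕ.m≤n⇒∃[o]m+o≡n a<b
  ...   | d , refl = begin
    v ℚ.* ι (a ℕ.⊔ (suc a ℕ.+ d))
      ≡⟨ cong (λ x → v ℚ.* ι x) (ℕ.m≤n⇒m⊔n≡n (ℕ.<⇒≤ a<b)) ⟩
    v ℚ.* ι (suc a ℕ.+ d)
      ≡⟨ cong (λ x → v ℚ.* ι x) (sym (ℕ.+-suc a d)) ⟩
    v ℚ.* ι (a ℕ.+ suc d)
      ≡⟨ trans (cong (v ℚ.*_) (ι-+ a (suc d))) (ℚ.*-distribˡ-+ v (ι a) (ι (suc d))) ⟩
    v ℚ.* ι a ℚ.+ v ℚ.* ι (suc d)
      ≤⟨ ℚ.+-monoʳ-≤ (v ℚ.* ι a) (jump M d) ⟩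
    v ℚ.* ι a ℚ.+ q ^ d
      ≡⟨ cong (v ℚ.* ι a ℚ.+_) (sym (ℚ.*-identityˡ (q ^ d))) ⟩
    v ℚ.* ι a ℚ.+ 1ℚ ℚ.* q ^ d
      ≡⟨ cong (λ x → v ℚ.* ι a ℚ.+ x ℚ.* q ^ d) (sym (trans (ℚ.*-comm (t ^ a) (q ^ a)) (q^*t^≡1 a))) ⟩
    v ℚ.* ι a ℚ.+ t ^ a ℚ.* q ^ a ℚ.* q ^ d
      ≡⟨ cong (v ℚ.* ι a ℚ.+_) (trans (ℚ.*-assoc (t ^ a) (q ^ a) (q ^ d)) (cong (t ^ a ℚ.*_) (sym (^-homo-* q a d)))) ⟩
    v ℚ.* ι a ℚ.+ t ^ a ℚ.* q ^ (a ℕ.+ d)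
      ≤⟨ ℚ.+-monoʳ-≤ (v ℚ.* ι a) (*-monoˡ (q ^ (a ℕ.+ d)) (^-nonNeg (a ℕ.+ d) 0≤q) (^-antimono k≤a)) ⟩
    v ℚ.* ι a ℚ.+ t ^ k ℚ.* q ^ (a ℕ.+ d) ∎
    where open ℚ.≤-Reasoning

  -- The bids are for the stages k, k+1, ... and a is the largest bid before stage k; by the end of
  -- stage j, some bid is larger than j. (Stated negatively, as it is only known classically.)
  Covers : ∀ {ℓ} → ℕ → ℕ → (Fin (suc ℓ) → ℕ) → Set
  Covers {ℓ} k a b = ∀ (i : Fin (suc ℓ)) → a ℕ.≤ k ℕ.+ toℕ i →
    ¬ (∀ (j : Fin (suc ℓ)) → toℕ j ℕ.≤ toℕ i → b j ℕ.≤ k ℕ.+ toℕ i)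

  Covers-suc : ∀ {ℓ} k a (b : Fin (suc (suc ℓ)) → ℕ) → Covers k a b → Covers (suc k) (a ℕ.⊔ b zero) (b ∘ suc)
  Covers-suc k a b cov i a⊔b≤ b≤ = cov (suc i) (subst (a ℕ.≤_) (sym (ℕ.+-suc k (toℕ i))) (ℕ.m⊔n≤o⇒m≤o a (b zero) a⊔b≤)) small
    where
    small : ∀ j → toℕ j ℕ.≤ suc (toℕ i) → b j ℕ.≤ k ℕ.+ suc (toℕ i)
    small zero    _         = subst (b zero ℕ.≤_) (sym (ℕ.+-suc k (toℕ i))) (ℕ.m⊔n≤o⇒n≤o a (b zero) a⊔b≤)
    small (suc j) (ℕ.s≤s p) = subst (b (suc j) ℕ.≤_) (sym (ℕ.+-suc k (toℕ i))) (b≤ j p)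

  Covers-first : ∀ {ℓ} k a (b : Fin (suc ℓ) → ℕ) → Covers k a b → suc k ℕ.≤ a ℕ.⊔ b zero
  Covers-first k a b cov = ℕ.≰⇒> λ a⊔b≤k → cov zero
    (subst (a ℕ.≤_) (sym (ℕ.+-identityʳ k)) (ℕ.m⊔n≤o⇒m≤o a (b zero) a⊔b≤k))
    λ { zero _ → subst (b zero ℕ.≤_) (sym (ℕ.+-identityʳ k)) (ℕ.m⊔n≤o⇒n≤o a (b zero) a⊔b≤k)
      ; (suc j) () }

  -- `price-bound` telescopes over the stages. Coverage serves twice: it restores the hypothesis
  -- `k ≤ a` at every next stage, and it forces the final largest bid up to `ℓ + 1 + k`.
  spent-bound : ∀ ℓ k a (b : Fin (suc ℓ) → ℕ) → k ℕ.≤ a → Covers k a b →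
    v ℚ.* ι (suc ℓ ℕ.+ k) ℚ.≤ v ℚ.* ι a ℚ.+ t ^ k ℚ.* average ℓ (spent b)
  spent-bound zero    k a b k≤a cov =
    ℚ.≤-trans (*-monoʳ v 0≤v (ι-mono-≤ (Covers-first k a b cov))) (price-bound k a (b zero) k≤a)
  spent-bound (suc ℓ) k a b k≤a cov = begin
    v ℚ.* ι (suc (suc ℓ) ℕ.+ k)
      ≡⟨ cong (λ x → v ℚ.* ι (suc x)) (sym (ℕ.+-suc ℓ k)) ⟩
    v ℚ.* ι (suc ℓ ℕ.+ suc k)
      ≤⟨ spent-bound ℓ (suc k) (a ℕ.⊔ b zero) (b ∘ suc) (Covers-first k a b cov) (Covers-suc k a b cov) ⟩
    v ℚ.* ι (a ℕ.⊔ b zero) ℚ.+ t ^ suc k ℚ.* rest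
      ≤⟨ ℚ.+-monoˡ-≤ (t ^ suc k ℚ.* rest) (price-bound k a (b zero) k≤a) ⟩
    v ℚ.* ι a ℚ.+ t ^ k ℚ.* price (b zero) ℚ.+ t ^ suc k ℚ.* rest
      ≡⟨ solve 5 (λ x y p t r → x :+ y :* p :+ (t :* y) :* r := x :+ y :* (p :+ t :* r)) refl
           (v ℚ.* ι a) (t ^ k) (price (b zero)) t rest ⟩
    v ℚ.* ι a ℚ.+ t ^ k ℚ.* (price (b zero) ℚ.+ t ℚ.* rest)
      ≡⟨ cong (λ x → v ℚ.* ι a ℚ.+ t ^ k ℚ.* x) (sym unfold) ⟩
    v ℚ.* ι a ℚ.+ t ^ k ℚ.* average (suc ℓ) (spent b) ∎
    where
    open ℚ.≤-Reasoning
    rest = average ℓ (spent (b ∘ suc))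
    p = price (b zero)
    -- The first bid is paid for every `T`, the later ones only after a success, which has
    -- probability `t`.
    unfold : average (suc ℓ) (spent b) ≡ p ℚ.+ t ℚ.* rest
    unfold = begin-equality
      u ℚ.* p ℚ.+ t ℚ.* average ℓ (λ T → p ℚ.+ spent (b ∘ suc) T)
        ≡⟨ cong (λ x → u ℚ.* p ℚ.+ t ℚ.* x) (average-shift ℓ p (spent (b ∘ suc))) ⟩
      u ℚ.* p ℚ.+ t ℚ.* (p ℚ.+ rest)
        ≡⟨ solve 4 (λ u p t r → u :* p :+ t :* (p :+ r) := (u :+ t) :* p :+ t :* r) refl u p t rest ⟩
      (u ℚ.+ t) ℚ.* p ℚ.+ t ℚ.* rest
        ≡⟨ cong (λ x → x ℚ.+ t ℚ.* rest) (trans (cong (ℚ._* p) u+t≡1) (ℚ.*-identityˡ p)) ⟩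
      p ℚ.+ t ℚ.* rest ∎

  bidding-bound : ∀ ℓ (b : Fin (suc ℓ) → ℕ) → Covers 0 0 b → v ℚ.* ι (suc ℓ) ℚ.≤ average ℓ (spent b)
  bidding-bound ℓ b cov = begin
    v ℚ.* ι (suc ℓ)                         ≡⟨ cong (λ x → v ℚ.* ι x) (sym (ℕ.+-identityʳ (suc ℓ))) ⟩
    v ℚ.* ι (suc ℓ ℕ.+ 0)                   ≤⟨ spent-bound ℓ 0 0 b ℕ.z≤n cov ⟩
    v ℚ.* 0ℚ ℚ.+ 1ℚ ℚ.* average ℓ (spent b)    ≡⟨ solve 2 (λ v x → v :* con 0ℚ :+ con 1ℚ :* x := x) refl v (average ℓ (spent b)) ⟩
    average ℓ (spent b)                        ∎
    where open ℚ.≤-Reasoning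

  1≤q^ : ∀ k → 1ℚ ℚ.≤ q ^ k
  1≤q^ k = ℚ.≤-trans (≤-by-diff (ι k ℚ.* u) (0≤* (0≤ι k) 0≤u) refl) (bernoulli-q k)

  price-mono : ∀ {i j} → i ℕ.≤ j → price i ℚ.≤ price j
  price-mono {zero}  {j}     _         = 0≤price j
  price-mono {suc i} {suc j} (ℕ.s≤s p) with ℕ.m≤n⇒∃[o]m+o≡n p
  ... | o , refl = begin
    q ^ i              ≡⟨ sym (ℚ.*-identityʳ (q ^ i)) ⟩
    q ^ i ℚ.* 1ℚ       ≤⟨ *-monoʳ (q ^ i) (^-nonNeg i 0≤q) (1≤q^ o) ⟩
    q ^ i ℚ.* q ^ o    ≡⟨ sym (^-homo-* q i o) ⟩
    q ^ (i ℕ.+ o)      ∎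
    where open ℚ.≤-Reasoning

  -- Crude, but the same for all algorithms: this is what later allows a common truncation level.
  spent≤ : ∀ {ℓ} B (b : Fin (suc ℓ) → ℕ) → (∀ i → b i ℕ.≤ B) → ∀ T → spent b T ℚ.≤ ι (suc ℓ) ℚ.* price B
  spent≤ {ℓ} B b b≤B zero    = begin
    price (b zero)                    ≤⟨ price-mono (b≤B zero) ⟩
    price B                           ≤⟨ ≤-by-diff (ι ℓ ℚ.* price B) (0≤* (0≤ι ℓ) (0≤price B))
                                           (solve 2 (λ i p → (con 1ℚ :+ i) :* p := p :+ i :* p) refl (ι ℓ) (price B)) ⟩
    ι (suc ℓ) ℚ.* price B             ∎
    where open ℚ.≤-Reasoning
  spent≤ {suc ℓ} B b b≤B (suc T) = begin
    price (b zero) ℚ.+ spent (b ∘ suc) T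
      ≤⟨ ℚ.+-mono-≤ (price-mono (b≤B zero)) (spent≤ B (b ∘ suc) (b≤B ∘ suc) T) ⟩
    price B ℚ.+ ι (suc ℓ) ℚ.* price B
      ≡⟨ solve 2 (λ i p → p :+ i :* p := (con 1ℚ :+ i) :* p) refl (ι (suc ℓ)) (price B) ⟩
    ι (suc (suc ℓ)) ℚ.* price B ∎
    where open ℚ.≤-Reasoning

-- Real numbers

½-split : ∀ ε → ε ≡ ε ℚ.* ½ ℚ.+ ε ℚ.* ½
½-split ε = solve 1 (λ e → e := e :* con ½ :+ e :* con ½) refl ε

0<½ : ∀ {ε} → 0ℚ ℚ.< ε → 0ℚ ℚ.< ε ℚ.* ½
0<½ 0<ε = 0<* 0<ε (ℚ.positive⁻¹ ½)

p≤p+q : ∀ {p q} → 0ℚ ℚ.≤ q → p ℚ.≤ p ℚ.+ q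
p≤p+q 0≤q = ≤-by-diff _ 0≤q refl

p≤∣p∣ : ∀ p → p ℚ.≤ ℚ.∣ p ∣
p≤∣p∣ p with ℚ.≤-total p 0ℚ
... | inj₁ p≤0 = ℚ.≤-trans p≤0 (ℚ.0≤∣p∣ p)
... | inj₂ 0≤p = ℚ.≤-reflexive (sym (ℚ.0≤p⇒∣p∣≡p 0≤p))

near : ∀ p q {δ} → ℚ.∣ p ℚ.- q ∣ ℚ.< δ → p ℚ.≤ q ℚ.+ δ
near p q {δ} close = begin
  p                ≡⟨ solve 2 (λ p q → p := q :+ (p :- q)) refl p q ⟩
  q ℚ.+ (p ℚ.- q)  ≤⟨ ℚ.+-monoʳ-≤ q (ℚ.≤-trans (p≤∣p∣ (p ℚ.- q)) (ℚ.<⇒≤ close)) ⟩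
  q ℚ.+ δ          ∎
  where open ℚ.≤-Reasoning

≤-pointwise : ∀ {x y} → (∀ n → seq x n ℚ.≤ seq y n) → x ≤ y
≤-pointwise h ε 0<ε = 0 , λ n _ → ℚ.≤-trans (h n) (p≤p+q (ℚ.<⇒≤ 0<ε))

≤-refl : ∀ {x} → x ≤ x
≤-refl {x} = ≤-pointwise {x} {x} (λ _ → ℚ.≤-refl)

≈-refl : ∀ {x} → x ≈ x
≈-refl {x} = ≤-refl {x} , ≤-refl {x}

≤-trans : ∀ {x y z} → x ≤ y → y ≤ z → x ≤ z
≤-trans {x} {y} {z} x≤y y≤z ε 0<ε with x≤y (ε ℚ.* ½) (0<½ 0<ε) | y≤z (ε ℚ.* ½) (0<½ 0<ε)
... | M , h | N , k = M ℕ.⊔ N , λ n p → begin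
  seq x n                                    ≤⟨ h n (ℕ.m⊔n≤o⇒m≤o M N p) ⟩
  seq y n ℚ.+ ε ℚ.* ½                        ≤⟨ ℚ.+-monoˡ-≤ (ε ℚ.* ½) (k n (ℕ.m⊔n≤o⇒n≤o M N p)) ⟩
  seq z n ℚ.+ ε ℚ.* ½ ℚ.+ ε ℚ.* ½            ≡⟨ ℚ.+-assoc (seq z n) (ε ℚ.* ½) (ε ℚ.* ½) ⟩
  seq z n ℚ.+ (ε ℚ.* ½ ℚ.+ ε ℚ.* ½)          ≡⟨ cong (seq z n ℚ.+_) (sym (½-split ε)) ⟩
  seq z n ℚ.+ ε                              ∎
  where open ℚ.≤-Reasoning

+-mono-≤ : ∀ {x y z w} → x ≤ y → z ≤ w → x + z ≤ y + w
+-mono-≤ {x} {y} {z} {w} x≤y z≤w ε 0<ε with x≤y (ε ℚ.* ½) (0<½ 0<ε) | z≤w (ε ℚ.* ½) (0<½ 0<ε)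
... | M , h | N , k = M ℕ.⊔ N , λ n p → begin
  seq x n ℚ.+ seq z n
    ≤⟨ ℚ.+-mono-≤ (h n (ℕ.m⊔n≤o⇒m≤o M N p)) (k n (ℕ.m⊔n≤o⇒n≤o M N p)) ⟩
  (seq y n ℚ.+ ε ℚ.* ½) ℚ.+ (seq w n ℚ.+ ε ℚ.* ½)
    ≡⟨ solve 3 (λ y w e → (y :+ e :* con ½) :+ (w :+ e :* con ½) := y :+ w :+ e) refl (seq y n) (seq w n) ε ⟩
  seq y n ℚ.+ seq w n ℚ.+ ε ∎
  where open ℚ.≤-Reasoning

fromℚ-mono : ∀ {p q} → p ℚ.≤ q → fromℚ p ≤ fromℚ q
fromℚ-mono {p} {q} p≤q = ≤-pointwise {fromℚ p} {fromℚ q} (λ _ → p≤q)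

<⇒≱ : ∀ {x y} → y < x → ¬ x ≤ y
<⇒≱ {x} {y} (ε , 0<ε , M , h) x≤y with x≤y (ε ℚ.* ½) (0<½ 0<ε)
... | N , k = ℚ.<-irrefl refl (begin-strict
  seq y n ℚ.+ ε ℚ.* ½                    ≡⟨ sym (ℚ.+-identityʳ _) ⟩
  seq y n ℚ.+ ε ℚ.* ½ ℚ.+ 0ℚ             <⟨ ℚ.+-monoʳ-< (seq y n ℚ.+ ε ℚ.* ½) (0<½ 0<ε) ⟩
  seq y n ℚ.+ ε ℚ.* ½ ℚ.+ ε ℚ.* ½        ≡⟨ ℚ.+-assoc (seq y n) (ε ℚ.* ½) (ε ℚ.* ½) ⟩
  seq y n ℚ.+ (ε ℚ.* ½ ℚ.+ ε ℚ.* ½)      ≡⟨ cong (seq y n ℚ.+_) (sym (½-split ε)) ⟩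
  seq y n ℚ.+ ε                          ≤⟨ h n (ℕ.m≤m⊔n M N) ⟩
  seq x n                                ≤⟨ k n (ℕ.m≤n⊔m M N) ⟩
  seq y n ℚ.+ ε ℚ.* ½                    ∎)
  where
  open ℚ.≤-Reasoning
  n = M ℕ.⊔ N

fromℚ-cancel : ∀ {p q} → fromℚ p ≤ fromℚ q → p ℚ.≤ q
fromℚ-cancel {p} {q} p≤q with p ℚ.≤? q
... | yes h = h
... | no  h = ⊥-elim (<⇒≱ {fromℚ p} {fromℚ q} (p ℚ.- q , gap , 0 , λ _ _ →
    ℚ.≤-reflexive (solve 2 (λ p q → q :+ (p :- q) := p) refl p q)) p≤q)
  where
  gap : 0ℚ ℚ.< p ℚ.- q
  gap = subst (ℚ._< p ℚ.- q) (ℚ.+-inverseʳ q) (ℚ.+-monoˡ-< (ℚ.- q) (ℚ.≰⇒> h))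

-- The two alternatives overlap, so comparing the rational terms at a single index `N`, beyond which
-- both sequences move by less than `δ`, suffices to choose one.
cotrans : ∀ x y {α δ} → 0ℚ ℚ.< α → 0ℚ ℚ.< δ →
  y < x ⊎ ∃[ N ] (∀ n → N ℕ.≤ n → seq x n ℚ.≤ seq y n ℚ.+ (α ℚ.+ ((δ ℚ.+ δ) ℚ.+ (δ ℚ.+ δ))))
cotrans x y {α} {δ} 0<α 0<δ with isCauchy x δ 0<δ | isCauchy y δ 0<δ
... | M₁ , cx | M₂ , cy = decide (xN ℚ.≤? yN ℚ.+ (α ℚ.+ (δ ℚ.+ δ)))
  where
  open ℚ.≤-Reasoning
  N = M₁ ℕ.⊔ M₂
  xN = seq x N
  yN = seq y N
  px : ∀ {n} → N ℕ.≤ n → M₁ ℕ.≤ n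
  px = ℕ.m⊔n≤o⇒m≤o M₁ M₂
  py : ∀ {n} → N ℕ.≤ n → M₂ ℕ.≤ n
  py = ℕ.m⊔n≤o⇒n≤o M₁ M₂
  decide : Dec (xN ℚ.≤ yN ℚ.+ (α ℚ.+ (δ ℚ.+ δ))) → _
  decide (yes h) = inj₂ (N , λ n N≤n → begin
    seq x n
      ≤⟨ near (seq x n) xN (cx n N (px N≤n) (px ℕ.≤-refl)) ⟩
    xN ℚ.+ δ
      ≤⟨ ℚ.+-monoˡ-≤ δ h ⟩
    yN ℚ.+ (α ℚ.+ (δ ℚ.+ δ)) ℚ.+ δ
      ≤⟨ ℚ.+-monoˡ-≤ δ (ℚ.+-monoˡ-≤ (α ℚ.+ (δ ℚ.+ δ)) (near yN (seq y n) (cy N n (py ℕ.≤-refl) (py N≤n)))) ⟩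
    seq y n ℚ.+ δ ℚ.+ (α ℚ.+ (δ ℚ.+ δ)) ℚ.+ δ
      ≡⟨ solve 4 (λ y a d b → y :+ d :+ (a :+ b) :+ d := y :+ (a :+ (b :+ (d :+ d)))) refl (seq y n) α δ (δ ℚ.+ δ) ⟩
    seq y n ℚ.+ (α ℚ.+ ((δ ℚ.+ δ) ℚ.+ (δ ℚ.+ δ))) ∎)
  decide (no h) = inj₁ (α , 0<α , N , λ m N≤m → begin
    seq y m ℚ.+ α
      ≤⟨ ℚ.+-monoˡ-≤ α (near (seq y m) yN (cy m N (py N≤m) (py ℕ.≤-refl))) ⟩
    yN ℚ.+ δ ℚ.+ α
      ≡⟨ solve 3 (λ y d a → y :+ d :+ a := y :+ (a :+ (d :+ d)) :- d) refl yN δ α ⟩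
    yN ℚ.+ (α ℚ.+ (δ ℚ.+ δ)) ℚ.- δ
      ≤⟨ ℚ.+-monoˡ-≤ (ℚ.- δ) (ℚ.<⇒≤ (ℚ.≰⇒> h)) ⟩
    xN ℚ.- δ
      ≤⟨ ℚ.+-monoˡ-≤ (ℚ.- δ) (near xN (seq x m) (cx N m (px ℕ.≤-refl) (px N≤m))) ⟩
    seq x m ℚ.+ δ ℚ.- δ
      ≡⟨ solve 2 (λ x d → x :+ d :- d := x) refl (seq x m) δ ⟩
    seq x m ∎)

halve : ∀ ε → 0ℚ ℚ.< ε → ∃[ δ ] (0ℚ ℚ.< δ × δ ℚ.+ δ ≡ ε)
halve ε 0<ε = ε ℚ.* ½ , 0<½ 0<ε , sym (½-split ε)

≮⇒≥ : ∀ {x y} → ¬ y < x → x ≤ y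
≮⇒≥ {x} {y} y≮x ε 0<ε =
  -- The slack is spent as `α = ε/2` and `δ = ε/8`, so that `α + 4δ = ε`.
  let α , 0<α , α+α≡ε = halve ε 0<ε
      β , 0<β , β+β≡α = halve α 0<α
      δ , 0<δ , δ+δ≡β = halve β 0<β
      split = trans (cong (α ℚ.+_) (trans (cong₂ ℚ._+_ δ+δ≡β δ+δ≡β) β+β≡α)) α+α≡ε
  in [ (λ y<x → ⊥-elim (y≮x y<x))
     , (λ (N , h) → N , λ n N≤n → subst (λ z → seq x n ℚ.≤ seq y n ℚ.+ z) split (h n N≤n))
     ]′ (cotrans x y 0<α 0<δ)

≰⇒¬¬> : ∀ {x y} → ¬ x ≤ y → ¬ ¬ y < x
≰⇒¬¬> {x} {y} x≰y y≮x = x≰y (≮⇒≥ {x} {y} y≮x)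

≤-stable : ∀ {x y} → ¬ ¬ x ≤ y → x ≤ y
≤-stable {x} {y} x≤y = ≮⇒≥ {x} {y} (λ y<x → x≤y (<⇒≱ {x} {y} y<x))

<⇒≤ : ∀ {x y} → x < y → x ≤ y
<⇒≤ {x} {y} (ε , 0<ε , N , h) δ 0<δ = N , λ n p → ℚ.≤-trans (p≤p+q (ℚ.<⇒≤ 0<ε)) (ℚ.≤-trans (h n p) (p≤p+q (ℚ.<⇒≤ 0<δ)))

<-≤-trans : ∀ {x y z} → x < y → y ≤ z → x < z
<-≤-trans {x} {y} {z} (ε , 0<ε , M , h) y≤z with y≤z (ε ℚ.* ½) (0<½ 0<ε)
... | N , k = ε ℚ.* ½ , 0<½ 0<ε , M ℕ.⊔ N , λ n p → begin
  seq x n ℚ.+ ε ℚ.* ½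
    ≡⟨ solve 2 (λ x e → x :+ e :* con ½ := x :+ e :- e :* con ½) refl (seq x n) ε ⟩
  seq x n ℚ.+ ε ℚ.- ε ℚ.* ½
    ≤⟨ ℚ.+-monoˡ-≤ (ℚ.- (ε ℚ.* ½)) (ℚ.≤-trans (h n (ℕ.m⊔n≤o⇒m≤o M N p)) (k n (ℕ.m⊔n≤o⇒n≤o M N p))) ⟩
  seq z n ℚ.+ ε ℚ.* ½ ℚ.- ε ℚ.* ½
    ≡⟨ solve 2 (λ z d → z :+ d :- d := z) refl (seq z n) (ε ℚ.* ½) ⟩
  seq z n ∎
  where open ℚ.≤-Reasoning

≤-<-trans : ∀ {x y z} → x ≤ y → y < z → x < z
≤-<-trans {x} {y} {z} x≤y (ε , 0<ε , M , h) with x≤y (ε ℚ.* ½) (0<½ 0<ε)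
... | N , k = ε ℚ.* ½ , 0<½ 0<ε , M ℕ.⊔ N , λ n p → begin
  seq x n ℚ.+ ε ℚ.* ½
    ≤⟨ ℚ.+-monoˡ-≤ (ε ℚ.* ½) (k n (ℕ.m⊔n≤o⇒n≤o M N p)) ⟩
  seq y n ℚ.+ ε ℚ.* ½ ℚ.+ ε ℚ.* ½
    ≡⟨ trans (ℚ.+-assoc (seq y n) (ε ℚ.* ½) (ε ℚ.* ½)) (cong (seq y n ℚ.+_) (sym (½-split ε))) ⟩
  seq y n ℚ.+ ε
    ≤⟨ h n (ℕ.m⊔n≤o⇒m≤o M N p) ⟩
  seq z n ∎
  where open ℚ.≤-Reasoning

fromℚ-mono-< : ∀ {p q} → p ℚ.< q → fromℚ p < fromℚ q
fromℚ-mono-< {p} {q} p<q = q ℚ.- p , subst (ℚ._< q ℚ.- p) (ℚ.+-inverseʳ p) (ℚ.+-monoˡ-< (ℚ.- p) p<q) , 0 ,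
  λ _ _ → ℚ.≤-reflexive (solve 2 (λ p q → p :+ (q :- p) := q) refl p q)

small-factor : ∀ p → ∃[ w ] (0ℚ ℚ.< w × p ℚ.* w ℚ.≤ 1ℚ)
small-factor p =
  let k , p≤k         = archimedean p
      w , 0<w , kw≡1  = reciprocal k
  in w , 0<w , ℚ.≤-trans (*-monoˡ w (ℚ.<⇒≤ 0<w) (ℚ.≤-trans p≤k (ι-mono-≤ (ℕ.n≤1+n k)))) (ℚ.≤-reflexive kw≡1)

*-mono-≤ : ∀ {p x y} → 0ℚ ℚ.≤ p → x ≤ y → fromℚ p * x ≤ fromℚ p * y
*-mono-≤ {p} {x} {y} 0≤p x≤y ε 0<ε =
  -- `w` takes the place of `1/p`, since `p` may be 0.
  let w , 0<w , pw≤1 = small-factor p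
      N , h          = x≤y (ε ℚ.* w) (0<* 0<ε 0<w)
  in N , λ n N≤n → scaled (seq x n) (seq y n) w pw≤1 (h n N≤n)
  where
  open ℚ.≤-Reasoning
  scaled : ∀ a b w → p ℚ.* w ℚ.≤ 1ℚ → a ℚ.≤ b ℚ.+ ε ℚ.* w → p ℚ.* a ℚ.≤ p ℚ.* b ℚ.+ ε
  scaled a b w pw≤1 h = begin
    p ℚ.* a                            ≤⟨ *-monoʳ p 0≤p h ⟩
    p ℚ.* (b ℚ.+ ε ℚ.* w)              ≡⟨ solve 4 (λ p y e w → p :* (y :+ e :* w) := p :* y :+ e :* (p :* w)) refl p b ε w ⟩
    p ℚ.* b ℚ.+ ε ℚ.* (p ℚ.* w)        ≤⟨ ℚ.+-monoʳ-≤ (p ℚ.* b) (*-monoʳ ε (ℚ.<⇒≤ 0<ε) pw≤1) ⟩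
    p ℚ.* b ℚ.+ ε ℚ.* 1ℚ               ≡⟨ cong (p ℚ.* b ℚ.+_) (ℚ.*-identityʳ ε) ⟩
    p ℚ.* b ℚ.+ ε                      ∎

-- A copy of _≤_ that does not unfold, so that both sides can be inferred from a proof.
infix 4 _≼_

record _≼_ (x y : ℝ) : Set where
  constructor ⌊_⌋
  field ⌈_⌉ : x ≤ y

open _≼_ public

≼-preorder : Preorder _ _ _
≼-preorder = record
  { _≈_ = _≡_ ; _≲_ = _≼_
  ; isPreorder = record
    { isEquivalence = isEquivalence
    ; reflexive     = λ { {x} refl → ⌊ ≤-refl {x} ⌋ }
    ; trans         = λ { {x} {y} {z} ⌊ p ⌋ ⌊ q ⌋ → ⌊ ≤-trans {x} {y} {z} p q ⌋ } } }

module ≼-Reasoning = Relation.Binary.Reasoning.Preorder ≼-preorder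

≼-refl : ∀ {x} → x ≼ x
≼-refl = Preorder.refl ≼-preorder

≼-trans : ∀ {x y z} → x ≼ y → y ≼ z → x ≼ z
≼-trans = Preorder.trans ≼-preorder

≼-pointwise : ∀ {x y} → (∀ n → seq x n ≡ seq y n) → x ≼ y
≼-pointwise {x} {y} h = ⌊ ≤-pointwise {x} {y} (λ n → ℚ.≤-reflexive (h n)) ⌋

-- Opaque for the same reason: _+_ and _*_ unfold to their Cauchy proofs.
infixl 6 _⊞_
infixr 7 _⊙_

opaque
  _⊞_ : ℝ → ℝ → ℝ
  x ⊞ y = x + y

  _⊙_ : ℚ → ℝ → ℝ
  p ⊙ x = fromℚ p * x

  ⊞⇒+ : ∀ x y → x ⊞ y ≼ x + y
  ⊞⇒+ x y = ≼-refl

  +⇒⊞ : ∀ x y → x + y ≼ x ⊞ y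
  +⇒⊞ x y = ≼-refl

  ⊙⇒* : ∀ p x → p ⊙ x ≼ fromℚ p * x
  ⊙⇒* p x = ≼-refl

  ⊞-mono : ∀ {x y z w} → x ≼ y → z ≼ w → x ⊞ z ≼ y ⊞ w
  ⊞-mono {x} {y} {z} {w} ⌊ p ⌋ ⌊ q ⌋ = ⌊ +-mono-≤ {x} {y} {z} {w} p q ⌋

  ⊙-mono : ∀ {p x y} → 0ℚ ℚ.≤ p → x ≼ y → p ⊙ x ≼ p ⊙ y
  ⊙-mono {p} {x} {y} 0≤p ⌊ h ⌋ = ⌊ *-mono-≤ {p} {x} {y} 0≤p h ⌋

  ⊞-identityˡ : ∀ x → 0ℝ ⊞ x ≼ x
  ⊞-identityˡ x = ≼-pointwise (λ n → ℚ.+-identityˡ (seq x n))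

  ⊞-identityˡ⁻ : ∀ x → x ≼ 0ℝ ⊞ x
  ⊞-identityˡ⁻ x = ≼-pointwise (λ n → sym (ℚ.+-identityˡ (seq x n)))

  ⊞-identityʳ : ∀ x → x ⊞ 0ℝ ≼ x
  ⊞-identityʳ x = ≼-pointwise (λ n → ℚ.+-identityʳ (seq x n))

  ⊞-identityʳ⁻ : ∀ x → x ≼ x ⊞ 0ℝ
  ⊞-identityʳ⁻ x = ≼-pointwise (λ n → sym (ℚ.+-identityʳ (seq x n)))

  ⊞-assoc⁻ : ∀ x y z → x ⊞ (y ⊞ z) ≼ x ⊞ y ⊞ z
  ⊞-assoc⁻ x y z = ≼-pointwise (λ n → sym (ℚ.+-assoc (seq x n) (seq y n) (seq z n)))

  ⊙-zeroʳ : ∀ p → p ⊙ 0ℝ ≼ 0ℝ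
  ⊙-zeroʳ p = ≼-pointwise (λ _ → ℚ.*-zeroʳ p)

  ⊙-zeroʳ⁻ : ∀ p → 0ℝ ≼ p ⊙ 0ℝ
  ⊙-zeroʳ⁻ p = ≼-pointwise (λ _ → sym (ℚ.*-zeroʳ p))

  ⊙-1 : ∀ p → p ⊙ 1ℝ ≼ fromℚ p
  ⊙-1 p = ≼-pointwise (λ _ → ℚ.*-identityʳ p)

  ⊙-1⁻ : ∀ p → fromℚ p ≼ p ⊙ 1ℝ
  ⊙-1⁻ p = ≼-pointwise (λ _ → sym (ℚ.*-identityʳ p))

  ⊙-distrib : ∀ p x y → p ⊙ (x ⊞ y) ≼ p ⊙ x ⊞ p ⊙ y
  ⊙-distrib p x y = ≼-pointwise (λ n → ℚ.*-distribˡ-+ p (seq x n) (seq y n))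

  ⊙-fromℚ : ∀ p q → p ⊙ fromℚ q ≼ fromℚ (p ℚ.* q)
  ⊙-fromℚ p q = ≼-pointwise (λ _ → refl)

  ⊞-fromℚ : ∀ p q → fromℚ p ⊞ fromℚ q ≼ fromℚ (p ℚ.+ q)
  ⊞-fromℚ p q = ≼-pointwise (λ _ → refl)

  ⊞-fromℚ⁻ : ∀ p q → fromℚ (p ℚ.+ q) ≼ fromℚ p ⊞ fromℚ q
  ⊞-fromℚ⁻ p q = ≼-pointwise (λ _ → refl)

  ⊙-difference : ∀ p q x → p ⊙ x ⊞ (q ℚ.- p) ⊙ x ≼ q ⊙ x
  ⊙-difference p q x = ≼-pointwise (λ n → solve 3 (λ p q x → p :* x :+ (q :- p) :* x := q :* x) refl p q (seq x n))

  ⊙-factor : ∀ a x y m k → (a ⊙ x ⊞ m) ⊞ (a ⊙ y ⊞ k) ≼ a ⊙ (x ⊞ y) ⊞ (m ⊞ k)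
  ⊙-factor a x y m k = ≼-pointwise (λ n →
    solve 5 (λ a x y m k → (a :* x :+ m) :+ (a :* y :+ k) := a :* (x :+ y) :+ (m :+ k)) refl
      a (seq x n) (seq y n) (seq m n) (seq k n))

  ⊙-factor₂ : ∀ a b x y m k → ((a ℚ.+ b) ⊙ x ⊞ m) ⊞ (a ⊙ y ⊞ k) ≼ a ⊙ (x ⊞ y) ⊞ (b ⊙ x ⊞ (m ⊞ k))
  ⊙-factor₂ a b x y m k = ≼-pointwise (λ n →
    solve 6 (λ a b x y m k → ((a :+ b) :* x :+ m) :+ (a :* y :+ k) := a :* (x :+ y) :+ (b :* x :+ (m :+ k))) refl
      a b (seq x n) (seq y n) (seq m n) (seq k n))

  ⊙-assoc-factor : ∀ p a x m → (p ℚ.* a) ⊙ x ⊞ p ⊙ m ≼ p ⊙ (a ⊙ x ⊞ m)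
  ⊙-assoc-factor p a x m = ≼-pointwise (λ n →
    solve 4 (λ p a x m → p :* a :* x :+ p :* m := p :* (a :* x :+ m)) refl p a (seq x n) (seq m n))

  ⊞-negate : ∀ x y → (ℚ.- 1ℚ) ⊙ x ⊞ (x ⊞ y) ≼ y
  ⊞-negate x y = ≼-pointwise (λ n → cancel (seq x n) (seq y n))
    where
    cancel : ∀ p q → (ℚ.- 1ℚ) ℚ.* p ℚ.+ (p ℚ.+ q) ≡ q
    cancel = solve 2 (λ p q → con (ℚ.- 1ℚ) :* p :+ (p :+ q) := q) refl

  ⊞-negate⁻ : ∀ x y → y ≼ (ℚ.- 1ℚ) ⊙ x ⊞ (x ⊞ y)
  ⊞-negate⁻ x y = ≼-pointwise (λ n → cancel (seq x n) (seq y n))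
    where
    cancel : ∀ p q → q ≡ (ℚ.- 1ℚ) ℚ.* p ℚ.+ (p ℚ.+ q)
    cancel = solve 2 (λ p q → q := con (ℚ.- 1ℚ) :* p :+ (p :+ q)) refl

  ≼-limit : ∀ {x y} → (∀ ε → 0ℚ ℚ.< ε → x ≼ y ⊞ fromℚ ε) → x ≼ y
  ≼-limit {x} {y} h = ⌊ limit ⌋
    where
    limit : x ≤ y
    limit ε 0<ε = let N , k = ⌈ h (ε ℚ.* ½) (0<½ 0<ε) ⌉ (ε ℚ.* ½) (0<½ 0<ε)
      in N , λ n N≤n → ℚ.≤-trans (k n N≤n) (ℚ.≤-reflexive
           (trans (ℚ.+-assoc (seq y n) (ε ℚ.* ½) (ε ℚ.* ½)) (cong (seq y n ℚ.+_) (sym (½-split ε)))))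

⊞-cancelˡ : ∀ x {y z} → x ⊞ y ≼ x ⊞ z → y ≼ z
⊞-cancelˡ x {y} {z} h = ≼-trans (⊞-negate⁻ x y) (≼-trans (⊞-mono ≼-refl h) (⊞-negate x z))

0≼⊞ : ∀ {x y} → 0ℝ ≼ x → 0ℝ ≼ y → 0ℝ ≼ x ⊞ y
0≼⊞ 0≤x 0≤y = ≼-trans (⊞-identityˡ⁻ 0ℝ) (⊞-mono 0≤x 0≤y)

x≼x⊞y : ∀ {x y} → 0ℝ ≼ y → x ≼ x ⊞ y
x≼x⊞y {x} 0≤y = ≼-trans (⊞-identityʳ⁻ x) (⊞-mono ≼-refl 0≤y)

0≼⊙ : ∀ {p x} → 0ℚ ℚ.≤ p → 0ℝ ≼ x → 0ℝ ≼ p ⊙ x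
0≼⊙ {p} 0≤p 0≤x = ≼-trans (⊙-zeroʳ⁻ p) (⊙-mono 0≤p 0≤x)

⊙-monoˡ : ∀ {p q x} → p ℚ.≤ q → 0ℝ ≼ x → p ⊙ x ≼ q ⊙ x
⊙-monoˡ {p} {q} {x} p≤q 0≤x = ≼-trans (x≼x⊞y (0≼⊙ (≤⇒0≤diff p≤q) 0≤x)) (⊙-difference p q x)

-- Expectations

module Measure {Ω : Set} {ℓ} (P : ProbabilityMeasure Ω ℓ) where
  open ProbabilityMeasure P

  -- Only ¬¬-stable events are compared with unions, since ℙ-⋃ is about classical unions.
  record StableEvent : Set (lsuc 0ℓ ⊔ˡ ℓ) where
    field
      set     : Pred Ω 0ℓ
      isEvent : Event set
      stable  : ∀ {ω} → ¬ ¬ set ω → set ω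

  open StableEvent

  infix 4 _∈_ _∉_
  _∈_ _∉_ : Ω → StableEvent → Set
  ω ∈ E = set E ω
  ω ∉ E = ¬ ω ∈ E

  pr : StableEvent → ℝ
  pr E = ℙ (set E) (isEvent E)

  0≤pr : ∀ E → 0ℝ ≼ pr E
  0≤pr E = ⌊ ℙ-nonNeg (set E) (isEvent E) ⌋

  univ none : StableEvent
  univ = record { set = U ; isEvent = Event-U ; stable = λ _ → tt }
  none = record { set = ∁ U ; isEvent = Event-∁ Event-U ; stable = λ h x → h (λ k → k x) }

  compl : StableEvent → StableEvent
  compl E = record { set = ∁ (set E) ; isEvent = Event-∁ (isEvent E) ; stable = λ h x → h (λ k → k x) }

  infixr 7 _∩_
  _∩_ : StableEvent → StableEvent → StableEvent
  A ∩ B = record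
    { set     = λ ω → ω ∈ A × ω ∈ B
    ; isEvent = Event-≐ ((λ h → h 0 , h 1) , λ { (a , b) zero → a ; (a , b) (suc _) → b }) (Event-⋂ (λ n → isEvent (pick n)))
    ; stable  = λ h → stable A (λ k → h (k ∘ proj₁)) , stable B (λ k → h (k ∘ proj₂))
    }
    where
    pick : ℕ → StableEvent
    pick zero    = A
    pick (suc _) = B

  partialSum-nonNeg : ∀ (E : ℕ → StableEvent) n → 0ℝ ≼ partialSum (pr ∘ E) n
  partialSum-nonNeg E zero    = ≼-refl
  partialSum-nonNeg E (suc n) = ≼-trans (0≼⊞ (partialSum-nonNeg E n) (0≤pr (E n))) (⊞⇒+ _ (pr (E n)))

  -- An empty event is disjoint from itself, so countable additivity applies to the constant
  -- sequence: the multiples of `p` converge to `p`. Already `2p ≤ p + ε` forces `p ≤ ε`.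
  pr-empty : ∀ E → (∀ ω → ω ∉ E) → pr E ≼ 0ℝ
  pr-empty E empty = ≼-limit λ ε 0<ε → let N , close = sums ε 0<ε in
    ≼-trans (⊞-cancelˡ p (≼-trans (double N) (≼-trans ⌊ proj₁ (close (2 ℕ.+ N) (ℕ.m≤n+m N 2)) ⌋ (+⇒⊞ p (fromℚ ε)))))
      (⊞-identityˡ⁻ (fromℚ ε))
    where
    p = pr E
    sums : partialSum (λ _ → p) ⟶ p
    sums = ℙ-⋃ (λ _ → set E) (λ _ → isEvent E) (λ _ _ _ → λ { (a , _) → empty _ a }) (set E) (isEvent E)
      ((λ {ω} a → ⊥-elim (empty ω a)) , (λ {ω} h → ⊥-elim (h (λ _ → empty ω))))
    double : ∀ N → p ⊞ p ≼ partialSum (λ _ → p) (2 ℕ.+ N)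
    double N = begin
      p ⊞ p              ≲⟨ ⊞-mono (⊞-identityˡ⁻ p) ≼-refl ⟩
      0ℝ ⊞ p ⊞ p         ≲⟨ ⊞-mono (⊞-mono (partialSum-nonNeg (λ _ → E) N) ≼-refl) ≼-refl ⟩
      s ⊞ p ⊞ p          ≲⟨ ⊞-mono (⊞⇒+ s p) ≼-refl ⟩
      (s + p) ⊞ p        ≲⟨ ⊞⇒+ (s + p) p ⟩
      s + p + p          ∎
      where
      open ≼-Reasoning
      s = partialSum (λ _ → p) N

  -- `cover` is as weak as membership in `⋃ᶜ`, so that `ℙ-⋃` applies to the sequence `A`, `B`,
  -- `none`, `none`, and so on.
  record Partition (G A B : StableEvent) : Set where
    field
      disjoint : ∀ {ω} → ω ∈ A → ω ∉ B
      left     : ∀ {ω} → ω ∈ A → ω ∈ G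
      right    : ∀ {ω} → ω ∈ B → ω ∈ G
      cover    : ∀ {ω} → ω ∈ G → ω ∉ A → ¬ ω ∉ B

  module _ {G A B : StableEvent} (part : Partition G A B) where
    private
      open Partition part
      cells : ℕ → StableEvent
      cells zero          = A
      cells (suc zero)    = B
      cells (suc (suc _)) = none

      apart : ∀ m n → m ≢ n → set (cells m) ⊥ set (cells n)
      apart zero          zero          m≢n _       = m≢n refl
      apart (suc zero)    (suc zero)    m≢n _       = m≢n refl
      apart zero          (suc zero)    m≢n (a , b) = disjoint a b
      apart (suc zero)    zero          m≢n (b , a) = disjoint a b
      apart (suc (suc _)) _             m≢n (x , _) = x tt
      apart zero          (suc (suc _)) m≢n (_ , x) = x tt
      apart (suc zero)    (suc (suc _)) m≢n (_ , x) = x tt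

      sums : partialSum (pr ∘ cells) ⟶ pr G
      sums = ℙ-⋃ (set ∘ cells) (isEvent ∘ cells) apart (set G) (isEvent G)
        ( (λ g h → cover g (h 0) (h 1))
        , (λ h → stable G (λ ¬g → h (λ { zero a → ¬g (left a) ; (suc zero) b → ¬g (right b) ; (suc (suc _)) x → x tt }))) )

      lower : ∀ k → pr A ⊞ pr B ≼ partialSum (pr ∘ cells) (2 ℕ.+ k)
      lower zero    = ≼-trans (⊞-mono (≼-trans (⊞-identityˡ⁻ (pr A)) (⊞⇒+ 0ℝ (pr A))) ≼-refl) (⊞⇒+ (0ℝ + pr A) (pr B))
      lower (suc k) = ≼-trans (≼-trans (lower k) (x≼x⊞y (0≤pr none)))
        (⊞⇒+ (partialSum (pr ∘ cells) (2 ℕ.+ k)) (pr none))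

      upper : ∀ k → partialSum (pr ∘ cells) (2 ℕ.+ k) ≼ pr A ⊞ pr B
      upper zero    = ≼-trans (+⇒⊞ (0ℝ + pr A) (pr B)) (⊞-mono (≼-trans (+⇒⊞ 0ℝ (pr A)) (⊞-identityˡ (pr A))) ≼-refl)
      upper (suc k) = ≼-trans (+⇒⊞ (partialSum (pr ∘ cells) (2 ℕ.+ k)) (pr none))
        (≼-trans (⊞-mono (upper k) (pr-empty none (λ _ x → x tt))) (⊞-identityʳ (pr A ⊞ pr B)))

    pr-superadditive : pr A ⊞ pr B ≼ pr G
    pr-superadditive = ≼-limit λ ε 0<ε → let N , close = sums ε 0<ε in
      ≼-trans (lower N) (≼-trans ⌊ proj₁ (close (2 ℕ.+ N) (ℕ.m≤n+m N 2)) ⌋ (+⇒⊞ (pr G) (fromℚ ε)))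

    pr-subadditive : pr G ≼ pr A ⊞ pr B
    pr-subadditive = ≼-limit λ ε 0<ε → let N , close = sums ε 0<ε in
      ≼-trans (≼-trans ⌊ proj₂ (close (2 ℕ.+ N) (ℕ.m≤n+m N 2)) ⌋ (+⇒⊞ (partialSum (pr ∘ cells) (2 ℕ.+ N)) (fromℚ ε)))
        (⊞-mono (upper N) ≼-refl)

  split : ∀ E B G → Partition (E ∩ G) (E ∩ (B ∩ G)) (E ∩ (compl B ∩ G))
  split E B G = record
    { disjoint = λ (_ , b , _) (_ , ¬b , _) → ¬b b
    ; left     = λ (e , _ , g) → e , g
    ; right    = λ (e , _ , g) → e , g
    ; cover    = λ (e , g) ¬l ¬r → ¬r (e , (λ b → ¬l (e , b , g)) , g)
    }

  split₁ : ∀ B G → Partition G (B ∩ G) (compl B ∩ G)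
  split₁ B G = record
    { disjoint = λ (b , _) (¬b , _) → ¬b b
    ; left     = proj₂
    ; right    = proj₂
    ; cover    = λ g ¬l ¬r → ¬r ((λ b → ¬l (b , g)) , g)
    }

  pr-∩-univ : ∀ E → pr (E ∩ univ) ≼ pr E
  pr-∩-univ E = ≼-trans (x≼x⊞y (0≤pr none)) (pr-superadditive trivial)
    where
    trivial : Partition E (E ∩ univ) none
    trivial = record
      { disjoint = λ _ x → x tt ; left = proj₁ ; right = λ x → ⊥-elim (x tt) ; cover = λ e ¬l _ → ¬l (e , tt) }

  -- Weighted families of events

  Layers : Set (lsuc 0ℓ ⊔ˡ ℓ)
  Layers = List (ℚ × StableEvent)

  -- The total coefficient of the layers that contain `ω`. It is a relation because membership is
  -- undecidable; a value exists only up to double negation.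
  data Value (ω : Ω) : Layers → ℚ → Set (lsuc 0ℓ ⊔ˡ ℓ) where
    []   : Value ω [] 0ℚ
    hit  : ∀ {a B L v} → ω ∈ B → Value ω L v → Value ω ((a , B) ∷ L) (a ℚ.+ v)
    miss : ∀ {a B L v} → ω ∉ B → Value ω L v → Value ω ((a , B) ∷ L) v

  NonNegLayers : Layers → Set (lsuc 0ℓ ⊔ˡ ℓ)
  NonNegLayers = All (λ l → 0ℚ ℚ.≤ proj₁ l)

  mass : StableEvent → Layers → ℝ
  mass G []            = 0ℝ
  mass G ((a , B) ∷ L) = a ⊙ pr (B ∩ G) ⊞ mass G L

  mass-split : ∀ B G {L} → NonNegLayers L → mass (B ∩ G) L ⊞ mass (compl B ∩ G) L ≼ mass G L
  mass-split B G {[]}          []          = ⊞-identityˡ 0ℝ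
  mass-split B G {(a , E) ∷ L} (0≤a ∷ 0≤L) = ≼-trans
    (⊙-factor a (pr (E ∩ (B ∩ G))) (pr (E ∩ (compl B ∩ G))) (mass (B ∩ G) L) (mass (compl B ∩ G) L))
    (⊞-mono (⊙-mono 0≤a (pr-superadditive (split E B G))) (mass-split B G 0≤L))

  -- Replaces monotonicity of the integral for overlapping layers. Each layer cuts `G` into the part
  -- inside and the part outside it, and `K` accumulates the coefficients of the layers already
  -- known to contain `G`.
  mass-lower : ∀ {L} → NonNegLayers L → ∀ G {C K} → 0ℚ ℚ.≤ C → 0ℚ ℚ.≤ K →
    (∀ ω → ω ∈ G → ∀ v → Value ω L v → C ℚ.≤ K ℚ.+ v) →
    C ⊙ pr G ≼ K ⊙ pr G ⊞ mass G L
  mass-lower {[]} [] G {C} {K} 0≤C 0≤K h = ≼-trans (below (C ℚ.≤? K)) (⊞-identityʳ⁻ (K ⊙ pr G))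
    where
    open ≼-Reasoning
    below : Dec (C ℚ.≤ K) → C ⊙ pr G ≼ K ⊙ pr G
    below (yes C≤K) = ⊙-monoˡ C≤K (0≤pr G)
    -- No layer is left, so a point of `G` would give `C ≤ K`; hence `G` is empty and has
    -- probability 0.
    below (no  C≰K) = begin
      C ⊙ pr G   ≲⟨ ⊙-mono 0≤C (pr-empty G (λ ω g → C≰K (subst (C ℚ.≤_) (ℚ.+-identityʳ K) (h ω g 0ℚ [])))) ⟩
      C ⊙ 0ℝ     ≲⟨ ⊙-zeroʳ C ⟩
      0ℝ         ≲⟨ 0≼⊙ 0≤K (0≤pr G) ⟩
      K ⊙ pr G   ∎
  mass-lower {(a , B) ∷ L} (0≤a ∷ 0≤L) G {C} {K} 0≤C 0≤K h = begin
    C ⊙ pr G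
      ≲⟨ ⊙-mono 0≤C (pr-subadditive (split₁ B G)) ⟩
    C ⊙ (x ⊞ y)
      ≲⟨ ⊙-distrib C x y ⟩
    C ⊙ x ⊞ C ⊙ y
      ≲⟨ ⊞-mono
           (mass-lower 0≤L (B ∩ G) 0≤C (0≤+ 0≤K 0≤a) (λ ω (b , g) v V → ℚ.≤-trans (h ω g (a ℚ.+ v) (hit b V))
             (ℚ.≤-reflexive (sym (ℚ.+-assoc K a v)))))
           (mass-lower 0≤L (compl B ∩ G) 0≤C 0≤K (λ ω (¬b , g) v V → h ω g v (miss ¬b V))) ⟩
    (K ℚ.+ a) ⊙ x ⊞ m₁ ⊞ (K ⊙ y ⊞ m₂)
      ≲⟨ ⊙-factor₂ K a x y m₁ m₂ ⟩
    K ⊙ (x ⊞ y) ⊞ (a ⊙ x ⊞ (m₁ ⊞ m₂))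
      ≲⟨ ⊞-mono (⊙-mono 0≤K (pr-superadditive (split₁ B G))) (⊞-mono ≼-refl (mass-split B G 0≤L)) ⟩
    K ⊙ pr G ⊞ (a ⊙ x ⊞ mass G L) ∎
    where
    open ≼-Reasoning
    x = pr (B ∩ G)
    y = pr (compl B ∩ G)
    m₁ = mass (B ∩ G) L
    m₂ = mass (compl B ∩ G) L

  -- Rounding a random variable down to integers

  module _ (f : Ω → ℝ) (f-measurable : Measurable P f) where
    at-most : ℕ → StableEvent
    at-most k = record
      { set = λ ω → f ω ≤ fromℚ (ι k) ; isEvent = f-measurable (fromℚ (ι k))
      ; stable = λ {ω} → ≤-stable {f ω} {fromℚ (ι k)} }

    above : ℕ → StableEvent
    above k = compl (at-most k)

    -- f rounded down to an integer and truncated at k + n, on the event f > k.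
    floor : ℕ → ℕ → Layers
    floor k zero    = (ι k , above k) ∷ []
    floor k (suc n) = (ι k , above k ∩ at-most (suc k)) ∷ floor (suc k) n

    floor-nonNeg : ∀ k n → NonNegLayers (floor k n)
    floor-nonNeg k zero    = 0≤ι k ∷ []
    floor-nonNeg k (suc n) = 0≤ι k ∷ floor-nonNeg (suc k) n

    at-most-mono : ∀ {k} {ω} → ω ∈ at-most k → ω ∈ at-most (suc k)
    at-most-mono {k} {ω} h = ≤-trans {f ω} {fromℚ (ι k)} {fromℚ (ι (suc k))} h (fromℚ-mono (ι-mono-≤ (ℕ.n≤1+n k)))

    floor-above : ∀ k n → All (λ l → ∀ ω → ω ∈ proj₂ l → ω ∈ above k) (floor k n)
    floor-above k zero    = (λ _ a → a) ∷ []
    floor-above k (suc n) = (λ _ → proj₁) ∷ All.map (λ sub ω x∈ x∈k → sub ω x∈ (at-most-mono {k} {ω} x∈k)) (floor-above (suc k) n)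

    toStep : ℚ × StableEvent → Step P
    toStep (a , B) = record { set = set B ; isEvent = isEvent B ; value = fromℚ a }

    above⇒≤ : ∀ {k ω} → ω ∈ above k → fromℚ (ι k) ≤ f ω
    above⇒≤ {k} {ω} h = ≮⇒≥ {fromℚ (ι k)} {f ω} (λ lt → h (<⇒≤ {f ω} {fromℚ (ι k)} lt))

    floor-below : ∀ k n → All (λ S → ∀ ω → Step.set S ω → Step.value S ≤ f ω) (map toStep (floor k n))
    floor-below k zero    = (λ ω a → above⇒≤ {k} {ω} a) ∷ []
    floor-below k (suc n) = (λ ω (a , _) → above⇒≤ {k} {ω} a) ∷ floor-below (suc k) n

    floor-disjoint : ∀ k n → AllPairs (λ S T → Step.set S ⊥ Step.set T) (map toStep (floor k n))
    floor-disjoint k zero    = [] ∷ []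
    floor-disjoint k (suc n) =
      All.map⁺ (All.map (λ sub {ω} ((_ , le) , x) → sub ω x le) (floor-above (suc k) n)) ∷ floor-disjoint (suc k) n

    floor-simple : ∀ n → SimpleBelow P f
    floor-simple n = record
      { steps    = map toStep (floor 0 n)
      ; disjoint = floor-disjoint 0 n
      ; nonNeg   = All.map⁺ (All.map (λ {l} 0≤a → fromℚ-mono 0≤a) (floor-nonNeg 0 n))
      ; below    = floor-below 0 n
      }

    mass≼integral : ∀ {L} → NonNegLayers L → mass univ L ≼ integral P (map toStep L)
    mass≼integral {[]}          []          = ≼-refl
    mass≼integral {(a , B) ∷ L} (0≤a ∷ 0≤L) = ≼-trans
      (⊞-mono (≼-trans (⊙-mono 0≤a (pr-∩-univ B)) (⊙⇒* a (pr B))) (mass≼integral 0≤L))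
      (⊞⇒+ (fromℚ a * pr B) (integral P (map toStep L)))

    floor-expectation : ∀ {c} → IsExpectation P f c → ∀ n → mass univ (floor 0 n) ≼ c
    floor-expectation {c} (upper , _) n = ≼-trans (mass≼integral (floor-nonNeg 0 n))
      ⌊ upper (integral P (map toStep (floor 0 n))) (floor-simple n , ≈-refl {integral P (map toStep (floor 0 n))}) ⌋

    Value-nonNeg : ∀ {L} → NonNegLayers L → ∀ {ω v} → Value ω L v → 0ℚ ℚ.≤ v
    Value-nonNeg []          []         = ℚ.≤-refl
    Value-nonNeg (0≤a ∷ 0≤L) (hit _ V)  = 0≤+ 0≤a (Value-nonNeg 0≤L V)
    Value-nonNeg (_   ∷ 0≤L) (miss _ V) = Value-nonNeg 0≤L V

    -- Climbs the levels while `f > k` is known: a hit means `f ≤ k + 1` and counts `k`, so at most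
    -- 1 is lost, and a miss yields `f > k + 1`. At the top level the cap on `g` takes over.
    floor-value-above : ∀ k n {ω v g} → Value ω (floor k n) v → ω ∈ above k →
      fromℚ g ≤ f ω → g ℚ.≤ ι (n ℕ.+ k) → g ℚ.≤ 1ℚ ℚ.+ v
    floor-value-above k zero    {g = g} (hit _ [])     above-k g≤f g≤k =
      ℚ.≤-trans g≤k (ℚ.≤-trans (ι-mono-≤ (ℕ.n≤1+n k)) (ℚ.≤-reflexive (cong (1ℚ ℚ.+_) (sym (ℚ.+-identityʳ (ι k))))))
    floor-value-above k zero    (miss h _)     above-k g≤f g≤k = ⊥-elim (h above-k)
    floor-value-above k (suc n) {ω} {g = g} (hit {v = v} (_ , le) V) above-k g≤f g≤k = begin
      g                        ≤⟨ fromℚ-cancel (≤-trans {fromℚ g} {f ω} {fromℚ (ι (suc k))} g≤f le) ⟩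
      1ℚ ℚ.+ ι k               ≤⟨ ≤-by-diff v (Value-nonNeg (floor-nonNeg (suc k) n) V) (sym (ℚ.+-assoc 1ℚ (ι k) v)) ⟩
      1ℚ ℚ.+ (ι k ℚ.+ v)       ∎
      where open ℚ.≤-Reasoning
    floor-value-above k (suc n) {g = g} (miss h V) above-k g≤f g≤k =
      floor-value-above (suc k) n V (λ le → h (above-k , le)) g≤f (subst (λ m → g ℚ.≤ ι m) (sym (ℕ.+-suc n k)) g≤k)

    floor-value : ∀ n {ω v g} → Value ω (floor 0 n) v → fromℚ g ≤ f ω → g ℚ.≤ ι n → g ℚ.≤ 1ℚ ℚ.+ v
    floor-value n {ω} {v} {g} V g≤f g≤n = decidable-stable (g ℚ.≤? 1ℚ ℚ.+ v) λ h →
      h (floor-value-above 0 n V (f>0 h) g≤f (subst (λ m → g ℚ.≤ ι m) (sym (ℕ.+-identityʳ n)) g≤n))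
      where
      f>0 : ¬ g ℚ.≤ 1ℚ ℚ.+ v → ω ∈ above 0
      f>0 h f≤0 = h (ℚ.≤-trans (fromℚ-cancel (≤-trans {fromℚ g} {f ω} {0ℝ} g≤f f≤0))
        (0≤+ 0≤1 (Value-nonNeg (floor-nonNeg 0 n) V)))

  scaleLayers : ℚ → Layers → Layers
  scaleLayers p = map (λ (a , B) → p ℚ.* a , B)

  mass-scale : ∀ p L → mass univ (scaleLayers p L) ≼ p ⊙ mass univ L
  mass-scale p []            = ⊙-zeroʳ⁻ p
  mass-scale p ((a , B) ∷ L) = ≼-trans (⊞-mono ≼-refl (mass-scale p L))
    (⊙-assoc-factor p a (pr (B ∩ univ)) (mass univ L))

  mass-++ : ∀ L L′ → mass univ (L ++ L′) ≼ mass univ L ⊞ mass univ L′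
  mass-++ []            L′ = ⊞-identityˡ⁻ (mass univ L′)
  mass-++ ((a , B) ∷ L) L′ = ≼-trans (⊞-mono ≼-refl (mass-++ L L′))
    (⊞-assoc⁻ (a ⊙ pr (B ∩ univ)) (mass univ L) (mass univ L′))

  Value-++ : ∀ L {L′ ω v} → Value ω (L ++ L′) v →
    ∃[ v₁ ] ∃[ v₂ ] (Value ω L v₁ × Value ω L′ v₂ × v ≡ v₁ ℚ.+ v₂)
  Value-++ []            {v = v} V = 0ℚ , v , [] , V , sym (ℚ.+-identityˡ v)
  Value-++ ((a , B) ∷ L) (hit b V) = let v₁ , v₂ , V₁ , V₂ , eq = Value-++ L V in
    a ℚ.+ v₁ , v₂ , hit b V₁ , V₂ , trans (cong (a ℚ.+_) eq) (sym (ℚ.+-assoc a v₁ v₂))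
  Value-++ ((a , B) ∷ L) (miss b V) = let v₁ , v₂ , V₁ , V₂ , eq = Value-++ L V in
    v₁ , v₂ , miss b V₁ , V₂ , eq

  Value-scale : ∀ p L {ω v} → Value ω (scaleLayers p L) v → ∃[ v′ ] (Value ω L v′ × v ≡ p ℚ.* v′)
  Value-scale p []            []         = 0ℚ , [] , sym (ℚ.*-zeroʳ p)
  Value-scale p ((a , B) ∷ L) (hit b V)  = let v′ , V′ , eq = Value-scale p L V in
    a ℚ.+ v′ , hit b V′ , trans (cong (p ℚ.* a ℚ.+_) eq) (sym (ℚ.*-distribˡ-+ p a v′))
  Value-scale p ((a , B) ∷ L) (miss b V) = let v′ , V′ , eq = Value-scale p L V in v′ , miss b V′ , eq

  𝔼ᴿ : ∀ {W} → Weighted W → (W → ℝ) → ℝ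
  𝔼ᴿ []            c = 0ℝ
  𝔼ᴿ ((p , w) ∷ D) c = p ⊙ c w ⊞ 𝔼ᴿ D c

  module _ {W : Set} (f : W → Ω → ℝ) (f-measurable : ∀ w → Measurable P (f w)) (J : ℕ) where
    -- One family for all instances, with the weights multiplied in, so that `mass-lower` bounds the
    -- whole mean at once although no single cost has a useful pointwise bound.
    layers : Weighted W → Layers
    layers []            = []
    layers ((p , w) ∷ D) = scaleLayers p (floor (f w) (f-measurable w) 0 J) ++ layers D

    layers-nonNeg : ∀ {D} → NonNegWeights D → NonNegLayers (layers D)
    layers-nonNeg {[]}          []          = []
    layers-nonNeg {(p , w) ∷ D} (0≤p ∷ 0≤D) =
      All.++⁺ (All.map⁺ (All.map (0≤* 0≤p) (floor-nonNeg (f w) (f-measurable w) 0 J))) (layers-nonNeg 0≤D)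

    mass-layers : ∀ {c} → (∀ w → IsExpectation P (f w) (c w)) → ∀ {D} → NonNegWeights D → mass univ (layers D) ≼ 𝔼ᴿ D c
    mass-layers expect {[]}          []          = ≼-refl
    mass-layers expect {(p , w) ∷ D} (0≤p ∷ 0≤D) = ≼-trans (mass-++ (scaleLayers p L) (layers D))
      (⊞-mono (≼-trans (mass-scale p L) (⊙-mono 0≤p (floor-expectation (f w) (f-measurable w) (expect w) J)))
              (mass-layers expect 0≤D))
      where L = floor (f w) (f-measurable w) 0 J

    layers-value : ∀ {ω} {g : W → ℚ} → (∀ w → fromℚ (g w) ≤ f w ω) → (∀ w → g w ℚ.≤ ι J) →
      ∀ {D} → NonNegWeights D → ∀ {v} → Value ω (layers D) v → 𝔼 D g ℚ.≤ 𝔼 D (λ _ → 1ℚ) ℚ.+ v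
    layers-value g≤f g≤J {[]} [] [] = ℚ.≤-refl
    layers-value {ω} {g} g≤f g≤J {(p , w) ∷ D} (0≤p ∷ 0≤D) V =
      let L = floor (f w) (f-measurable w) 0 J
          v₁ , v₂ , V₁ , V₂ , eq = Value-++ (scaleLayers p L) V
          v′ , V′ , eq′          = Value-scale p L V₁
      in ℚ.≤-trans
        (ℚ.+-mono-≤ (*-monoʳ p 0≤p (floor-value (f w) (f-measurable w) J V′ (g≤f w) (g≤J w))) (layers-value g≤f g≤J 0≤D V₂))
        (ℚ.≤-reflexive (trans
          (solve 4 (λ p v′ s v₂ → p :* (con 1ℚ :+ v′) :+ (s :+ v₂) := (p :* con 1ℚ :+ s) :+ (p :* v′ :+ v₂)) refl
            p v′ (𝔼 D (λ _ → 1ℚ)) v₂)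
          (cong (p ℚ.* 1ℚ ℚ.+ 𝔼 D (λ _ → 1ℚ) ℚ.+_) (sym (trans eq (cong (ℚ._+ v₂) eq′))))))

    -- The averaging principle: a bound on the mean over `D` for every single `ω` passes to the mean
    -- of the expectations, up to the 1 lost in rounding. The witness `g` may depend on `ω` and
    -- exist only classically, since the inequality drawn from it is between rationals and thus
    -- decidable; its bound by `J` must be uniform.
    expectation-lower : ∀ {c} → (∀ w → IsExpectation P (f w) (c w)) →
      ∀ {D} → NonNegWeights D → 𝔼 D (λ _ → 1ℚ) ≡ 1ℚ → ∀ {C} → 0ℚ ℚ.≤ C →
      (∀ ω → ¬ ¬ (∃[ g ] ((∀ w → fromℚ (g w) ≤ f w ω) × (∀ w → g w ℚ.≤ ι J) × C ℚ.≤ 𝔼 D g))) →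
      fromℚ C ≼ 1ℝ ⊞ 𝔼ᴿ D c
    expectation-lower {c} expect {D} 0≤D total {C} 0≤C pointwise = begin
      fromℚ C
        ≲⟨ ⊙-1⁻ C ⟩
      C ⊙ 1ℝ
        ≲⟨ ⊙-mono 0≤C ⌊ proj₂ (ℙ-U Event-U) ⌋ ⟩
      C ⊙ pr univ
        ≲⟨ mass-lower (layers-nonNeg 0≤D) univ 0≤C 0≤1 value ⟩
      1ℚ ⊙ pr univ ⊞ mass univ (layers D)
        ≲⟨ ⊞-mono (⊙-mono 0≤1 ⌊ proj₁ (ℙ-U Event-U) ⌋) (mass-layers expect 0≤D) ⟩
      1ℚ ⊙ 1ℝ ⊞ 𝔼ᴿ D c
        ≲⟨ ⊞-mono (⊙-1 1ℚ) ≼-refl ⟩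
      1ℝ ⊞ 𝔼ᴿ D c ∎
      where
      open ≼-Reasoning
      value : ∀ ω → ω ∈ univ → ∀ v → Value ω (layers D) v → C ℚ.≤ 1ℚ ℚ.+ v
      value ω _ v V = decidable-stable (C ℚ.≤? 1ℚ ℚ.+ v) λ h → pointwise ω (λ (g , g≤f , g≤J , C≤) → h (ℚ.≤-trans C≤
        (subst (λ x → 𝔼 D g ℚ.≤ x ℚ.+ v) total (layers-value g≤f g≤J 0≤D V))))

-- Instances and algorithms

ιᴿ : ℕ → ℝ
ιᴿ k = fromℚ (ι k)

-- Open below and closed above, so that consecutive windows are disjoint and a deadline belongs to
-- the window it ends.
Window : ℕ → ℕ → ℚ → Service → Set
Window lo hi x s = ιᴿ lo < time s × time s ≤ ιᴿ hi × fromℚ x ≤ place s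

-- Certifies that X contains services at distinct times after lo whose places sum to at least g.
data Charge (X : List Service) : ℕ → ℚ → Set where
  done : ∀ {lo} → Charge X lo 0ℚ
  idle : ∀ {lo hi g} → lo ℕ.≤ hi → Charge X hi g → Charge X lo g
  pay  : ∀ {lo hi x g} → lo ℕ.≤ hi → Any (Window lo hi x) X → Charge X hi g → Charge X lo (x ℚ.+ g)

ιᴿ-mono : ∀ {m n} → m ℕ.≤ n → ιᴿ m ≤ ιᴿ n
ιᴿ-mono m≤n = fromℚ-mono (ι-mono-≤ m≤n)

Charge-tail : ∀ {s X lo g} → time s ≤ ιᴿ lo → Charge (s ∷ X) lo g → Charge X lo g
Charge-tail early done = done
Charge-tail {s} {lo = lo} early (idle {hi = hi} p C) =
  idle p (Charge-tail (≤-trans {time s} {ιᴿ lo} {ιᴿ hi} early (ιᴿ-mono p)) C)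
Charge-tail {s} {lo = lo} early (pay p (here (late , _)) C) = ⊥-elim (<⇒≱ {time s} {ιᴿ lo} late early)
Charge-tail {s} {lo = lo} early (pay {hi = hi} p (there w) C) =
  pay p w (Charge-tail (≤-trans {time s} {ιᴿ lo} {ιᴿ hi} early (ιᴿ-mono p)) C)

ChargeHead : Service → List Service → ℕ → ℚ → Set
ChargeHead s X lo g = Charge X lo g ⊎ ∃[ x ] ∃[ h ] (fromℚ x ≤ place s × g ≡ x ℚ.+ h × Charge X lo h)

ChargeHead-idle : ∀ {s X lo hi g} → lo ℕ.≤ hi → ChargeHead s X hi g → ChargeHead s X lo g
ChargeHead-idle p (inj₁ C)                     = inj₁ (idle p C)
ChargeHead-idle p (inj₂ (x , h , le , eq , C)) = inj₂ (x , h , le , eq , idle p C)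

ChargeHead-pay : ∀ s {X lo hi x g} → lo ℕ.≤ hi → Any (Window lo hi x) X → ChargeHead s X hi g → ChargeHead s X lo (x ℚ.+ g)
ChargeHead-pay s                   p w (inj₁ C)                     = inj₁ (pay p w C)
ChargeHead-pay s {X} {lo} {hi} {x} {g} p w (inj₂ (y , h , le , eq , C)) =
  inj₂ (y , x ℚ.+ h , le , trans (cong (x ℚ.+_) eq) (swap x y h) , pay p w C)
  where
  swap : ∀ x y h → x ℚ.+ (y ℚ.+ h) ≡ y ℚ.+ (x ℚ.+ h)
  swap = solve 3 (λ x y h → x :+ (y :+ h) := y :+ (x :+ h)) refl

-- The head of the list can be used for at most one payment, since its time then lies before all
-- later windows. Peeling off services instead of windows lets `Charge-cost` follow a list that is
-- not sorted by time.
Charge-head : ∀ {s X lo g} → Charge (s ∷ X) lo g → ChargeHead s X lo g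
Charge-head done             = inj₁ done
Charge-head {s} {X} {g = g} (idle {hi = hi} p C) = ChargeHead-idle {s} {X} {hi = hi} {g} p (Charge-head C)
Charge-head (pay {x = x} {g} p (here (_ , early , le)) C) = inj₂ (x , g , le , refl , idle p (Charge-tail early C))
Charge-head {s} {X} (pay {lo} {hi} {x} {g} p (there w) C) = ChargeHead-pay s {X} {lo} {hi} {x} {g} p w (Charge-head C)

Charge-cost : ∀ X {lo g} → Charge X lo g → fromℚ g ≼ sum (map place X)
Charge-cost []      done       = ≼-refl
Charge-cost []      (idle _ C) = Charge-cost [] C
Charge-cost (s ∷ X) C          =
  [ (λ C′ → ≼-trans (Charge-cost X C′)
      (≼-trans (≼-trans (⊞-identityˡ⁻ rest) (⊞-mono ⌊ 0≤place s ⌋ ≼-refl)) (⊞⇒+ (place s) rest)))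
  , (λ { (x , h , le , refl , C′) →
      ≼-trans (⊞-fromℚ⁻ x h) (≼-trans (⊞-mono ⌊ le ⌋ (Charge-cost X C′)) (⊞⇒+ (place s) rest)) })
  ]′ (Charge-head C)
  where rest = sum (map place X)

≈ˢ-refl : ∀ {s} → s ≈ˢ s
≈ˢ-refl {s} = ≈-refl {time s} , ≈-refl {place s}

Window-resp : ∀ {lo hi x s s′} → s ≈ˢ s′ → Window lo hi x s → Window lo hi x s′
Window-resp {lo} {hi} {x} {s} {s′} ((t≤t′ , t′≤t) , (p≤p′ , _)) (late , early , le) =
  <-≤-trans {ιᴿ lo} {time s} {time s′} late t≤t′ ,
  ≤-trans {time s′} {time s} {ιᴿ hi} t′≤t early ,
  ≤-trans {fromℚ x} {place s} {place s′} le p≤p′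

≈ʳ-refl : ∀ {r} → r ≈ʳ r
≈ʳ-refl {r} = ≈-refl {release r} , ≈-refl {location r} , ≈-refl {deadline r}

SameUpTo-later : ∀ {t I J} → All (λ r → t < release r) I → All (λ r → t < release r) J → SameUpTo t I J
SameUpTo-later []         []         = []
SameUpTo-later []         (t<r ∷ J>) = skipʳ t<r (SameUpTo-later [] J>)
SameUpTo-later (t<r ∷ I>) J>         = skipˡ t<r (SameUpTo-later I> J>)

SameUpTo-++ : ∀ {t} H {I J} → SameUpTo t I J → SameUpTo t (H ++ I) (H ++ J)
SameUpTo-++ []      same = same
SameUpTo-++ (r ∷ H) same = both (≈ʳ-refl {r}) (SameUpTo-++ H same)

Window-online : ∀ (A : DeterministicAlgorithm) {I J lo hi x} → SameUpTo (ιᴿ hi) I J →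
  ∀ {s} → s ∈ₗ services (run A I) → Window lo hi x s → Any (Window lo hi x) (services (run A J))
Window-online A {I} {J} {lo} {hi} {x} same {s} s∈I (late , early , le) =
  Any.map (λ {s′} eq → Window-resp {lo} {hi} {x} {s} {s′} eq (late , early , le))
    (online A (ιᴿ hi) I J same s early (Any.map (λ { refl → ≈ˢ-refl {s} }) s∈I))

Any-Window-online : ∀ (A : DeterministicAlgorithm) {I J lo hi x} → SameUpTo (ιᴿ hi) I J →
  Any (Window lo hi x) (services (run A I)) → Any (Window lo hi x) (services (run A J))
Any-Window-online A {lo = lo} {hi} {x} same any =
  let s , s∈ , w = find any in Window-online A {lo = lo} {hi} {x} same s∈ w

¬¬-∀Fin : ∀ {a n} {P : Fin n → Set a} → (∀ i → ¬ ¬ P i) → ¬ ¬ (∀ i → P i)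
¬¬-∀Fin {n = zero}  h k = k λ ()
¬¬-∀Fin {n = suc n} h k = h zero λ p → ¬¬-∀Fin (h ∘ suc) λ ps → k (Fin.∀-cons p ps)

-- Excluded middle is used once for each candidate, which double negation permits. The default 0
-- will be the bid that stands for no service.
¬¬-maximum : ∀ (Q : ℕ → Set) n → ¬ ¬ (∃[ b ] (b ℕ.≤ n × (b ≡ 0 ⊎ Q b) × (∀ j → j ℕ.≤ n → Q j → j ℕ.≤ b)))
¬¬-maximum Q zero    k = k (0 , ℕ.z≤n , inj₁ refl , λ j j≤0 _ → j≤0)
¬¬-maximum Q (suc n) k = ¬¬-excluded-middle λ
  { (yes q) → k (suc n , ℕ.≤-refl , inj₂ q , λ j j≤ _ → j≤)
  ; (no ¬q) → ¬¬-maximum Q n λ (b , b≤n , qb , max) → k (b , ℕ.m≤n⇒m≤1+n b≤n , qb , λ j j≤ qj →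
      [ (λ { (ℕ.s≤s j≤n) → max j j≤n qj }) , (λ { refl → ⊥-elim (¬q qj) }) ]′ (ℕ.m≤n⇒m<n∨m≡n j≤)) }

-- The random instances and their optimal solutions

module Adversary {n} (R : Ratio n) (M ℓ : ℕ) where
  open Ratio R
  open Bidding R M

  -- A block of r phases based at β occupies the time interval (β, len r + β]; it fits strictly between
  -- two consecutive deadlines of the phase before it.
  len : ℕ → ℕ
  len zero    = 1
  len (suc r) = suc (suc ℓ) ℕ.* suc (len r)

  tick : ℕ → ℕ → ℕ → ℕ
  tick r β k = k ℕ.* suc (len r) ℕ.+ β

  tick-mono : ∀ r β {j k} → j ℕ.≤ k → tick r β j ℕ.≤ tick r β k
  tick-mono r β j≤k = ℕ.+-monoˡ-≤ β (ℕ.*-monoˡ-≤ (suc (len r)) j≤k)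

  β<tick-suc : ∀ r β k → suc β ℕ.≤ tick r β (suc k)
  β<tick-suc r β k = ℕ.s≤s
    (ℕ.≤-trans (ℕ.m≤n+m β (k ℕ.* suc (len r))) (ℕ.+-monoˡ-≤ β (ℕ.m≤n+m (k ℕ.* suc (len r)) (len r))))

  request : (k τ d : ℕ) → τ ℕ.≤ d → Request
  request k τ d τ≤d = record
    { release = ιᴿ τ ; location = fromℚ (q ^ k) ; deadline = ιᴿ d
    ; 0≤release = fromℚ-mono (0≤ι τ)
    ; 0<location = fromℚ-mono-< (ℚ.<-≤-trans (ℚ.positive⁻¹ 1ℚ) (1≤q^ k))
    ; release≤deadline = ιᴿ-mono τ≤d
    }

  phaseRequest : ∀ r β → Fin (suc ℓ) → Request
  phaseRequest r β k = request (toℕ k) (suc β) (tick r β (suc (toℕ k))) (β<tick-suc r β (toℕ k))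

  phase : ℕ → ℕ → Instance
  phase r β = tabulate (phaseRequest r β)

  -- The closing request at `q^ℓ` makes the final service unavoidable, so the optimal cost is
  -- exactly `optCost` for every word.
  instanceOf : ∀ r → ℕ → Word ℓ r → Instance
  instanceOf zero    β []      = request ℓ (suc β) (suc β) ℕ.≤-refl ∷ []
  instanceOf (suc r) β (T ∷ w) = phase r β ++ instanceOf r (tick r β (suc (toℕ T))) w

  released-later : ∀ r β w {γ} → γ ℕ.≤ β → All (λ req → ιᴿ γ < release req) (instanceOf r β w)
  released-later zero    β []      γ≤β = fromℚ-mono-< (ι-mono-< (ℕ.s≤s γ≤β)) ∷ []
  released-later (suc r) β (T ∷ w) {γ} γ≤β = All.++⁺
    (All.tabulate⁺ {P = λ req → ιᴿ γ < release req} {f = phaseRequest r β} (λ k → fromℚ-mono-< (ι-mono-< (ℕ.s≤s γ≤β))))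
    (released-later r (tick r β (suc (toℕ T))) w (ℕ.≤-trans γ≤β (ℕ.<⇒≤ (β<tick-suc r β (toℕ T)))))

  SameUpTo-instances : ∀ H r {β β′ γ} w w′ → γ ℕ.≤ β → γ ℕ.≤ β′ →
    SameUpTo (ιᴿ γ) (H ++ instanceOf r β w) (H ++ instanceOf r β′ w′)
  SameUpTo-instances H r w w′ γ≤β γ≤β′ =
    SameUpTo-++ H (SameUpTo-later (released-later r _ w γ≤β) (released-later r _ w′ γ≤β′))

  service : ℕ → ℕ → Service
  service t k = record { time = ιᴿ t ; place = fromℚ (q ^ k) ; 0≤place = fromℚ-mono (^-nonNeg k 0≤q) }

  optServices : ∀ r → ℕ → Word ℓ r → List Service
  optServices zero    β []      = service (suc β) ℓ ∷ []
  optServices (suc r) β (T ∷ w) = service (suc β) (toℕ T) ∷ optServices r (tick r β (suc (toℕ T))) w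

  served-later : ∀ r β w {γ} → γ ℕ.≤ β → All (λ s → ιᴿ γ < time s) (optServices r β w)
  served-later zero    β []      γ≤β = fromℚ-mono-< (ι-mono-< (ℕ.s≤s γ≤β)) ∷ []
  served-later (suc r) β (T ∷ w) γ≤β = fromℚ-mono-< (ι-mono-< (ℕ.s≤s γ≤β)) ∷
    served-later r (tick r β (suc (toℕ T))) w (ℕ.≤-trans γ≤β (ℕ.<⇒≤ (β<tick-suc r β (toℕ T))))

  optDistinct : ∀ r β w → AllPairs (λ s s′ → ¬ s ≈ˢ s′) (optServices r β w)
  optDistinct zero    β []      = [] ∷ []
  optDistinct (suc r) β (T ∷ w) =
    All.map (λ {s} later ((_ , t′≤t) , _) → <⇒≱ {time s} {ιᴿ (suc β)} later t′≤t)
      (served-later r (tick r β (suc (toℕ T))) w (β<tick-suc r β (toℕ T)))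
    ∷ optDistinct r (tick r β (suc (toℕ T))) w

  opt : ∀ r β → Word ℓ r → Solution
  opt r β w = record { services = optServices r β w ; distinct = optDistinct r β w }

  cost-opt : ∀ r β w k → seq (cost (opt r β w)) k ≡ optCost w
  cost-opt zero    β []      k = ℚ.+-identityʳ (q ^ ℓ)
  cost-opt (suc r) β (T ∷ w) k = cong (q ^ toℕ T ℚ.+_) (cost-opt r (tick r β (suc (toℕ T))) w k)

  ^-mono : ∀ {j k} → j ℕ.≤ k → q ^ j ℚ.≤ q ^ k
  ^-mono j≤k = price-mono (ℕ.s≤s j≤k)

  -- The final service falls inside every nested block, hence before all outer deadlines that are
  -- still open; so it can serve the remainder of every phase.
  last-service : ∀ r β w → Any (Window β (len r ℕ.+ β) (q ^ ℓ)) (optServices r β w)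
  last-service zero    β []      = 
    here (fromℚ-mono-< (ι-mono-< (ℕ.n<1+n β)) , ≤-refl {ιᴿ (suc β)} , ≤-refl {fromℚ (q ^ ℓ)})
  last-service (suc r) β (T ∷ w) = there
    (Any.map {P = Window β′ (len r ℕ.+ β′) (q ^ ℓ)} (λ {s} → widen {s}) (last-service r β′ w))
    where
    β′ = tick r β (suc (toℕ T))
    fits : len r ℕ.+ β′ ℕ.≤ len (suc r) ℕ.+ β
    fits = subst (len r ℕ.+ β′ ℕ.≤_) (sym (ℕ.+-assoc (suc (len r)) (suc ℓ ℕ.* suc (len r)) β))
      (ℕ.+-mono-≤ (ℕ.n≤1+n (len r)) (tick-mono r β (Fin.toℕ<n T)))
    widen : ∀ {s} → Window β′ (len r ℕ.+ β′) (q ^ ℓ) s → Window β (len (suc r) ℕ.+ β) (q ^ ℓ) s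
    widen {s} (late , early , le) =
      ≤-<-trans {ιᴿ β} {ιᴿ β′} {time s} (ιᴿ-mono (ℕ.<⇒≤ (β<tick-suc r β (toℕ T)))) late ,
      ≤-trans {time s} {ιᴿ (len r ℕ.+ β′)} {ιᴿ (len (suc r) ℕ.+ β)} early (ιᴿ-mono fits) , le

  optFeasible : ∀ r β w → Feasible (instanceOf r β w) (opt r β w)
  optFeasible zero    β []      = here (≤-refl {ιᴿ (suc β)} , ≤-refl {ιᴿ (suc β)} , ≤-refl {fromℚ (q ^ ℓ)}) ∷ []
  optFeasible (suc r) β (T ∷ w) = All.++⁺
    (All.tabulate⁺ {P = λ req → Any (_Serves req) (optServices (suc r) β (T ∷ w))} {f = phaseRequest r β}
      (λ k → serve k (ℕ.≤-<-connex (toℕ k) (toℕ T))))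
    (All.map there (optFeasible r β′ w))
    where
    β′ = tick r β (suc (toℕ T))
    serve : ∀ k → toℕ k ℕ.≤ toℕ T ⊎ toℕ T ℕ.< toℕ k → Any (_Serves phaseRequest r β k) (optServices (suc r) β (T ∷ w))
    serve k (inj₁ k≤T) = here (≤-refl {ιᴿ (suc β)} , ιᴿ-mono (β<tick-suc r β (toℕ k)) , fromℚ-mono (^-mono k≤T))
    serve k (inj₂ T<k) = there
      (Any.map {P = Window β′ (len r ℕ.+ β′) (q ^ ℓ)} (λ {s} → late-service {s}) (last-service r β′ w))
      where
      -- `β′` is the deadline of `q^T`; the next deadline comes `suc (len r)` later, after the
      -- nested block of length `len r` has ended.
      deadline-later : len r ℕ.+ β′ ℕ.≤ tick r β (suc (toℕ k))
      deadline-later = ℕ.≤-trans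
        (ℕ.≤-trans (ℕ.+-monoˡ-≤ β′ (ℕ.n≤1+n (len r)))
          (ℕ.≤-reflexive (sym (ℕ.+-assoc (suc (len r)) (suc (toℕ T) ℕ.* suc (len r)) β))))
        (tick-mono r β {suc (suc (toℕ T))} (ℕ.s≤s T<k))
      late-service : ∀ {s} → Window β′ (len r ℕ.+ β′) (q ^ ℓ) s → s Serves phaseRequest r β k
      late-service {s} (late , early , le) =
        ≤-trans {ιᴿ (suc β)} {ιᴿ β′} {time s} (ιᴿ-mono (β<tick-suc r β (toℕ T))) (<⇒≤ {ιᴿ β′} {time s} late) ,
        ≤-trans {time s} {ιᴿ (len r ℕ.+ β′)} {ιᴿ (tick r β (suc (toℕ k)))} early (ιᴿ-mono deadline-later) ,
        ≤-trans {fromℚ (q ^ toℕ k)} {fromℚ (q ^ ℓ)} {place s} (fromℚ-mono (^-mono (Fin.toℕ≤pred[n] k))) le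

  served-window : ∀ {k β d p s} → s Serves request k (suc β) d p → Window β d (q ^ k) s
  served-window {k} {β} {s = s} (late , early , le) =
    <-≤-trans {ιᴿ β} {ιᴿ (suc β)} {time s} (fromℚ-mono-< (ι-mono-< (ℕ.n<1+n β))) late , early , le

  -- In each phase the request at `q^T` must be served by its deadline, which is also where the next
  -- block is based. So these windows are disjoint, and every feasible solution pays in each of
  -- them: this is the optimality of `opt`.
  feasible-charge : ∀ r β w X → Feasible (instanceOf r β w) X → Charge (services X) β (optCost w)
  feasible-charge zero    β []      X (f ∷ []) = subst (Charge (services X) β) (ℚ.+-identityʳ (q ^ ℓ))
    (pay (ℕ.n≤1+n β) (Any.map (λ {s} → served-window {ℓ} {β} {suc β} {ℕ.≤-refl} {s}) f) done)
  feasible-charge (suc r) β (T ∷ w) X f = pay (ℕ.<⇒≤ (β<tick-suc r β (toℕ T)))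
    (Any.map {P = _Serves phaseRequest r β T}
      (λ {s} → served-window {toℕ T} {β} {tick r β (suc (toℕ T))} {β<tick-suc r β (toℕ T)} {s})
      (All.tabulate⁻ {P = λ req → Any (_Serves req) (services X)} {f = phaseRequest r β} (All.++⁻ˡ (phase r β) f) T))
    (feasible-charge r (tick r β (suc (toℕ T))) w X (All.++⁻ʳ (phase r β) f))

  opt-isOPT : ∀ r β w → IsOPT (instanceOf r β w) (opt r β w)
  opt-isOPT r β w = optFeasible r β w , λ Y f → ⌈ ≼-trans
    (≼-pointwise {cost (opt r β w)} {fromℚ (optCost w)} (cost-opt r β w))
    (Charge-cost (services Y) (feasible-charge r β w Y f)) ⌉

  -- The cost of a single deterministic algorithm

  Charge-window : ∀ {X lo hi k g} → lo ℕ.≤ hi → k ≡ 0 ⊎ Any (Window lo hi (price k)) X →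
    Charge X hi g → Charge X lo (price k ℚ.+ g)
  Charge-window {X} {lo} {g = g} p (inj₁ refl) C = subst (Charge X lo) (sym (ℚ.+-identityˡ g)) (idle p C)
  Charge-window                  p (inj₂ w)    C = pay p w C

  Charge-windows : ∀ {X m} (b : Fin (suc m) → ℕ) (t : ℕ → ℕ) → (∀ i → t i ℕ.≤ t (suc i)) → ∀ T {g} →
    (∀ i → toℕ i ℕ.≤ toℕ T → b i ≡ 0 ⊎ Any (Window (t (toℕ i)) (t (suc (toℕ i))) (price (b i))) X) →
    Charge X (t (suc (toℕ T))) g → Charge X (t 0) (spent b T ℚ.+ g)
  Charge-windows {X} b t mono zero    windows C = Charge-window (mono 0) (windows zero ℕ.z≤n) C
  Charge-windows {X} {suc m} b t mono (suc T) {g} windows C =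
    subst (Charge X (t 0)) (sym (ℚ.+-assoc (price (b zero)) (spent (b ∘ suc) T) g))
      (Charge-window (mono 0) (windows zero ℕ.z≤n)
        (Charge-windows (b ∘ suc) (t ∘ suc) (mono ∘ suc) T (λ i i≤T → windows (suc i) (ℕ.s≤s i≤T)) C))

  phaseCost : ℚ
  phaseCost = ι (suc ℓ) ℚ.* price (suc ℓ)

  -- An arbitrary history `H` lets the induction pass to later phases, and charging only after `β`
  -- lets the charges of successive phases be added. The upper bound on `g` does not mention `A`.
  AlgorithmBound : DeterministicAlgorithm → ℕ → Set
  AlgorithmBound A r = ∀ H β → ¬ ¬ (∃[ g ]
    ( (∀ w → Charge (services (run A (H ++ instanceOf r β w))) β (g w))
    × (∀ w → g w ℚ.≤ ι r ℚ.* phaseCost)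
    × ι r ℚ.* (v ℚ.* ι (suc ℓ)) ℚ.≤ 𝔼 (words ℓ r) g ))

  module _ (A : DeterministicAlgorithm) {r : ℕ} (ih : AlgorithmBound A r) (H : Instance) (β : ℕ) where
    private
      τ : ℕ → ℕ
      τ = tick r β

      continue : Fin (suc ℓ) → Word ℓ r → Instance
      continue T w = (H ++ phase r β) ++ instanceOf r (τ (suc (toℕ T))) w

      run-on : Fin (suc ℓ) → Word ℓ r → List Service
      run-on T w = services (run A (continue T w))

      -- Up to the k-th deadline the revealed requests are the same for all T ≥ k, so what the
      -- algorithm does in the k-th window can be read off a run with T = k.
      reference : Fin (suc ℓ) → List Service
      -- The word after the current phase is arbitrary: its requests come after the window.
      reference k = run-on k (replicate r zero)

      Reaches : Fin (suc ℓ) → ℕ → Set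
      Reaches k j = Any (Window (τ (toℕ k)) (τ (suc (toℕ k))) (price j)) (reference k)

      same : ∀ k {T T′ w w′} → k ℕ.≤ toℕ T → k ℕ.≤ toℕ T′ →
        SameUpTo (ιᴿ (τ (suc k))) (continue T w) (continue T′ w′)
      same k {w = w} {w′} k≤T k≤T′ = SameUpTo-instances (H ++ phase r β) r w w′
        (tick-mono r β (ℕ.s≤s k≤T)) (tick-mono r β (ℕ.s≤s k≤T′))

      -- Bids stop at `suc ℓ`, whose price is `q^ℓ`: a service farther out counts only as `q^ℓ`,
      -- which keeps the charge bounded.
      IsBid : Fin (suc ℓ) → ℕ → Set
      IsBid k b = b ℕ.≤ suc ℓ × (b ≡ 0 ⊎ Reaches k b) × (∀ j → j ℕ.≤ suc ℓ → Reaches k j → j ℕ.≤ b)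

      module _ (b : Fin (suc ℓ) → ℕ) (bid : ∀ k → IsBid k (b k)) where
        -- In the run with `T = i`, some service at `q^i` or farther meets the `i`-th deadline. It
        -- lies in the `k`-th window for some `k ≤ i`, so it also occurs in `reference k`, and
        -- maximality makes the bid there at least `i + 1`, the bid with price `q^i`.
        covers : Covers 0 0 b
        covers i _ b≤i = unserved (find served)
          where
          served : Any (_Serves phaseRequest r β i) (reference i)
          served = All.tabulate⁻ {P = λ req → Any (_Serves req) (reference i)} {f = phaseRequest r β}
            (All.++⁻ʳ H (All.++⁻ˡ (H ++ phase r β) (feasible A (continue i (replicate r zero))))) i

          unserved : ¬ (∃[ s ] (s ∈ₗ reference i × s Serves phaseRequest r β i))
          unserved (s , s∈ , serves) = no-window (suc (toℕ i)) ℕ.≤-refl (proj₁ (proj₂ window))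
            where
            window : Window β (τ (suc (toℕ i))) (q ^ toℕ i) s
            window = served-window {toℕ i} {β} {τ (suc (toℕ i))} {β<tick-suc r β (toℕ i)} {s} serves

            -- Descends from the deadline to `β`, ruling out one window after another as the place
            -- of `s`.
            no-window : ∀ k → k ℕ.≤ suc (toℕ i) → ¬ time s ≤ ιᴿ (τ k)
            no-window zero    _           early = <⇒≱ {time s} {ιᴿ β} (proj₁ window) early
            no-window (suc k) (ℕ.s≤s k≤i) early = ≰⇒¬¬> {time s} {ιᴿ (τ k)} (no-window k (ℕ.m≤n⇒m≤1+n k≤i)) contra
              where
              k<ℓ : k ℕ.< suc ℓ
              k<ℓ = ℕ.≤-<-trans k≤i (Fin.toℕ<n i)
              j : Fin (suc ℓ)
              j = Fin.fromℕ< k<ℓ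
              j≡k : toℕ j ≡ k
              j≡k = Fin.toℕ-fromℕ< k<ℓ
              contra : ¬ ιᴿ (τ k) < time s
              contra late = ℕ.<⇒≱ (ℕ.≤-refl {suc (toℕ i)}) (ℕ.≤-trans
                (proj₂ (proj₂ (bid j)) (suc (toℕ i)) (Fin.toℕ<n i) reaches)
                (b≤i j (ℕ.≤-trans (ℕ.≤-reflexive j≡k) k≤i)))
                where
                reaches : Reaches j (suc (toℕ i))
                reaches = subst (λ m → Any (Window (τ m) (τ (suc m)) (q ^ toℕ i)) (reference j)) (sym j≡k)
                  (Window-online A {lo = τ k} {hi = τ (suc k)} {x = q ^ toℕ i}
                    (same k {i} {j} {replicate r zero} {replicate r zero} k≤i (ℕ.≤-reflexive (sym j≡k)))
                    {s} s∈ (late , early , proj₂ (proj₂ window)))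

        windows : ∀ T w i → toℕ i ℕ.≤ toℕ T →
          b i ≡ 0 ⊎ Any (Window (τ (toℕ i)) (τ (suc (toℕ i))) (price (b i))) (run-on T w)
        windows T w i i≤T =
          [ inj₁
          , (λ reach → inj₂ (Any-Window-online A {continue i (replicate r zero)} {continue T w}
              {τ (toℕ i)} {τ (suc (toℕ i))} {price (b i)}
              (same (toℕ i) {i} {T} {replicate r zero} {w} ℕ.≤-refl i≤T) reach))
          ]′ (proj₁ (proj₂ (bid i)))

        module _ (g : Fin (suc ℓ) → Word ℓ r → ℚ) where
          total : Word ℓ (suc r) → ℚ
          total (T ∷ w) = spent b T ℚ.+ g T w

          total-charge : ∀ {T} → (∀ w → Charge (run-on T w) (τ (suc (toℕ T))) (g T w)) →
            ∀ w → Charge (services (run A (H ++ instanceOf (suc r) β (T ∷ w)))) β (total (T ∷ w))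
          total-charge {T} charge w = subst (λ I → Charge (services (run A I)) β (total (T ∷ w)))
            (List.++-assoc H (phase r β) (instanceOf r (τ (suc (toℕ T))) w))
            (Charge-windows b τ (λ i → tick-mono r β (ℕ.n≤1+n i)) T (windows T w) (charge w))

          total-bound : ∀ {T w} → g T w ℚ.≤ ι r ℚ.* phaseCost → total (T ∷ w) ℚ.≤ ι (suc r) ℚ.* phaseCost
          total-bound {T} {w} g≤ = begin
            spent b T ℚ.+ g T w                  ≤⟨ ℚ.+-mono-≤ (spent≤ (suc ℓ) b (λ i → proj₁ (bid i)) T) g≤ ⟩
            phaseCost ℚ.+ ι r ℚ.* phaseCost      ≡⟨ solve 2 (λ c r → c :+ r :* c := (con 1ℚ :+ r) :* c) refl phaseCost (ι r) ⟩
            ι (suc r) ℚ.* phaseCost              ∎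
            where open ℚ.≤-Reasoning

          total-average : (∀ T → ι r ℚ.* (v ℚ.* ι (suc ℓ)) ℚ.≤ 𝔼 (words ℓ r) (g T)) →
            ι (suc r) ℚ.* (v ℚ.* ι (suc ℓ)) ℚ.≤ 𝔼 (words ℓ (suc r)) total
          total-average avg = begin
            ι (suc r) ℚ.* V
              ≡⟨ solve 2 (λ r c → (con 1ℚ :+ r) :* c := r :* c :+ c) refl (ι r) V ⟩
            ι r ℚ.* V ℚ.+ V
              ≤⟨ ℚ.+-monoʳ-≤ (ι r ℚ.* V) (bidding-bound ℓ b covers) ⟩
            ι r ℚ.* V ℚ.+ average ℓ (spent b)
              ≡⟨ sym (average-shift ℓ (ι r ℚ.* V) (spent b)) ⟩
            average ℓ (λ T → ι r ℚ.* V ℚ.+ spent b T)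
              ≤⟨ average-mono ℓ (λ T → ℚ.+-monoˡ-≤ (spent b T) (avg T)) ⟩
            average ℓ (λ T → 𝔼 (words ℓ r) (g T) ℚ.+ spent b T)
              ≡⟨ average-cong ℓ (λ T → trans (ℚ.+-comm (𝔼 (words ℓ r) (g T)) (spent b T))
                  (sym (𝔼-words-shift ℓ r (spent b T) (g T)))) ⟩
            average ℓ (λ T → 𝔼 (words ℓ r) (λ w → total (T ∷ w)))
              ≡⟨ sym (𝔼-words-suc ℓ r total) ⟩
            𝔼 (words ℓ (suc r)) total ∎
            where
            open ℚ.≤-Reasoning
            V = v ℚ.* ι (suc ℓ)

    phase-bound : ¬ ¬ (∃[ g ]
      ( (∀ w → Charge (services (run A (H ++ instanceOf (suc r) β w))) β (g w))
      × (∀ w → g w ℚ.≤ ι (suc r) ℚ.* phaseCost)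
      × ι (suc r) ℚ.* (v ℚ.* ι (suc ℓ)) ℚ.≤ 𝔼 (words ℓ (suc r)) g ))
    phase-bound k =
      ¬¬-∀Fin (λ i → ¬¬-maximum (Reaches i) (suc ℓ)) λ bids →
      ¬¬-∀Fin (λ T → ih (H ++ phase r β) (τ (suc (toℕ T)))) λ later →
      let b   = λ i → proj₁ (bids i)
          bid = λ i → proj₂ (bids i)
          g   = λ T → proj₁ (later T)
      in k ( total b bid g
           , (λ { (T ∷ w) → total-charge b bid g (proj₁ (proj₂ (later T))) w })
           , (λ { (T ∷ w) → total-bound b bid g (proj₁ (proj₂ (proj₂ (later T))) w) })
           , total-average b bid g (λ T → proj₂ (proj₂ (proj₂ (later T)))) )

  algorithm-bound : ∀ A r → AlgorithmBound A r
  algorithm-bound A zero    H β k = k ((λ _ → 0ℚ) , (λ _ → done) , (λ _ → ℚ.≤-reflexive (sym (ℚ.*-zeroˡ phaseCost)))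
    , ℚ.≤-reflexive (trans (ℚ.*-zeroˡ (v ℚ.* ι (suc ℓ))) refl))
  algorithm-bound A (suc r) H β = phase-bound A (algorithm-bound A r) H β

-- The limit

-- Per phase, the algorithm's mean cost exceeds `e-seq M - δ` times the offline one by at least 1;
-- this surplus eventually outgrows the costs that do not depend on the number of phases.
Gap : ∀ {n} → Ratio n → ℕ → ℚ → ℕ → Set
Gap R M δ ℓ = (e-seq M ℚ.- δ) ℚ.* (1ℚ ℚ.+ ι ℓ ℚ.* u) ℚ.+ 1ℚ ℚ.≤ e-seq M ℚ.* t ℚ.* u ℚ.* ι (suc ℓ)
  where open Ratio R

gap : ∀ M δ → 0ℚ ℚ.< δ → ∃[ n ] ∃[ ℓ ] Gap (ratio n) M δ ℓ
gap M δ 0<δ =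
  -- `k` will be `ℓ u`. It is chosen so that `δ k` beats the constants; `n` comes after it, so that
  -- the loss `E k u` caused by `t = 1 - u` is at most 1.
  let k , k-large = archimedean-* δ 0<δ (e-seq M ℚ.+ 1ℚ ℚ.+ 1ℚ)
      n , n-large = archimedean (e-seq M ℚ.* ι k)
  in n , suc (suc n) ℕ.* k , bound k n k-large n-large
  where
  open ℚ.≤-Reasoning
  E = e-seq M
  0≤E : 0ℚ ℚ.≤ E
  0≤E = ℚ.≤-trans 0≤1 (1≤e-seq M)
  bound : ∀ k n → E ℚ.+ 1ℚ ℚ.+ 1ℚ ℚ.≤ δ ℚ.* ι k → E ℚ.* ι k ℚ.≤ ι n → Gap (ratio n) M δ (suc (suc n) ℕ.* k)
  bound k n k-large n-large = begin
    (E ℚ.- δ) ℚ.* (1ℚ ℚ.+ ι ℓ ℚ.* u) ℚ.+ 1ℚ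
      ≡⟨ cong (λ x → (E ℚ.- δ) ℚ.* (1ℚ ℚ.+ x) ℚ.+ 1ℚ) ℓu≡k ⟩
    (E ℚ.- δ) ℚ.* (1ℚ ℚ.+ ι k) ℚ.+ 1ℚ
      ≤⟨ ≤-by-diff (δ ℚ.+ (δ ℚ.* ι k ℚ.- (E ℚ.+ 1ℚ ℚ.+ 1ℚ))) (0≤+ (ℚ.<⇒≤ 0<δ) (≤⇒0≤diff k-large))
           (solve 3 (λ E d k → E :* k :- con 1ℚ := ((E :- d) :* (con 1ℚ :+ k) :+ con 1ℚ) :+
             (d :+ (d :* k :- (E :+ con 1ℚ :+ con 1ℚ)))) refl E δ (ι k)) ⟩
    E ℚ.* ι k ℚ.- 1ℚ
      ≤⟨ ≤-by-diff (1ℚ ℚ.- E ℚ.* ι k ℚ.* u) (≤⇒0≤diff Eku≤1)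
           (solve 3 (λ E k u → E :* (con 1ℚ :- u) :* k := E :* k :- con 1ℚ :+ (con 1ℚ :- E :* k :* u)) refl E (ι k) u) ⟩
    E ℚ.* (1ℚ ℚ.- u) ℚ.* ι k
      ≡⟨ cong₂ (λ x y → E ℚ.* x ℚ.* y) (sym t≡1-u) (sym ℓu≡k) ⟩
    E ℚ.* t ℚ.* (ι ℓ ℚ.* u)
      ≤⟨ ≤-by-diff (E ℚ.* t ℚ.* u) (0≤* (0≤* 0≤E 0≤t) 0≤u)
           (solve 4 (λ E t u l → E :* t :* u :* (con 1ℚ :+ l) := E :* t :* (l :* u) :+ E :* t :* u) refl E t u (ι ℓ)) ⟩
    E ℚ.* t ℚ.* u ℚ.* ι (suc ℓ) ∎
    where
    open Ratio (ratio n)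
    ℓ = suc (suc n) ℕ.* k
    ℓu≡k : ι ℓ ℚ.* u ≡ ι k
    ℓu≡k = begin-equality
      ι ℓ ℚ.* u                        ≡⟨ cong (ℚ._* u) (ι-* (suc (suc n)) k) ⟩
      ι (suc (suc n)) ℚ.* ι k ℚ.* u    ≡⟨ solve 3 (λ a k u → a :* k :* u := (a :* u) :* k) refl (ι (suc (suc n))) (ι k) u ⟩
      ι (suc (suc n)) ℚ.* u ℚ.* ι k    ≡⟨ cong (ℚ._* ι k) Nu≡1 ⟩
      1ℚ ℚ.* ι k                       ≡⟨ ℚ.*-identityˡ (ι k) ⟩
      ι k                              ∎
    Eku≤1 : E ℚ.* ι k ℚ.* u ℚ.≤ 1ℚ
    Eku≤1 = begin
      E ℚ.* ι k ℚ.* u         ≤⟨ *-monoˡ u 0≤u (ℚ.≤-trans n-large (ι-mono-≤ (ℕ.m≤n+m n 2))) ⟩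
      ι (suc (suc n)) ℚ.* u   ≡⟨ Nu≡1 ⟩
      1ℚ                      ∎

-- Divide the second inequality by the number m of phases and let m → ∞.
gap-contradiction : ∀ {r U V y} → r ℚ.* U ℚ.+ 1ℚ ℚ.≤ V → ¬ (∀ m → ι m ℚ.* V ℚ.≤ 1ℚ ℚ.+ r ℚ.* (ι m ℚ.* U ℚ.+ y))
gap-contradiction {r} {U} {V} {y} gap h =
  let k , bound = archimedean (1ℚ ℚ.+ r ℚ.* y) in
  ℚ.<-irrefl refl (ℚ.<-≤-trans (ι-mono-< (ℕ.n<1+n k)) (ℚ.≤-trans (m≤ (suc k)) bound))
  where
  open ℚ.≤-Reasoning
  m≤ : ∀ m → ι m ℚ.≤ 1ℚ ℚ.+ r ℚ.* y
  m≤ m = begin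
    ι m
      ≡⟨ solve 3 (λ m r U → m := m :* (r :* U :+ con 1ℚ) :- r :* (m :* U)) refl (ι m) r U ⟩
    ι m ℚ.* (r ℚ.* U ℚ.+ 1ℚ) ℚ.- r ℚ.* (ι m ℚ.* U)
      ≤⟨ ℚ.+-monoˡ-≤ (ℚ.- (r ℚ.* (ι m ℚ.* U))) (ℚ.≤-trans (*-monoʳ (ι m) (0≤ι m) gap) (h m)) ⟩
    1ℚ ℚ.+ r ℚ.* (ι m ℚ.* U ℚ.+ y) ℚ.- r ℚ.* (ι m ℚ.* U)
      ≡⟨ solve 4 (λ m r U y → con 1ℚ :+ r :* (m :* U :+ y) :- r :* (m :* U) := con 1ℚ :+ r :* y) refl (ι m) r U y ⟩
    1ℚ ℚ.+ r ℚ.* y ∎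

-- Trades the real `ρ` for a rational bound tied to one partial sum of e, after which only rational
-- arithmetic is left.
eventually-below : ∀ {ρ} → ρ < e → ∃[ M ] ∃[ δ ] (0ℚ ℚ.< δ × (∀ n → M ℕ.≤ n → seq ρ n ℚ.≤ e-seq M ℚ.- δ))
eventually-below {ρ} (ε , 0<ε , N , h) = below (isCauchy e (ε ℚ.* ½) (0<½ 0<ε))
  where
  open ℚ.≤-Reasoning
  below : ∃[ N′ ] (∀ m n → N′ ℕ.≤ m → N′ ℕ.≤ n → ℚ.∣ e-seq m ℚ.- e-seq n ∣ ℚ.< ε ℚ.* ½) →
    ∃[ M ] ∃[ δ ] (0ℚ ℚ.< δ × (∀ n → M ℕ.≤ n → seq ρ n ℚ.≤ e-seq M ℚ.- δ))
  below (N′ , close) = N ℕ.⊔ N′ , ε ℚ.* ½ , 0<½ 0<ε , λ n M≤n → bound (seq ρ n) (e-seq n) (e-seq (N ℕ.⊔ N′))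
    (h n (ℕ.m⊔n≤o⇒m≤o N N′ M≤n))
    (near (e-seq n) (e-seq (N ℕ.⊔ N′)) (close n (N ℕ.⊔ N′) (ℕ.m⊔n≤o⇒n≤o N N′ M≤n) (ℕ.m≤n⊔m N N′)))
    where
    bound : ∀ a b c → a ℚ.+ ε ℚ.≤ b → b ℚ.≤ c ℚ.+ ε ℚ.* ½ → a ℚ.≤ c ℚ.- ε ℚ.* ½
    bound a b c p q = begin
      a                                    ≡⟨ solve 2 (λ a e → a := a :+ e :- e) refl a ε ⟩
      a ℚ.+ ε ℚ.- ε                        ≤⟨ ℚ.+-monoˡ-≤ (ℚ.- ε) (ℚ.≤-trans p q) ⟩
      c ℚ.+ ε ℚ.* ½ ℚ.- ε                  ≡⟨ solve 2 (λ c e → c :+ e :* con ½ :- e := c :- e :* con ½) refl c ε ⟩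
      c ℚ.- ε ℚ.* ½                        ∎

*-eventually : ∀ {ρ x r o M} → (∀ n → M ℕ.≤ n → seq ρ n ℚ.≤ r) → 0ℚ ℚ.≤ o → (∀ n → seq x n ≡ o) → ρ * x ≼ fromℚ (r ℚ.* o)
*-eventually {ρ} {x} {r} {o} {M} ρ≤r 0≤o x≡o = ⌊ (λ ε 0<ε → M , λ n M≤n → ℚ.≤-trans
  (ℚ.≤-trans (ℚ.≤-reflexive (cong (seq ρ n ℚ.*_) (x≡o n))) (*-monoˡ o 0≤o (ρ≤r n M≤n))) (p≤p+q (ℚ.<⇒≤ 0<ε))) ⌋

-- Averaging over the random instances

module _ {ℓ′} (𝒜 : RandomizedAlgorithm ℓ′) (ρ : ℝ)
  (competitive : ∀ (I : Instance) (OPT : Solution) → IsOPT I OPT →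
    ∃[ c ] (IsExpectedCost 𝒜 I c × c ≤ ρ * cost OPT)) where
  open Measure (distribution 𝒜)

  𝔼ᴿ-mono : ∀ {W : Set} (D : Weighted W) → NonNegWeights D → ∀ {c h} → (∀ w → c w ≼ fromℚ (h w)) → 𝔼ᴿ D c ≼ fromℚ (𝔼 D h)
  𝔼ᴿ-mono []            []          c≤h = ≼-refl
  𝔼ᴿ-mono ((p , w) ∷ D) (0≤p ∷ 0≤D) {c} {h} c≤h = ≼-trans
    (⊞-mono (≼-trans (⊙-mono 0≤p (c≤h w)) (⊙-fromℚ p (h w))) (𝔼ᴿ-mono D 0≤D c≤h)) (⊞-fromℚ (p ℚ.* h w) (𝔼 D h))

  phases-bound : ∀ {n} (R : Ratio n) M ℓ {r} {N} → (∀ k → N ℕ.≤ k → seq ρ k ℚ.≤ r) →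
    let open Ratio R in
    ∀ m → ι m ℚ.* (e-seq M ℚ.* t ℚ.* u ℚ.* ι (suc ℓ)) ℚ.≤ 1ℚ ℚ.+ r ℚ.* (ι m ℚ.* (1ℚ ℚ.+ ι ℓ ℚ.* u) ℚ.+ q ^ ℓ)
  phases-bound R M ℓ {r} {N} ρ≤r m = fromℚ-cancel ⌈ begin
    fromℚ C
      ≲⟨ expectation-lower f (λ w → cost-measurable 𝒜 (I w)) (proj₁ cap) {c = c} (λ w → proj₁ (proj₂ (comp w)))
           (words-nonNeg ℓ m) (words-total ℓ m) 0≤C pointwise ⟩
    1ℝ ⊞ 𝔼ᴿ (words ℓ m) c
      ≲⟨ ⊞-mono ≼-refl (𝔼ᴿ-mono (words ℓ m) (words-nonNeg ℓ m) c≤) ⟩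
    1ℝ ⊞ fromℚ (𝔼 (words ℓ m) (λ w → r ℚ.* optCost w))
      ≲⟨ ⊞-fromℚ 1ℚ (𝔼 (words ℓ m) (λ w → r ℚ.* optCost w)) ⟩
    fromℚ (1ℚ ℚ.+ 𝔼 (words ℓ m) (λ w → r ℚ.* optCost w))
      ≡⟨ cong (λ x → fromℚ (1ℚ ℚ.+ x)) (trans (𝔼-*ˡ (words ℓ m) r optCost) (cong (r ℚ.*_) (𝔼-optCost ℓ m))) ⟩
    fromℚ (1ℚ ℚ.+ r ℚ.* (ι m ℚ.* (1ℚ ℚ.+ ι ℓ ℚ.* u) ℚ.+ q ^ ℓ)) ∎ ⌉
    where
    open ≼-Reasoning
    open Ratio R
    open Bidding R M
    open Adversary R M ℓ
    I : Word ℓ m → Instance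
    I = instanceOf m 0
    f : Word ℓ m → DeterministicAlgorithm → ℝ
    f w A = cost (run A (I w))
    comp : ∀ w → ∃[ c ] (IsExpectedCost 𝒜 (I w) c × c ≤ ρ * cost (opt m 0 w))
    comp w = competitive (I w) (opt m 0 w) (opt-isOPT m 0 w)
    c : Word ℓ m → ℝ
    c w = proj₁ (comp w)
    c≤ : ∀ w → c w ≼ fromℚ (r ℚ.* optCost w)
    c≤ w = ≼-trans ⌊ proj₂ (proj₂ (comp w)) ⌋
      (*-eventually {ρ} {cost (opt m 0 w)} {M = N} ρ≤r (0≤optCost w) (cost-opt m 0 w))
    C = ι m ℚ.* (v ℚ.* ι (suc ℓ))
    0≤C : 0ℚ ℚ.≤ C
    0≤C = 0≤* (0≤ι m) (0≤* 0≤v (0≤ι (suc ℓ)))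
    -- The truncation level is fixed before any algorithm or word is considered.
    cap : ∃[ J ] ι m ℚ.* phaseCost ℚ.≤ ι J
    cap = archimedean (ι m ℚ.* phaseCost)
    pointwise : ∀ A → ¬ ¬ (∃[ g ] ((∀ w → fromℚ (g w) ≤ f w A) × (∀ w → g w ℚ.≤ ι (proj₁ cap)) × C ℚ.≤ 𝔼 (words ℓ m) g))
    pointwise A k = algorithm-bound A m [] 0 λ (g , charge , g≤ , avg) →
      k (g , (λ w → ⌈ Charge-cost (services (run A (I w))) (charge w) ⌉) , (λ w → ℚ.≤-trans (g≤ w) (proj₂ cap)) , avg)

theorem3p3 : ∀ {ℓ} (𝒜 : RandomizedAlgorithm ℓ) (ρ : ℝ) →
    (∀ (I : Instance) (OPT : Solution) → IsOPT I OPT →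
    ∃[ c ] (IsExpectedCost 𝒜 I c × c ≤ ρ * cost OPT)) →
    e ≤ ρ
theorem3p3 𝒜 ρ competitive = ≮⇒≥ {e} {ρ} λ ρ<e →
  let M , δ , 0<δ , ρ≤r = eventually-below {ρ} ρ<e
      n , ℓ , large     = gap M δ 0<δ
      open Ratio (ratio n)
  in gap-contradiction {e-seq M ℚ.- δ} {1ℚ ℚ.+ ι ℓ ℚ.* u} {e-seq M ℚ.* t ℚ.* u ℚ.* ι (suc ℓ)} {q ^ ℓ} large
       (phases-bound 𝒜 ρ competitive (ratio n) M ℓ ρ≤r)
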